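{- Let $E(q)=\prod_{k\ge1}(1-q^k)$, $X=\dfrac{E(q^2)^4E(q^3)^8}{E(q)^8E(q^6)^4}$, $\xi=q^{ -2}\dfrac{E(q^2)^5E(q^9)^4}{E(q)^4E(q^{18})^5}$, and let $U$ be the operator $U\left(\sum_{n\ge n_0}a_nq^n\right)=\sum_{3n\ge n_0}a_{3n}q^n$. Define infinite integer matrices $(a(i,j))_{i,j\ge1}$ and $(b(i,j))_{i,j\ge1}$ as follows (all entries not specified, and all entries with an index $\le 0$, are $0$). For $1\le i\le 3$ the nonzero entries are: $(a(1,1),a(1,2),a(1,3))=(10,-36,27)$; $(a(2,1),\dots,a(2,6))=(-8,306,-2160,5508,-5832,2187)$; $(a(3,1),\dots,a(3,9))=(1,-360,10566,-99144,423549,-944784,1141614,-708588,177147)$; $(b(1,1),\dots,b(1,4))=(-9,252,-891,729)$; $(b(2,1),\dots,b(2,7))=(1,-378,8613,-54675,138510,-150903,59049)$; $(b(3,1),\dots,b(3,10))=(0,147,-14553,312255,-2617839,10764414,-23914845,29288304,-18600435,4782969)$. For $i\ge 4$ and all $j\ge1$, both $m=a$ and $m=b$ satisfy $$m(i,j)=30m(i-1,j-1)-108m(i-1,j-2)+81m(i-1,j-3)-12m(i-2,j-1)+9m(i-2,j-2)+m(i-3,j-1).$$ Then for every $i\ge 1$, $$U(X^i)=\sum_{j\ge1}a(i,j)X^j,\qquad U(\xi X^i)=\sum_{j\ge1}b(i,j)X^j.$$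
   Context: All objects are formal Laurent series in $q$; the sums over $j$ are finite. -}

module Defs where

open import Data.Nat as ℕ using (ℕ; zero; suc; NonZero; _≡ᵇ_; _≤ᵇ_)
open import Data.Nat.DivMod using (_/_; _%_)
open import Data.Integer as ℤ using (ℤ; +_; -[1+_]; -_)
open import Data.List using (List; []; _∷_)
open import Data.Bool using (if_then_else_)

-- Formal power series with integer coefficients: n ↦ coefficient of q^n
PS : Set
PS = ℕ → ℤ

-- Formal Laurent series with integer coefficients: n ↦ coefficient of q^n
-- (only used for series bounded below)
LS : Set
LS = ℤ → ℤ

sumUpTo : ℕ → (ℕ → ℤ) → ℤ
sumUpTo zero    f = f 0
sumUpTo (suc n) f = sumUpTo n f ℤ.+ f (suc n)

sum1To : ℕ → (ℕ → ℤ) → ℤ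
sum1To zero    f = + 0
sum1To (suc n) f = sum1To n f ℤ.+ f (suc n)

oneP : PS
oneP zero    = + 1
oneP (suc n) = + 0

_*P_ : PS → PS → PS
(f *P g) n = sumUpTo n (λ k → f k ℤ.* g (n ℕ.∸ k))

infixl 7 _*P_

_^P_ : PS → ℕ → PS
f ^P zero    = oneP
f ^P (suc k) = f *P (f ^P k)

infixr 8 _^P_

oneMinusQ : ℕ → PS
oneMinusQ k n = if n ≡ᵇ 0 then + 1 else (if n ≡ᵇ k then - (+ 1) else + 0)

finProd : ℕ → PS
finProd zero    = oneP
finProd (suc m) = finProd m *P oneMinusQ (suc m)

-- E(q) = ∏_{k≥1} (1 - q^k): the coefficient of q^n only depends on the
-- factors with k ≤ n.
E : PS
E n = finProd n n

dil : (m : ℕ) → .{{NonZero m}} → PS → PS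
dil m f n = if (n % m) ≡ᵇ 0 then f (n / m) else + 0

-- Multiplicative inverse of a power series with constant term 1:
-- g 0 = 1, g (N+1) = - Σ_{k=1}^{N+1} f k * g (N+1-k).
-- invAux f N = [g N, g (N-1), ..., g 0].
private
  conv : PS → ℕ → List ℤ → ℤ
  conv f i []       = + 0
  conv f i (x ∷ xs) = f (suc i) ℤ.* x ℤ.+ conv f (suc i) xs

  invAux : PS → ℕ → List ℤ
  invAux f zero    = + 1 ∷ []
  invAux f (suc N) = let L = invAux f N in (- conv f 0 L) ∷ L

  headZ : List ℤ → ℤ
  headZ []      = + 0
  headZ (x ∷ _) = x

inv : PS → PS
inv f n = headZ (invAux f n)

X : PS
X = (dil 2 E ^P 4) *P (dil 3 E ^P 8) *P (inv E ^P 8) *P (inv (dil 6 E) ^P 4)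

q2ξ : PS
q2ξ = (dil 2 E ^P 5) *P (dil 9 E ^P 4) *P (inv E ^P 4) *P (inv (dil 18 E) ^P 5)

toLS : PS → LS
toLS f (+ n)    = f n
toLS f -[1+ n ] = + 0

qShift : ℤ → LS → LS
qShift k f n = f (n ℤ.- k)

ξX^ : ℕ → LS
ξX^ i = qShift (- (+ 2)) (toLS (q2ξ *P (X ^P i)))

X^ : ℕ → LS
X^ i = toLS (X ^P i)

U : LS → LS
U f n = f (+ 3 ℤ.* n)

-- The matrices. Indices are natural numbers; index 0 (and any
-- "negative" index) gives entry 0.

rowOf : List ℤ → ℕ → ℤ
rowOf l zero = + 0
rowOf [] (suc j) = + 0
rowOf (x ∷ xs) (suc zero) = x
rowOf (x ∷ xs) (suc (suc j)) = rowOf xs (suc j)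

sh : (ℕ → ℤ) → ℕ → ℕ → ℤ
sh r k j = if k ℕ.≤ᵇ j then r (j ℕ.∸ k) else + 0

step : (ℕ → ℤ) → (ℕ → ℤ) → (ℕ → ℤ) → ℕ → ℤ
step r1 r2 r3 zero = + 0
step r1 r2 r3 j =
  (+ 30 ℤ.* sh r1 1 j) ℤ.- (+ 108 ℤ.* sh r1 2 j) ℤ.+ (+ 81 ℤ.* sh r1 3 j)
  ℤ.- (+ 12 ℤ.* sh r2 1 j) ℤ.+ (+ 9 ℤ.* sh r2 2 j) ℤ.+ sh r3 1 j

mat : List ℤ → List ℤ → List ℤ → ℕ → ℕ → ℤ
mat l1 l2 l3 zero = λ _ → + 0
mat l1 l2 l3 (suc zero) = rowOf l1
mat l1 l2 l3 (suc (suc zero)) = rowOf l2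
mat l1 l2 l3 (suc (suc (suc zero))) = rowOf l3
mat l1 l2 l3 (suc (suc (suc (suc i)))) =
  step (mat l1 l2 l3 (suc (suc (suc i)))) (mat l1 l2 l3 (suc (suc i)))
       (mat l1 l2 l3 (suc i))

a : ℕ → ℕ → ℤ
a = mat (+ 10 ∷ - (+ 36) ∷ + 27 ∷ [])
        (- (+ 8) ∷ + 306 ∷ - (+ 2160) ∷ + 5508 ∷ - (+ 5832) ∷ + 2187 ∷ [])
        (+ 1 ∷ - (+ 360) ∷ + 10566 ∷ - (+ 99144) ∷ + 423549 ∷ - (+ 944784)
          ∷ + 1141614 ∷ - (+ 708588) ∷ + 177147 ∷ [])

b : ℕ → ℕ → ℤ
b = mat (- (+ 9) ∷ + 252 ∷ - (+ 891) ∷ + 729 ∷ [])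
        (+ 1 ∷ - (+ 378) ∷ + 8613 ∷ - (+ 54675) ∷ + 138510 ∷ - (+ 150903)
          ∷ + 59049 ∷ [])
        (+ 0 ∷ + 147 ∷ - (+ 14553) ∷ + 312255 ∷ - (+ 2617839) ∷ + 10764414
          ∷ - (+ 23914845) ∷ + 29288304 ∷ - (+ 18600435) ∷ + 4782969 ∷ [])

-- Σ_{j≥1} m(i,j) X^j as a Laurent series.  Row i of a and of b vanishes
-- for j > 3i+1 (immediate induction from the recurrence), so the sum is
-- the finite sum over 1 ≤ j ≤ 3i+1.
sumX : (ℕ → ℕ → ℤ) → ℕ → LS
sumX m i n = sum1To (3 ℕ.* i ℕ.+ 1) (λ j → m i j ℤ.* X^ j n)

-- Write E_k = E(q^k), v = q E_3 E_18³ / (E_6 E_9³) and u = 1 - 2v, w = 1 + v. The Jacobi triple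
-- product turns φ(-q) = E_1²/E_2 and ψ(q) = E_2²/E_1 into theta series; sorting their exponents
-- modulo 3 gives
--   E_1²/E_2 = (E_9²/E_18) u,   E_2²/E_1 = (E_6 E_9²/(E_3 E_18)) w.
-- Let h = q E_1³ E_6⁹ / (E_2³ E_3⁹), so that h(q³) = v³. The level 6 identities
--   X (1 - 8h) = 1,   E_2⁵ E_6 / (E_1 E_3⁵) = 1 + h
-- at q³ imply, through the two dissections, the same identities at q. Hence their validity modulo
-- q^N implies their validity modulo q^(3N), and they hold. With Y = X(q³) they give
-- Y (1 - 8v³) = 1 and X = Y³ (1 + 2v + 4v²)⁴, and similarly ξ becomes a polynomial in Y and v up
-- to a factor in q³. As v is q times a series in q³, U is read off by reducing modulo
-- 8v³ = 1 - 1/Y; the recurrence for the rows is the cubic equation of X over ℤ[Y].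

{-# OPTIONS --safe #-}
module Submission where

open import Defs
open import Algebra.Bundles using (CommutativeRing)
open import Algebra.Structures using (IsCommutativeRing)
import Algebra.Properties.CommutativeSemiring.Exp as CExp
import Algebra.Properties.Semiring.Exp as Exp
import Algebra.Solver.Ring as RingSolver
import Algebra.Solver.Ring.AlmostCommutativeRing as ACR
open import Data.Bool using (true; false; if_then_else_)
open import Data.Fin using (Fin; zero; suc)
open import Data.Fin.Patterns
open import Data.Integer as ℤ using (ℤ; +_; -[1+_]) renaming (-_ to neg)
import Data.Integer.Properties as ℤₚ
import Data.Integer.Tactic.RingSolver as ℤSolver
open import Data.List using (List; []; _∷_; length)
open import Data.Maybe using (Maybe; just; nothing)
open import Data.Nat as ℕ using (ℕ; zero; suc; _≤_; _<_; z≤n; s≤s; _≡ᵇ_)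
import Data.Nat.DivMod as DivMod
import Data.Nat.Properties as ℕₚ
import Data.Nat.Tactic.RingSolver as ℕSolver
open import Data.Product using (_×_; _,_; proj₁)
open import Data.Vec as Vec using (Vec; []; _∷_; lookup; zipWith; replicate)
open import Level using (0ℓ)
open import Relation.Binary.PropositionalEquality as ≡ using (_≡_; cong; cong₂; subst)
import Relation.Binary.Reasoning.Setoid as SetoidReasoning
open import Relation.Nullary using (yes; no)

-- Formal power series as a commutative ring

-- The descent from q³ to q is a congruence argument, so its algebra must be available modulo q^N as
-- well as exactly. It is therefore written over an arbitrary commutative ring with a map from ℤ,
-- and used in ℤ[[q]] and in ℤ[[q]]/(q^N). The two level 6 identities travel together because
-- neither closes alone: the one for 1 + h at q³ supplies 1 + v³ = (1 + v)(1 - v + v²), whose factor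
-- 1 + v cancels against `Wm` and so yields h at q as a polynomial in v and Y; the one for X at q³
-- is what then turns this polynomial into both identities at q. Infinite products are handled only
-- as limits whose n-th term is already right modulo q^n. The triple product is proved in finite
-- form, with Gaussian binomials defined by a recursion free of division, and only then passed to
-- the limit. Equalities of pure eta quotients are settled by comparing exponent vectors; everything
-- else becomes a polynomial identity in v and Y.

module PowerSeries where

  open ≡ using (refl; sym; trans; module ≡-Reasoning)

  infix 4 _≡[_]_ _≈P_
  infixl 6 _+P_ _⊕_
  infixl 7 _·_
  infix 8 ⊖_

  _≡[_]_ : PS → ℕ → PS → Set
  f ≡[ N ] g = ∀ n → n < N → f n ≡ g n

  _≈P_ : PS → PS → Set
  f ≈P g = ∀ n → f n ≡ g n

  _+P_ : PS → PS → PS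
  (f +P g) n = f n ℤ.+ g n

  -P_ : PS → PS
  (-P f) n = ℤ.- f n

  constP : ℤ → PS
  constP c zero    = c
  constP c (suc n) = + 0

  tailP : PS → PS
  tailP f n = f (suc n)

  q : PS
  q zero = + 0
  q (suc n) = oneP n

  sumUpTo-cong : ∀ n {f g : ℕ → ℤ} → (∀ k → k ≤ n → f k ≡ g k) → sumUpTo n f ≡ sumUpTo n g
  sumUpTo-cong zero    h = h 0 z≤n
  sumUpTo-cong (suc n) h =
    cong₂ ℤ._+_ (sumUpTo-cong n (λ k k≤n → h k (ℕₚ.m≤n⇒m≤1+n k≤n))) (h (suc n) ℕₚ.≤-refl)

  sumUpTo-head : ∀ n (f : ℕ → ℤ) → sumUpTo (suc n) f ≡ f 0 ℤ.+ sumUpTo n (λ k → f (suc k))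
  sumUpTo-head zero    f = refl
  sumUpTo-head (suc n) f =
    trans (cong (ℤ._+ f (suc (suc n))) (sumUpTo-head n f)) (ℤₚ.+-assoc (f 0) _ _)

  sumUpTo-0 : ∀ n {f : ℕ → ℤ} → (∀ k → k ≤ n → f k ≡ + 0) → sumUpTo n f ≡ + 0
  sumUpTo-0 zero    h = h 0 z≤n
  sumUpTo-0 (suc n) h =
    cong₂ ℤ._+_ (sumUpTo-0 n (λ k k≤n → h k (ℕₚ.m≤n⇒m≤1+n k≤n))) (h (suc n) ℕₚ.≤-refl)

  *P-suc : ∀ f g n → (f *P g) (suc n) ≡ f 0 ℤ.* g (suc n) ℤ.+ (tailP f *P g) n
  *P-suc f g n = sumUpTo-head n (λ k → f k ℤ.* g (suc n ℕ.∸ k))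

  *P-suc′ : ∀ f g n → (f *P g) (suc n) ≡ (f *P tailP g) n ℤ.+ f (suc n) ℤ.* g 0
  *P-suc′ f g n = cong₂ ℤ._+_
    (sumUpTo-cong n (λ k k≤n → cong (λ t → f k ℤ.* g t) (ℕₚ.+-∸-assoc 1 k≤n)))
    (cong (λ t → f (suc n) ℤ.* g t) (ℕₚ.n∸n≡0 n))

  *P-cong[] : ∀ N {f f′ g g′} → f ≡[ N ] f′ → g ≡[ N ] g′ → (f *P g) ≡[ N ] (f′ *P g′)
  *P-cong[] N p r n n<N = sumUpTo-cong n λ k k≤n →
    cong₂ ℤ._*_ (p k (ℕₚ.≤-<-trans k≤n n<N)) (r (n ℕ.∸ k) (ℕₚ.≤-<-trans (ℕₚ.m∸n≤m n k) n<N))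

  *P-cong : ∀ {f f′ g g′} → f ≈P f′ → g ≈P g′ → (f *P g) ≈P (f′ *P g′)
  *P-cong p r n = sumUpTo-cong n λ k _ → cong₂ ℤ._*_ (p k) (r (n ℕ.∸ k))

  *P-comm : ∀ f g → (f *P g) ≈P (g *P f)
  *P-comm f g zero = ℤₚ.*-comm (f 0) (g 0)
  *P-comm f g (suc n) = begin
    (f *P g) (suc n)                             ≡⟨ *P-suc f g n ⟩
    f 0 ℤ.* g (suc n) ℤ.+ (tailP f *P g) n       ≡⟨ cong₂ ℤ._+_ (ℤₚ.*-comm (f 0) _) (*P-comm (tailP f) g n) ⟩
    g (suc n) ℤ.* f 0 ℤ.+ (g *P tailP f) n       ≡⟨ ℤₚ.+-comm (g (suc n) ℤ.* f 0) _ ⟩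
    (g *P tailP f) n ℤ.+ g (suc n) ℤ.* f 0       ≡⟨ *P-suc′ g f n ⟨
    (g *P f) (suc n)                             ∎
    where open ≡-Reasoning

  *P-distribʳ : ∀ f g h → ((g +P h) *P f) ≈P ((g *P f) +P (h *P f))
  *P-distribʳ f g h zero = ℤₚ.*-distribʳ-+ (f 0) (g 0) (h 0)
  *P-distribʳ f g h (suc n) = begin
    ((g +P h) *P f) (suc n)
      ≡⟨ *P-suc (g +P h) f n ⟩
    (g 0 ℤ.+ h 0) ℤ.* f (suc n) ℤ.+ ((tailP g +P tailP h) *P f) n
      ≡⟨ cong (λ t → (g 0 ℤ.+ h 0) ℤ.* f (suc n) ℤ.+ t) (*P-distribʳ f (tailP g) (tailP h) n) ⟩
    (g 0 ℤ.+ h 0) ℤ.* f (suc n) ℤ.+ ((tailP g *P f) n ℤ.+ (tailP h *P f) n)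
      ≡⟨ rearrange (g 0) (h 0) (f (suc n)) _ _ ⟩
    (g 0 ℤ.* f (suc n) ℤ.+ (tailP g *P f) n) ℤ.+ (h 0 ℤ.* f (suc n) ℤ.+ (tailP h *P f) n)
      ≡⟨ cong₂ ℤ._+_ (*P-suc g f n) (*P-suc h f n) ⟨
    ((g *P f) +P (h *P f)) (suc n) ∎
    where
    open ≡-Reasoning
    rearrange : ∀ a b c x y → (a ℤ.+ b) ℤ.* c ℤ.+ (x ℤ.+ y) ≡ (a ℤ.* c ℤ.+ x) ℤ.+ (b ℤ.* c ℤ.+ y)
    rearrange = ℤSolver.solve-∀

  scale-*P : ∀ c f g n → ((λ k → c ℤ.* f k) *P g) n ≡ c ℤ.* (f *P g) n
  scale-*P c f g zero = ℤₚ.*-assoc c (f 0) (g 0)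
  scale-*P c f g (suc n) = begin
    ((λ k → c ℤ.* f k) *P g) (suc n)
      ≡⟨ *P-suc (λ k → c ℤ.* f k) g n ⟩
    c ℤ.* f 0 ℤ.* g (suc n) ℤ.+ ((λ k → c ℤ.* f (suc k)) *P g) n
      ≡⟨ cong (λ t → c ℤ.* f 0 ℤ.* g (suc n) ℤ.+ t) (scale-*P c (tailP f) g n) ⟩
    c ℤ.* f 0 ℤ.* g (suc n) ℤ.+ c ℤ.* (tailP f *P g) n
      ≡⟨ rearrange c (f 0) (g (suc n)) _ ⟩
    c ℤ.* (f 0 ℤ.* g (suc n) ℤ.+ (tailP f *P g) n)
      ≡⟨ cong (c ℤ.*_) (*P-suc f g n) ⟨
    c ℤ.* (f *P g) (suc n) ∎
    where
    open ≡-Reasoning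
    rearrange : ∀ c x y z → c ℤ.* x ℤ.* y ℤ.+ c ℤ.* z ≡ c ℤ.* (x ℤ.* y ℤ.+ z)
    rearrange = ℤSolver.solve-∀

  *P-assoc : ∀ f g h → ((f *P g) *P h) ≈P (f *P (g *P h))
  *P-assoc f g h zero = ℤₚ.*-assoc (f 0) (g 0) (h 0)
  *P-assoc f g h (suc n) = begin
    ((f *P g) *P h) (suc n)
      ≡⟨ *P-suc (f *P g) h n ⟩
    f 0 ℤ.* g 0 ℤ.* h (suc n) ℤ.+ (tailP (f *P g) *P h) n
      ≡⟨ cong (λ t → f 0 ℤ.* g 0 ℤ.* h (suc n) ℤ.+ t)
           (trans (*P-cong {g = h} (*P-suc f g) (λ _ → refl) n)
           (trans (*P-distribʳ h (λ k → f 0 ℤ.* tailP g k) (tailP f *P g) n)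
           (cong₂ ℤ._+_ (scale-*P (f 0) (tailP g) h n) (*P-assoc (tailP f) g h n)))) ⟩
    f 0 ℤ.* g 0 ℤ.* h (suc n) ℤ.+ (f 0 ℤ.* (tailP g *P h) n ℤ.+ (tailP f *P (g *P h)) n)
      ≡⟨ rearrange (f 0) (g 0) (h (suc n)) _ _ ⟩
    f 0 ℤ.* (g 0 ℤ.* h (suc n) ℤ.+ (tailP g *P h) n) ℤ.+ (tailP f *P (g *P h)) n
      ≡⟨ cong (λ t → f 0 ℤ.* t ℤ.+ (tailP f *P (g *P h)) n) (*P-suc g h n) ⟨
    f 0 ℤ.* (g *P h) (suc n) ℤ.+ (tailP f *P (g *P h)) n
      ≡⟨ *P-suc f (g *P h) n ⟨
    (f *P (g *P h)) (suc n) ∎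
    where
    open ≡-Reasoning
    rearrange : ∀ a b c x y → a ℤ.* b ℤ.* c ℤ.+ (a ℤ.* x ℤ.+ y) ≡ a ℤ.* (b ℤ.* c ℤ.+ x) ℤ.+ y
    rearrange = ℤSolver.solve-∀

  zero-*P : ∀ {f} g → (∀ n → f n ≡ + 0) → ∀ n → (f *P g) n ≡ + 0
  zero-*P g f≡0 n = sumUpTo-0 n λ k _ → cong (ℤ._* g (n ℕ.∸ k)) (f≡0 k)

  constP-*P : ∀ c f n → (constP c *P f) n ≡ c ℤ.* f n
  constP-*P c f zero    = refl
  constP-*P c f (suc n) = trans (*P-suc (constP c) f n)
    (trans (cong (λ t → c ℤ.* f (suc n) ℤ.+ t) (zero-*P f (λ _ → refl) n)) (ℤₚ.+-identityʳ _))

  constP-1 : constP (+ 1) ≈P oneP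
  constP-1 zero    = refl
  constP-1 (suc n) = refl

  constP-0 : constP (+ 0) ≈P (λ _ → + 0)
  constP-0 zero    = refl
  constP-0 (suc n) = refl

  *P-identityˡ : ∀ f → (oneP *P f) ≈P f
  *P-identityˡ f n = trans (*P-cong {g = f} (λ k → sym (constP-1 k)) (λ _ → refl) n)
    (trans (constP-*P (+ 1) f n) (ℤₚ.*-identityˡ (f n)))

  -- The coefficient recursion behind inv uses private functions of Defs; convTail f i N
  -- (the sum Σ_k f(i+1+k)·inv f (N-k)) is obtained from it by unification.
  mutual
    convTail : PS → ℕ → ℕ → ℤ
    convTail = _

    inv-suc : ∀ f N → inv f (suc N) ≡ ℤ.- convTail f 0 N
    -- Replacing the start index 0 by a variable makes `convTail` occur applied to distinct
    -- variables, which lets unification determine it for every start index.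
    inv-suc f N with 0
    ... | i = unfold
      where
      unfold : ℤ.- _ ≡ ℤ.- convTail f i N
      unfold = refl

  -- The start index `i` stays general because each step of the recursion advances along `f` while
  -- moving down in `inv f`.
  convTail-*P : ∀ f i N → convTail f i N ≡ ((λ k → f (suc i ℕ.+ k)) *P inv f) N
  convTail-*P f i zero    = trans (ℤₚ.+-identityʳ _) (cong (λ t → f (suc t) ℤ.* + 1) (sym (ℕₚ.+-identityʳ i)))
  convTail-*P f i (suc N) = trans
    (cong₂ (λ t r → f (suc t) ℤ.* inv f (suc N) ℤ.+ r) (sym (ℕₚ.+-identityʳ i))
      (trans (convTail-*P f (suc i) N)
        (*P-cong {g = inv f} (λ k → cong (λ t → f (suc t)) (sym (ℕₚ.+-suc i k))) (λ _ → refl) N)))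
    (sym (*P-suc (λ k → f (suc i ℕ.+ k)) (inv f) N))

  *P-inv : ∀ f → f 0 ≡ + 1 → (f *P inv f) ≈P oneP
  *P-inv f f0 zero    = cong (ℤ._* + 1) f0
  *P-inv f f0 (suc n) = begin
    (f *P inv f) (suc n)                                   ≡⟨ *P-suc f (inv f) n ⟩
    f 0 ℤ.* inv f (suc n) ℤ.+ (tailP f *P inv f) n         ≡⟨ cong₂ (λ s t → s ℤ.* t ℤ.+ (tailP f *P inv f) n) f0
                                                                (trans (inv-suc f n) (cong ℤ.-_ (convTail-*P f 0 n))) ⟩
    + 1 ℤ.* ℤ.- (tailP f *P inv f) n ℤ.+ (tailP f *P inv f) n ≡⟨ cancel ((tailP f *P inv f) n) ⟩
    + 0 ∎
    where
    open ≡-Reasoning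
    cancel : ∀ x → + 1 ℤ.* ℤ.- x ℤ.+ x ≡ + 0
    cancel = ℤSolver.solve-∀

  0P : PS
  0P _ = + 0

  -- The ring operations are opaque so that unification treats them as injective.
  opaque
    _⊕_ _·_ : PS → PS → PS
    _⊕_ = _+P_
    _·_ = _*P_

    ⊖_ : PS → PS
    ⊖_ = -P_

  opaque
    unfolding _⊕_

    ·-*P : ∀ f g → f · g ≡ f *P g
    ·-*P f g = refl

    ⊕-at : ∀ f g n → (f ⊕ g) n ≡ f n ℤ.+ g n
    ⊕-at f g n = refl

    ⊖-at : ∀ f n → (⊖ f) n ≡ ℤ.- f n
    ⊖-at f n = refl

    constP-· : ∀ c f n → (constP c · f) n ≡ c ℤ.* f n
    constP-· = constP-*P

    ·-at0 : ∀ f g → (f · g) 0 ≡ f 0 ℤ.* g 0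
    ·-at0 f g = refl

    q·-suc : ∀ f n → (q · f) (suc n) ≡ f n
    q·-suc f n = trans (*P-suc q f n) (trans (ℤₚ.+-identityˡ _) (*P-identityˡ f n))

    ·-vanish : ∀ f g n → (∀ k → k ≤ n → f k ℤ.* g (n ℕ.∸ k) ≡ + 0) → (f · g) n ≡ + 0
    ·-vanish f g n = sumUpTo-0 n

    ·-inv : ∀ f → f 0 ≡ + 1 → (f · inv f) ≈P oneP
    ·-inv = *P-inv

    psIsCommutativeRing : IsCommutativeRing _≈P_ _⊕_ _·_ ⊖_ 0P oneP
    psIsCommutativeRing = record
      { isRing = record
        { +-isAbelianGroup = record
          { isGroup = record
            { isMonoid = record
              { isSemigroup = record
                { isMagma = record
                  { isEquivalence = record
                    { refl = λ _ → refl
                    ; sym = λ p n → sym (p n)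
                    ; trans = λ p r n → trans (p n) (r n) }
                  ; ∙-cong = λ p r n → cong₂ ℤ._+_ (p n) (r n) }
                ; assoc = λ f g h n → ℤₚ.+-assoc (f n) (g n) (h n) }
              ; identity = (λ f n → ℤₚ.+-identityˡ (f n)) , (λ f n → ℤₚ.+-identityʳ (f n)) }
            ; inverse = (λ f n → ℤₚ.+-inverseˡ (f n)) , (λ f n → ℤₚ.+-inverseʳ (f n))
            ; ⁻¹-cong = λ p n → cong ℤ.-_ (p n) }
          ; comm = λ f g n → ℤₚ.+-comm (f n) (g n) }
        ; *-cong = *P-cong
        ; *-assoc = *P-assoc
        ; *-identity = *P-identityˡ , (λ f n → trans (*P-comm f oneP n) (*P-identityˡ f n))
        ; distrib = (λ f g h n → trans (*P-comm f (g +P h) n) (trans (*P-distribʳ f g h n)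
                       (cong₂ ℤ._+_ (*P-comm g f n) (*P-comm h f n))))
                  , (λ f g h → *P-distribʳ f g h) }
      ; *-comm = *P-comm }

  psRing : CommutativeRing 0ℓ 0ℓ
  psRing = record { isCommutativeRing = psIsCommutativeRing }

  opaque
    unfolding _⊕_

    psIsCommutativeRingMod : ∀ N → IsCommutativeRing _≡[ N ]_ _⊕_ _·_ ⊖_ 0P oneP
    psIsCommutativeRingMod N = record
      { isRing = record
        { +-isAbelianGroup = record
          { isGroup = record
            { isMonoid = record
              { isSemigroup = record
                { isMagma = record
                  { isEquivalence = record
                    { refl = λ _ _ → refl
                    ; sym = λ p n l → sym (p n l)
                    ; trans = λ p r n l → trans (p n l) (r n l) }
                  ; ∙-cong = λ p r n l → cong₂ ℤ._+_ (p n l) (r n l) }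
                ; assoc = λ f g h → weaken (P.+-assoc f g h) }
              ; identity = (λ f → weaken (P.+-identityˡ f)) , (λ f → weaken (P.+-identityʳ f)) }
            ; inverse = (λ f → weaken (P.-‿inverseˡ f)) , (λ f → weaken (P.-‿inverseʳ f))
            ; ⁻¹-cong = λ p n l → cong ℤ.-_ (p n l) }
          ; comm = λ f g → weaken (P.+-comm f g) }
        ; *-cong = *P-cong[] N
        ; *-assoc = λ f g h → weaken (P.*-assoc f g h)
        ; *-identity = (λ f → weaken (P.*-identityˡ f)) , (λ f → weaken (P.*-identityʳ f))
        ; distrib = (λ f g h → weaken (P.distribˡ f g h)) , (λ f g h → weaken (P.distribʳ f g h)) }
      ; *-comm = λ f g → weaken (P.*-comm f g) }
      where
      module P = CommutativeRing psRing
      weaken : ∀ {f g} → f ≈P g → f ≡[ N ] g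
      weaken p n _ = p n

  -- ℤ[[q]]/(q^N), presented by the same carrier with a coarser equality, so that exact identities
  -- weaken to it without any change of terms.
  psRingMod : ℕ → CommutativeRing 0ℓ 0ℓ
  psRingMod N = record { isCommutativeRing = psIsCommutativeRingMod N }

  opaque
    unfolding _⊕_

    constP-+ : ∀ c d → constP (c ℤ.+ d) ≈P (constP c ⊕ constP d)
    constP-+ c d zero    = refl
    constP-+ c d (suc n) = refl

    constP-* : ∀ c d → constP (c ℤ.* d) ≈P (constP c · constP d)
    constP-* c d zero    = refl
    constP-* c d (suc n) = sym (trans (constP-*P c (constP d) (suc n)) (ℤₚ.*-zeroʳ c))

    constP-neg : ∀ c → constP (ℤ.- c) ≈P (⊖ constP c)
    constP-neg c zero    = refl
    constP-neg c (suc n) = refl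

  constP-morphism : ℤ.+-*-rawRing ACR.-Raw-AlmostCommutative⟶ ACR.fromCommutativeRing psRing
  constP-morphism = record
    { ⟦_⟧ = constP
    ; +-homo = constP-+
    ; *-homo = constP-*
    ; -‿homo = constP-neg
    ; 0-homo = constP-0
    ; 1-homo = constP-1 }

  constP-morphismMod : ∀ N → ℤ.+-*-rawRing ACR.-Raw-AlmostCommutative⟶ ACR.fromCommutativeRing (psRingMod N)
  constP-morphismMod N = record
    { ⟦_⟧ = constP
    ; +-homo = λ c d n _ → constP-+ c d n
    ; *-homo = λ c d n _ → constP-* c d n
    ; -‿homo = λ c n _ → constP-neg c n
    ; 0-homo = λ n _ → constP-0 n
    ; 1-homo = λ n _ → constP-1 n }

open PowerSeries

-- Identities in an arbitrary commutative ring

module RingKit (R : CommutativeRing 0ℓ 0ℓ)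
  (μ : ℤ.+-*-rawRing ACR.-Raw-AlmostCommutative⟶ ACR.fromCommutativeRing R) where

  open CommutativeRing R public
  open ACR._-Raw-AlmostCommutative⟶_ μ public using () renaming (⟦_⟧ to ι; 0-homo to ι-0; 1-homo to ι-1; +-homo to ι-+)
  open Exp semiring public using (_^_; ^-homo-*; ^-assocʳ; ^-congˡ)
  open CExp commutativeSemiring public using (^-distrib-*)
  module ≈-Reasoning = SetoidReasoning setoid
  open ≈-Reasoning

  _ι≟_ : ∀ c d → Maybe (ι c ≈ ι d)
  c ι≟ d with c ℤ.≟ d
  ... | yes ≡.refl = just refl
  ... | no _       = nothing

  module S = RingSolver ℤ.+-*-rawRing (ACR.fromCommutativeRing R) μ _ι≟_
  open S public using (solve; _:=_; _:+_; _:*_; _:-_; _:^_; :-_; con; Polynomial)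

  -- The exponent 0 makes this evaluate to 1# itself rather than to ι (+ 1).
  :1 : ∀ {n} → Polynomial n
  :1 = con (+ 1) :^ 0

  -0≈0 : - 0# ≈ 0#
  -0≈0 = trans (sym (+-identityˡ _)) (-‿inverseʳ 0#)

  ^-≡ : ∀ x {m n} → m ≡ n → x ^ m ≈ x ^ n
  ^-≡ x p = reflexive (cong (x ^_) p)

  -- The shifted factorial (-x; y)_n
  poch : Carrier → Carrier → ℕ → Carrier
  poch x y zero    = 1#
  poch x y (suc n) = poch x y n * (1# + x * y ^ n)

  poch-cong : ∀ {x x′ y y′} n → x ≈ x′ → y ≈ y′ → poch x y n ≈ poch x′ y′ n
  poch-cong zero    p r = refl
  poch-cong (suc n) p r = *-cong (poch-cong n p r) (+-congˡ (*-cong p (^-congˡ n r)))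

  poch-head : ∀ x y n → poch x y (suc n) ≈ (1# + x) * poch (x * y) y n
  poch-head x y zero    = solve 1 (λ x → :1 :* (:1 :+ x :* :1) := (:1 :+ x) :* :1) refl x
  poch-head x y (suc n) = begin
    poch x y (suc n) * (1# + x * (y * y ^ n))
      ≈⟨ *-congʳ (poch-head x y n) ⟩
    (1# + x) * poch (x * y) y n * (1# + x * (y * y ^ n))
      ≈⟨ solve 4 (λ x y t p → (:1 :+ x) :* p :* (:1 :+ x :* (y :* t)) :=
                              (:1 :+ x) :* (p :* (:1 :+ x :* y :* t))) refl x y (y ^ n) (poch (x * y) y n) ⟩
    (1# + x) * poch (x * y) y (suc n) ∎

  ^-*2 : ∀ y n → y ^ (n ℕ.* 2) ≈ (y * y) ^ n
  ^-*2 y zero    = refl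
  ^-*2 y (suc n) = trans (*-congˡ (*-congˡ (^-*2 y n))) (sym (*-assoc y y _))

  ^-*3 : ∀ y n → y ^ (n ℕ.* 3) ≈ (y * (y * y)) ^ n
  ^-*3 y zero    = refl
  ^-*3 y (suc n) = trans (*-congˡ (*-congˡ (*-congˡ (^-*3 y n))))
    (solve 2 (λ y t → y :* (y :* (y :* t)) := y :* (y :* y) :* t) refl y _)

  poch-split2 : ∀ x y n → poch x y (n ℕ.* 2) ≈ poch x (y * y) n * poch (x * y) (y * y) n
  poch-split2 x y zero    = sym (*-identityˡ 1#)
  poch-split2 x y (suc n) = begin
    poch x y (n ℕ.* 2) * (1# + x * y ^ (n ℕ.* 2)) * (1# + x * (y * y ^ (n ℕ.* 2)))
      ≈⟨ *-cong (*-cong (poch-split2 x y n) (+-congˡ (*-congˡ (^-*2 y n))))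
                (+-congˡ (*-congˡ (*-congˡ (^-*2 y n)))) ⟩
    _ ≈⟨ solve 5 (λ x y t p r → p :* r :* (:1 :+ x :* t) :* (:1 :+ x :* (y :* t)) :=
                 (p :* (:1 :+ x :* t)) :* (r :* (:1 :+ x :* y :* t))) refl
                 x y ((y * y) ^ n) (poch x (y * y) n) (poch (x * y) (y * y) n) ⟩
    poch x (y * y) (suc n) * poch (x * y) (y * y) (suc n) ∎

  poch-split3 : ∀ x y n → let z = y * (y * y) in
    poch x y (n ℕ.* 3) ≈ poch x z n * poch (x * y) z n * poch (x * (y * y)) z n
  poch-split3 x y zero    = solve 0 (:1 := :1 :* :1 :* :1) refl
  poch-split3 x y (suc n) = begin
    poch x y (n ℕ.* 3) * (1# + x * y ^ (n ℕ.* 3)) * (1# + x * (y * y ^ (n ℕ.* 3)))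
      * (1# + x * (y * (y * y ^ (n ℕ.* 3))))
      ≈⟨ *-cong (*-cong (*-cong (poch-split3 x y n) (+-congˡ (*-congˡ (^-*3 y n))))
                (+-congˡ (*-congˡ (*-congˡ (^-*3 y n)))))
                (+-congˡ (*-congˡ (*-congˡ (*-congˡ (^-*3 y n))))) ⟩
    _ ≈⟨ solve 6 (λ x y t p r s → p :* r :* s :* (:1 :+ x :* t) :* (:1 :+ x :* (y :* t)) :* (:1 :+ x :* (y :* (y :* t))) :=
                 (p :* (:1 :+ x :* t)) :* (r :* (:1 :+ x :* y :* t)) :* (s :* (:1 :+ x :* (y :* y) :* t))) refl
                 x y (z ^ n) (poch x z n) (poch (x * y) z n) (poch (x * (y * y)) z n) ⟩
    poch x z (suc n) * poch (x * y) z (suc n) * poch (x * (y * y)) z (suc n) ∎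
    where z = y * (y * y)

  poch-conjugate : ∀ x y n → poch x y n * poch (- x) y n ≈ poch (- (x * x)) (y * y) n
  poch-conjugate x y zero    = *-identityˡ 1#
  poch-conjugate x y (suc n) = begin
    poch x y n * (1# + x * y ^ n) * (poch (- x) y n * (1# + - x * y ^ n))
      ≈⟨ solve 4 (λ x t p r → p :* (:1 :+ x :* t) :* (r :* (:1 :+ :- x :* t)) :=
                  p :* r :* (:1 :+ :- (x :* x) :* (t :* t))) refl x (y ^ n) (poch x y n) (poch (- x) y n) ⟩
    poch x y n * poch (- x) y n * (1# + - (x * x) * (y ^ n * y ^ n))
      ≈⟨ *-cong (poch-conjugate x y n) (+-congˡ (*-congˡ (sym (^-distrib-* y y n)))) ⟩
    poch (- (x * x)) (y * y) (suc n) ∎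

  ∑ : ℕ → (ℕ → Carrier) → Carrier
  ∑ zero    f = 0#
  ∑ (suc n) f = ∑ n f + f n

  ∑-cong : ∀ n {f g} → (∀ k → k < n → f k ≈ g k) → ∑ n f ≈ ∑ n g
  ∑-cong zero    h = refl
  ∑-cong (suc n) h = +-cong (∑-cong n (λ k l → h k (ℕₚ.m≤n⇒m≤1+n l))) (h n ℕₚ.≤-refl)

  ∑-+ : ∀ n f g → ∑ n (λ k → f k + g k) ≈ ∑ n f + ∑ n g
  ∑-+ zero    f g = sym (+-identityˡ 0#)
  ∑-+ (suc n) f g = trans (+-congʳ (∑-+ n f g))
    (solve 4 (λ a b c d → a :+ b :+ (c :+ d) := a :+ c :+ (b :+ d)) refl _ _ _ _)

  ∑-* : ∀ n f x → ∑ n f * x ≈ ∑ n (λ k → f k * x)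
  ∑-* zero    f x = zeroˡ x
  ∑-* (suc n) f x = trans (distribʳ x _ _) (+-congʳ (∑-* n f x))

  ∑-head : ∀ n f → ∑ (suc n) f ≈ f 0 + ∑ n (λ k → f (suc k))
  ∑-head zero    f = +-comm _ _
  ∑-head (suc n) f = trans (+-congʳ (∑-head n f)) (+-assoc _ _ _)

  -- triPow z k = z^(k(k+1)/2)
  triPow : Carrier → ℕ → Carrier
  triPow z zero    = 1#
  triPow z (suc k) = triPow z k * z ^ suc k

  triPow-cong : ∀ {y z} k → y ≈ z → triPow y k ≈ triPow z k
  triPow-cong zero    p = refl
  triPow-cong (suc k) p = *-cong (triPow-cong k p) (^-congˡ (suc k) p)

  -- The symmetric partial sum |k| ≤ n of Ramanujan's theta function f(a,b), where Q = ab.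
  theta : Carrier → Carrier → Carrier → ℕ → Carrier
  theta a b Q n = 1# + ∑ n (λ k → triPow Q k * (a ^ suc k + b ^ suc k))

  theta-cong : ∀ {a a′ b b′ Q Q′} n → a ≈ a′ → b ≈ b′ → Q ≈ Q′ → theta a b Q n ≈ theta a′ b′ Q′ n
  theta-cong n p r s = +-congˡ (∑-cong n λ k _ →
    *-cong (triPow-cong k s) (+-cong (^-congˡ (suc k) p) (^-congˡ (suc k) r)))

  ^-regroup : ∀ x a n b → (x ^ a) ^ (n ℕ.* b) ≈ (x ^ n) ^ (a ℕ.* b)
  ^-regroup x a n b = trans (^-assocʳ x a (n ℕ.* b))
    (trans (^-≡ x (exponents a n b)) (sym (^-assocʳ x n (a ℕ.* b))))
    where
    exponents : ∀ a n b → a ℕ.* (n ℕ.* b) ≡ n ℕ.* (a ℕ.* b)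
    exponents = ℕSolver.solve-∀

  ^-swap : ∀ x a n → (x ^ a) ^ n ≈ (x ^ n) ^ a
  ^-swap x a n = trans (^-assocʳ x a n) (trans (^-≡ x (ℕₚ.*-comm a n)) (sym (^-assocʳ x n a)))

  -- The exponents agree because (3n+1)(3n+2)/2 = 9·n(n+1)/2 + 1. Both dissections reduce their
  -- blocks of three terms to base z⁹ through this.
  triPow-3n+1 : ∀ z n → triPow z (suc (n ℕ.* 3)) ≈ triPow (z ^ 9) n * z
  triPow-3n+1 z zero    = solve 1 (λ z → :1 :* (z :* :1) := :1 :* z) refl z
  triPow-3n+1 z (suc n) = begin
    triPow z (suc (n ℕ.* 3)) * (z * (z * z ^ (n ℕ.* 3))) * (z * (z * (z * z ^ (n ℕ.* 3))))
      * (z * (z * (z * (z * z ^ (n ℕ.* 3)))))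
      ≈⟨ *-cong (*-cong (*-cong (triPow-3n+1 z n) (*-congˡ (*-congˡ e))) (*-congˡ (*-congˡ (*-congˡ e))))
           (*-congˡ (*-congˡ (*-congˡ (*-congˡ e)))) ⟩
    _ ≈⟨ solve 3 (λ z y u → u :* z :* (z :* (z :* y :^ 3)) :* (z :* (z :* (z :* y :^ 3)))
              :* (z :* (z :* (z :* (z :* y :^ 3)))) := u :* (z :^ 9 :* y :^ 9) :* z) refl z (z ^ n) (triPow (z ^ 9) n) ⟩
    triPow (z ^ 9) n * (z ^ 9 * (z ^ n) ^ 9) * z
      ≈⟨ *-congʳ (*-congˡ (*-congˡ (sym (^-swap z 9 n)))) ⟩
    triPow (z ^ 9) (suc n) * z ∎
    where
    e : z ^ (n ℕ.* 3) ≈ (z ^ n) ^ 3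
    e = sym (^-assocʳ z n 3)

  -- Sorting the exponents k² by k mod 3
  theta-dissect : ∀ w n → theta w w (w ^ 2) (suc (n ℕ.* 3)) ≈
    theta (w ^ 9) (w ^ 9) (w ^ 18) n + (w + w) * theta (w ^ 3) (w ^ 15) (w ^ 18) n
  theta-dissect w zero    = trans (+-congˡ (+-identityˡ _)) (trans
    (solve 1 (λ w → :1 :+ :1 :* (w :* :1 :+ w :* :1) := :1 :+ (w :+ w) :* :1) refl w)
    (sym (+-cong (+-identityʳ _) (*-congˡ (+-identityʳ _)))))
  theta-dissect w (suc n) = begin
    1# + (∑ (suc (n ℕ.* 3)) _ + t₁ + t₂ + t₃)
      ≈⟨ solve 4 (λ s a b c → :1 :+ (s :+ a :+ b :+ c) := :1 :+ s :+ (a :+ b :+ c)) refl _ _ _ _ ⟩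
    theta w w (w ^ 2) (suc (n ℕ.* 3)) + (t₁ + t₂ + t₃)
      ≈⟨ +-cong (theta-dissect w n) terms ⟩
    theta (w ^ 9) (w ^ 9) (w ^ 18) n + (w + w) * theta (w ^ 3) (w ^ 15) (w ^ 18) n + (u₁ + (w + w) * u₂)
      ≈⟨ solve 5 (λ w s t u v → :1 :+ s :+ (w :+ w) :* (:1 :+ t) :+ (u :+ (w :+ w) :* v)
                    := :1 :+ (s :+ u) :+ (w :+ w) :* (:1 :+ (t :+ v))) refl w _ _ u₁ u₂ ⟩
    theta (w ^ 9) (w ^ 9) (w ^ 18) (suc n) + (w + w) * theta (w ^ 3) (w ^ 15) (w ^ 18) (suc n) ∎
    where
    k = suc (n ℕ.* 3)
    y = w ^ n
    T = triPow (w ^ 2)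
    u = triPow (w ^ 18) n
    t₁ = T k * (w ^ suc k + w ^ suc k)
    t₂ = T (1 ℕ.+ k) * (w ^ (2 ℕ.+ k) + w ^ (2 ℕ.+ k))
    t₃ = T (2 ℕ.+ k) * (w ^ (3 ℕ.+ k) + w ^ (3 ℕ.+ k))
    u₁ = u * ((w ^ 9) ^ suc n + (w ^ 9) ^ suc n)
    u₂ = u * ((w ^ 3) ^ suc n + (w ^ 15) ^ suc n)
    p : w ^ (n ℕ.* 3) ≈ y ^ 3
    p = sym (^-assocʳ w n 3)
    P : (w ^ 2) ^ (n ℕ.* 3) ≈ y ^ 6
    P = ^-regroup w 2 n 3
    Tk : T k ≈ u * w ^ 2
    Tk = trans (triPow-3n+1 (w ^ 2) n) (*-congʳ (triPow-cong n (^-assocʳ w 2 9)))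
    Tk₁ : T (1 ℕ.+ k) ≈ u * w ^ 2 * (w ^ 2 * (w ^ 2 * y ^ 6))
    Tk₁ = *-cong Tk (*-congˡ (*-congˡ P))
    Tk₂ : T (2 ℕ.+ k) ≈ u * w ^ 2 * (w ^ 2 * (w ^ 2 * y ^ 6)) * (w ^ 2 * (w ^ 2 * (w ^ 2 * y ^ 6)))
    Tk₂ = *-cong Tk₁ (*-congˡ (*-congˡ (*-congˡ P)))
    twice : ∀ {x x′} → x ≈ x′ → x + x ≈ x′ + x′
    twice e = +-cong e e
    -- The block has exponents (3n+2)², (3n+3)², (3n+4)². The middle term gives `u₁`; the outer two
    -- are the halves of `u₂`, up to the common factor 2w.
    terms : t₁ + t₂ + t₃ ≈ u₁ + (w + w) * u₂
    terms = begin
      t₁ + t₂ + t₃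
        ≈⟨ +-cong (+-cong (*-cong Tk (twice (*-congˡ (*-congˡ p))))
                          (*-cong Tk₁ (twice (*-congˡ (*-congˡ (*-congˡ p))))))
                  (*-cong Tk₂ (twice (*-congˡ (*-congˡ (*-congˡ (*-congˡ p)))))) ⟩
      _ ≈⟨ solve 3 (λ w y u →
             let d = λ x → x :+ x
                 T₀ = u :* w :^ 2
                 T₁ = T₀ :* (w :^ 2 :* (w :^ 2 :* y :^ 6))
                 T₂ = T₁ :* (w :^ 2 :* (w :^ 2 :* (w :^ 2 :* y :^ 6)))
             in T₀ :* d (w :* (w :* y :^ 3)) :+ T₁ :* d (w :* (w :* (w :* y :^ 3)))
                  :+ T₂ :* d (w :* (w :* (w :* (w :* y :^ 3))))
             := u :* d (w :^ 9 :* y :^ 9) :+ (w :+ w) :* (u :* (w :^ 3 :* y :^ 3 :+ w :^ 15 :* y :^ 15))) refl w y u ⟩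
      u * (w ^ 9 * y ^ 9 + w ^ 9 * y ^ 9) + (w + w) * (u * (w ^ 3 * y ^ 3 + w ^ 15 * y ^ 15))
        ≈⟨ +-cong (*-congˡ (twice (*-congˡ (sym (^-swap w 9 n)))))
                  (*-congˡ (*-congˡ (+-cong (*-congˡ (sym (^-swap w 3 n))) (*-congˡ (sym (^-swap w 15 n)))))) ⟩
      u₁ + (w + w) * u₂ ∎

  -- Sorting the triangular numbers k(k+1)/2 by k mod 3
  triangular-dissect : ∀ z n → ∑ (suc (n ℕ.* 3)) (triPow z) ≈
    theta (z ^ 3) (z ^ 6) (z ^ 9) n + z * ∑ n (triPow (z ^ 9))
  triangular-dissect z zero    = trans (+-identityˡ 1#) (sym (trans (+-cong (+-identityʳ 1#) (zeroʳ z)) (+-identityʳ 1#)))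
  triangular-dissect z (suc n) = begin
    ∑ (suc (n ℕ.* 3)) (triPow z) + T k + T (1 ℕ.+ k) + T (2 ℕ.+ k)
      ≈⟨ +-cong (+-cong (+-cong (triangular-dissect z n) Tk) Tk₁) (*-cong Tk₁ (*-congˡ (*-congˡ (*-congˡ p)))) ⟩
    -- The triangular number of 3n+1 is 1 modulo 3 and extends the second sum; those of 3n+2 and
    -- 3n+3 are divisible by 3 and form the new theta term.
    _ ≈⟨ solve 5 (λ z y u s r →
           let T₀ = u :* z
               T₁ = T₀ :* (z :* (z :* y :^ 3))
               T₂ = T₁ :* (z :* (z :* (z :* y :^ 3)))
           in (:1 :+ s) :+ z :* r :+ T₀ :+ T₁ :+ T₂
           := (:1 :+ (s :+ u :* (z :^ 3 :* y :^ 3 :+ z :^ 6 :* y :^ 6))) :+ z :* (r :+ u)) refl z y u _ _ ⟩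
    _ ≈⟨ +-congʳ (+-congˡ (+-congˡ (*-congˡ (+-cong (*-congˡ (sym (^-swap z 3 n))) (*-congˡ (sym (^-swap z 6 n))))))) ⟩
    theta (z ^ 3) (z ^ 6) (z ^ 9) (suc n) + z * ∑ (suc n) (triPow (z ^ 9)) ∎
    where
    k = suc (n ℕ.* 3)
    y = z ^ n
    T = triPow z
    u = triPow (z ^ 9) n
    p : z ^ (n ℕ.* 3) ≈ y ^ 3
    p = sym (^-assocʳ z n 3)
    Tk : T k ≈ u * z
    Tk = triPow-3n+1 z n
    Tk₁ : T (1 ℕ.+ k) ≈ u * z * (z * (z * y ^ 3))
    Tk₁ = *-cong Tk (*-congˡ (*-congˡ p))

  -- f(1,z) runs through the exponents k(k+1)/2 for all integers k, so k and -1-k yield every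
  -- triangular number twice. The symmetric cut-off leaves the two copies one term apart.
  theta-1-z : ∀ z n → theta 1# z z n ≈ ∑ n (triPow z) + ∑ (suc n) (triPow z)
  theta-1-z z n = begin
    1# + ∑ n (λ k → triPow z k * (1# ^ suc k + z ^ suc k))
      ≈⟨ +-congˡ (∑-cong n (λ k _ → trans (*-congˡ (+-congʳ (1^ (suc k)))) (trans (distribˡ _ _ _) (+-congʳ (*-identityʳ _))))) ⟩
    1# + ∑ n (λ k → triPow z k + triPow z (suc k))
      ≈⟨ +-congˡ (∑-+ n _ _) ⟩
    1# + (∑ n (triPow z) + ∑ n (λ k → triPow z (suc k)))
      ≈⟨ solve 2 (λ a b → :1 :+ (a :+ b) := a :+ (:1 :+ b)) refl _ _ ⟩
    ∑ n (triPow z) + (1# + ∑ n (λ k → triPow z (suc k)))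
      ≈⟨ +-congˡ (sym (∑-head n (triPow z))) ⟩
    ∑ n (triPow z) + ∑ (suc n) (triPow z) ∎
    where
    1^ : ∀ k → 1# ^ k ≈ 1#
    1^ zero    = refl
    1^ (suc k) = trans (*-identityˡ _) (1^ k)

  -- The triple product in finite form, by Gaussian binomials

  module TripleProduct (a b Q : Carrier) (ab≈Q : a * b ≈ Q) where

    P : ℕ → Carrier
    P = poch (- Q) Q

    -- The Gaussian binomial coefficient [2n, n+k] in base Q
    c : ℕ → ℕ → Carrier
    c zero    zero    = 1#
    c zero    (suc k) = 0#
    -- The recursion records multiplication by (1 + aQ^n)(1 + bQ^n) = 1 + Q^(2n+1) + (a + b)Q^n.
    -- Symmetry in k is built in, hence the doubled `c n 1`. For k > n the truncated exponent
    -- `n ∸ k` is harmless, as `c n k` vanishes.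
    c (suc n) zero    = c n 0 * (1# + Q ^ suc (n ℕ.+ n)) + Q ^ suc n * (c n 1 + c n 1)
    c (suc n) (suc k) = c n (suc k) * (1# + Q ^ suc (n ℕ.+ n))
                        + Q ^ (n ℕ.∸ k) * c n k + Q ^ (n ℕ.+ (2 ℕ.+ k)) * c n (2 ℕ.+ k)

    c-vanish : ∀ n k → n < k → c n k ≈ 0#
    c-vanish zero    (suc k) _         = refl
    c-vanish (suc n) (suc k) (s≤s n<k) = begin
      c n (suc k) * (1# + Q ^ suc (n ℕ.+ n)) + Q ^ (n ℕ.∸ k) * c n k + Q ^ (n ℕ.+ (2 ℕ.+ k)) * c n (2 ℕ.+ k)
        ≈⟨ +-cong (+-cong (*-congʳ (c-vanish n (suc k) (ℕₚ.m≤n⇒m≤1+n n<k))) (*-congˡ (c-vanish n k n<k)))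
                  (*-congˡ (c-vanish n (2 ℕ.+ k) (ℕₚ.m≤n⇒m≤1+n (ℕₚ.m≤n⇒m≤1+n n<k)))) ⟩
      0# * (1# + Q ^ suc (n ℕ.+ n)) + Q ^ (n ℕ.∸ k) * 0# + Q ^ (n ℕ.+ (2 ℕ.+ k)) * 0#
        ≈⟨ +-cong (+-cong (zeroˡ _) (zeroʳ _)) (zeroʳ _) ⟩
      0# + 0# + 0#
        ≈⟨ trans (+-identityʳ _) (+-identityʳ _) ⟩
      0# ∎

    P-suc : ∀ n → P (suc n) ≈ P n * (1# - Q ^ suc n)
    P-suc n = solve 3 (λ p Q t → p :* (:1 :+ :- Q :* t) := p :* (:1 :- Q :* t)) refl (P n) Q (Q ^ n)

    P-double : ∀ n → P (suc n ℕ.+ suc n) ≈ P (n ℕ.+ n) * (1# - Q ^ suc (n ℕ.+ n)) * (1# - Q * Q ^ suc (n ℕ.+ n))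
    P-double n = trans (reflexive (cong P (cong suc (ℕₚ.+-suc n n))))
      (trans (P-suc (suc (n ℕ.+ n))) (*-congʳ (P-suc (n ℕ.+ n))))

    private
      Closed : ℕ → Set
      Closed n = ∀ k l → k ℕ.+ l ≡ n → c n k * (P l * P (n ℕ.+ k)) ≈ P (n ℕ.+ n)

      -- `Closed` continued one place past its range: an extra factor 1 - Q^l appears. At l = 0 both
      -- this factor and the coefficient vanish, so the boundary is covered by the same formula.
      ladder₀ : ∀ n → Closed n → ∀ k l → k ℕ.+ l ≡ suc n →
        c n k * (P l * P (n ℕ.+ k)) ≈ (1# - Q ^ l) * P (n ℕ.+ n)
      ladder₀ n closed k zero    e = begin
        c n k * (P 0 * P (n ℕ.+ k)) ≈⟨ *-congʳ (c-vanish n k (ℕₚ.≤-reflexive (≡.trans (≡.sym e) (ℕₚ.+-identityʳ k)))) ⟩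
        0# * (P 0 * P (n ℕ.+ k))    ≈⟨ zeroˡ _ ⟩
        0#                          ≈⟨ sym (zeroˡ _) ⟩
        0# * P (n ℕ.+ n)            ≈⟨ *-congʳ (sym (-‿inverseʳ 1#)) ⟩
        (1# - 1#) * P (n ℕ.+ n)     ∎
      ladder₀ n closed k (suc l) e = begin
        c n k * (P (suc l) * P (n ℕ.+ k))
          ≈⟨ *-congˡ (*-congʳ (P-suc l)) ⟩
        c n k * (P l * (1# - Q ^ suc l) * P (n ℕ.+ k))
          ≈⟨ solve 4 (λ c p t r → c :* (p :* t :* r) := t :* (c :* (p :* r))) refl _ _ _ _ ⟩
        (1# - Q ^ suc l) * (c n k * (P l * P (n ℕ.+ k)))
          ≈⟨ *-congˡ (closed k l (ℕₚ.suc-injective (≡.trans (≡.sym (ℕₚ.+-suc k l)) e))) ⟩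
        (1# - Q ^ suc l) * P (n ℕ.+ n) ∎

      ladder₁ : ∀ n → Closed n → ∀ k l → k ℕ.+ suc l ≡ suc n →
        c n (suc k) * (P (suc l) * P (n ℕ.+ suc k)) ≈ (1# - Q ^ suc l) * (1# - Q ^ l) * P (n ℕ.+ n)
      ladder₁ n closed k l e = begin
        c n (suc k) * (P (suc l) * P (n ℕ.+ suc k))
          ≈⟨ *-congˡ (*-congʳ (P-suc l)) ⟩
        c n (suc k) * (P l * (1# - Q ^ suc l) * P (n ℕ.+ suc k))
          ≈⟨ solve 4 (λ c p t r → c :* (p :* t :* r) := t :* (c :* (p :* r))) refl _ _ _ _ ⟩
        (1# - Q ^ suc l) * (c n (suc k) * (P l * P (n ℕ.+ suc k)))
          ≈⟨ *-congˡ (ladder₀ n closed (suc k) l (≡.trans (≡.sym (ℕₚ.+-suc k l)) e)) ⟩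
        (1# - Q ^ suc l) * ((1# - Q ^ l) * P (n ℕ.+ n))
          ≈⟨ sym (*-assoc _ _ _) ⟩
        (1# - Q ^ suc l) * (1# - Q ^ l) * P (n ℕ.+ n) ∎

    -- The quotient formula (Q)_{2n} / ((Q)_{n-k} (Q)_{n+k}) with denominators cleared. The ladder
    -- lemmas bring the neighbours in the recursion to multiples of `P (n + n)`, and a polynomial
    -- identity in Q and its powers remains.
    c-closed : ∀ n k l → k ℕ.+ l ≡ n → c n k * (P l * P (n ℕ.+ k)) ≈ P (n ℕ.+ n)
    c-closed zero    zero    zero    _ = solve 0 (:1 :* (:1 :* :1) := :1) refl
    c-closed (suc n) zero    (suc l) ≡.refl = begin
      (c₀ * (1# + s) + Q ^ suc n * (c₁ + c₁)) * (P (suc n) * (P (suc (n ℕ.+ 0))))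
        ≈⟨ *-congˡ (*-congˡ (reflexive (cong (λ t → P (suc t)) (ℕₚ.+-identityʳ n)))) ⟩
      (c₀ * (1# + s) + Q ^ suc n * (c₁ + c₁)) * (P (suc n) * P (suc n))
        ≈⟨ solve 5 (λ c₀ c₁ s t p → (c₀ :* (:1 :+ s) :+ t :* (c₁ :+ c₁)) :* (p :* p) :=
              (:1 :+ s) :* (c₀ :* (p :* p)) :+ t :* (c₁ :* (p :* p) :+ c₁ :* (p :* p))) refl c₀ c₁ s (Q ^ suc n) (P (suc n)) ⟩
      (1# + s) * (c₀ * (P (suc n) * P (suc n))) + Q ^ suc n * (c₁ * (P (suc n) * P (suc n)) + c₁ * (P (suc n) * P (suc n)))
        ≈⟨ +-cong (*-congˡ e₀) (*-congˡ (+-cong e₁ e₁)) ⟩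
      (1# + s) * ((1# - Q * r) * ((1# - Q * r) * p)) + Q * r * ((1# - Q * r) * (1# - r) * p + (1# - Q * r) * (1# - r) * p)
        ≈⟨ +-congʳ (*-congʳ (+-congˡ s≈)) ⟩
      (1# + Q * (r * r)) * ((1# - Q * r) * ((1# - Q * r) * p)) + Q * r * ((1# - Q * r) * (1# - r) * p + (1# - Q * r) * (1# - r) * p)
        ≈⟨ solve 3 (λ Q r p → (:1 :+ Q :* (r :* r)) :* ((:1 :- Q :* r) :* ((:1 :- Q :* r) :* p))
               :+ Q :* r :* ((:1 :- Q :* r) :* (:1 :- r) :* p :+ (:1 :- Q :* r) :* (:1 :- r) :* p)
             := p :* (:1 :- Q :* (r :* r)) :* (:1 :- Q :* (Q :* (r :* r)))) refl Q r p ⟩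
      p * (1# - Q * (r * r)) * (1# - Q * (Q * (r * r)))
        ≈⟨ *-cong (*-congˡ (+-congˡ (-‿cong (sym s≈)))) (+-congˡ (-‿cong (*-congˡ (sym s≈)))) ⟩
      p * (1# - s) * (1# - Q * s)
        ≈⟨ sym (P-double n) ⟩
      P (suc n ℕ.+ suc n) ∎
      where
      c₀ = c n 0
      c₁ = c n 1
      s = Q ^ suc (n ℕ.+ n)
      r = Q ^ n
      p = P (n ℕ.+ n)
      s≈ : s ≈ Q * (r * r)
      s≈ = *-congˡ (^-homo-* Q n n)
      e₀ : c₀ * (P (suc n) * P (suc n)) ≈ (1# - Q * r) * ((1# - Q * r) * p)
      e₀ = begin
        c₀ * (P (suc n) * P (suc n))
          ≈⟨ *-congˡ (*-congˡ (P-suc n)) ⟩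
        c₀ * (P (suc n) * (P n * (1# - Q * r)))
          ≈⟨ solve 4 (λ c p t r → c :* (p :* (t :* r)) := r :* (c :* (p :* t))) refl _ _ _ _ ⟩
        (1# - Q * r) * (c₀ * (P (suc n) * P n))
          ≈⟨ *-congˡ (*-congˡ (*-congˡ (reflexive (cong P (≡.sym (ℕₚ.+-identityʳ n)))))) ⟩
        (1# - Q * r) * (c₀ * (P (suc n) * P (n ℕ.+ 0)))
          ≈⟨ *-congˡ (ladder₀ n (c-closed n) 0 (suc n) ≡.refl) ⟩
        (1# - Q * r) * ((1# - Q * r) * p) ∎
      e₁ : c₁ * (P (suc n) * P (suc n)) ≈ (1# - Q * r) * (1# - r) * p
      e₁ = trans (*-congˡ (*-congˡ (reflexive (cong P (≡.sym (ℕₚ.+-comm n 1))))))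
                 (ladder₁ n (c-closed n) 0 n ≡.refl)
    c-closed (suc n) (suc k) l e = begin
      (c₁ * (1# + s) + Q ^ (n ℕ.∸ k) * c₀ + Q ^ (n ℕ.+ (2 ℕ.+ k)) * c₂) * (P l * P (suc n ℕ.+ suc k))
        ≈⟨ solve 7 (λ c₁ s t c₀ v c₂ p → (c₁ :* (:1 :+ s) :+ t :* c₀ :+ v :* c₂) :* p :=
              (:1 :+ s) :* (c₁ :* p) :+ t :* (c₀ :* p) :+ v :* (c₂ :* p)) refl
              c₁ s (Q ^ (n ℕ.∸ k)) c₀ (Q ^ (n ℕ.+ (2 ℕ.+ k))) c₂ (P l * P (suc n ℕ.+ suc k)) ⟩
      (1# + s) * (c₁ * (P l * P (suc n ℕ.+ suc k))) + Q ^ (n ℕ.∸ k) * (c₀ * (P l * P (suc n ℕ.+ suc k)))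
        + Q ^ (n ℕ.+ (2 ℕ.+ k)) * (c₂ * (P l * P (suc n ℕ.+ suc k)))
        ≈⟨ +-cong (+-cong (*-cong (+-congˡ s≈) e₁) (*-cong (^-≡ Q n∸k≡l) e₀)) (*-congʳ v≈) ⟩
      (1# + r * x) * ((1# - Q * r) * ((1# - x) * p)) + x * ((1# - r) * (1# - Q * r) * p)
        + Q * r * (c₂ * (P l * P (suc n ℕ.+ suc k)))
        ≈⟨ finish l l+k ⟩
      p * (1# - r * x) * (1# - Q * (r * x))
        ≈⟨ *-cong (*-congˡ (+-congˡ (-‿cong (sym s≈)))) (+-congˡ (-‿cong (*-congˡ (sym s≈)))) ⟩
      p * (1# - s) * (1# - Q * s)
        ≈⟨ sym (P-double n) ⟩
      P (suc n ℕ.+ suc n) ∎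
      where
      c₀ = c n k
      c₁ = c n (suc k)
      c₂ = c n (2 ℕ.+ k)
      s = Q ^ suc (n ℕ.+ n)
      r = Q ^ suc (n ℕ.+ k)
      x = Q ^ l
      p = P (n ℕ.+ n)
      l+k : k ℕ.+ l ≡ n
      l+k = ℕₚ.suc-injective e
      n∸k≡l : n ℕ.∸ k ≡ l
      n∸k≡l = ≡.trans (cong (ℕ._∸ k) (≡.sym l+k)) (ℕₚ.m+n∸m≡n k l)
      s≈ : s ≈ r * x
      s≈ = trans (^-≡ Q (cong suc (≡.trans (cong (n ℕ.+_) (≡.sym l+k)) (≡.sym (ℕₚ.+-assoc n k l)))))
                 (^-homo-* Q (suc (n ℕ.+ k)) l)
      v≈ : Q ^ (n ℕ.+ (2 ℕ.+ k)) ≈ Q * r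
      v≈ = ^-≡ Q (≡.trans (ℕₚ.+-suc n (suc k)) (cong suc (ℕₚ.+-suc n k)))
      nk : n ℕ.+ suc k ≡ suc (n ℕ.+ k)
      nk = ℕₚ.+-suc n k
      P-top : P (suc n ℕ.+ suc k) ≈ P (n ℕ.+ k) * (1# - r) * (1# - Q * r)
      P-top = trans (reflexive (cong (λ t → P (suc t)) nk))
                (trans (P-suc (suc (n ℕ.+ k))) (*-congʳ (P-suc (n ℕ.+ k))))
      P-mid : P (suc n ℕ.+ suc k) ≈ P (n ℕ.+ suc k) * (1# - Q * r)
      P-mid = trans (P-suc (n ℕ.+ suc k)) (*-congˡ (+-congˡ (-‿cong (*-congˡ (^-≡ Q nk)))))
      e₀ : c₀ * (P l * P (suc n ℕ.+ suc k)) ≈ (1# - r) * (1# - Q * r) * p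
      e₀ = begin
        c₀ * (P l * P (suc n ℕ.+ suc k))
          ≈⟨ *-congˡ (*-congˡ P-top) ⟩
        c₀ * (P l * (P (n ℕ.+ k) * (1# - r) * (1# - Q * r)))
          ≈⟨ solve 5 (λ c p t r s → c :* (p :* (t :* r :* s)) := r :* s :* (c :* (p :* t))) refl _ _ _ _ _ ⟩
        (1# - r) * (1# - Q * r) * (c₀ * (P l * P (n ℕ.+ k)))
          ≈⟨ *-congˡ (c-closed n k l l+k) ⟩
        (1# - r) * (1# - Q * r) * p ∎
      e₁ : c₁ * (P l * P (suc n ℕ.+ suc k)) ≈ (1# - Q * r) * ((1# - x) * p)
      e₁ = begin
        c₁ * (P l * P (suc n ℕ.+ suc k))
          ≈⟨ *-congˡ (*-congˡ P-mid) ⟩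
        c₁ * (P l * (P (n ℕ.+ suc k) * (1# - Q * r)))
          ≈⟨ solve 4 (λ c p t r → c :* (p :* (t :* r)) := r :* (c :* (p :* t))) refl _ _ _ _ ⟩
        (1# - Q * r) * (c₁ * (P l * P (n ℕ.+ suc k)))
          ≈⟨ *-congˡ (ladder₀ n (c-closed n) (suc k) l e) ⟩
        (1# - Q * r) * ((1# - x) * p) ∎
      -- At l = 0 the neighbour k+2 lies outside the triangle and vanishes; otherwise `ladder₁`
      -- applies to it, with Q^l written as Q·Q^(l-1).
      finish : ∀ l → k ℕ.+ l ≡ n → let x = Q ^ l in
        (1# + r * x) * ((1# - Q * r) * ((1# - x) * p)) + x * ((1# - r) * (1# - Q * r) * p)
        + Q * r * (c₂ * (P l * P (suc n ℕ.+ suc k))) ≈ p * (1# - r * x) * (1# - Q * (r * x))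
      finish zero    k+0≡n = begin
        _ ≈⟨ +-congˡ (*-congˡ (*-congʳ (c-vanish n (2 ℕ.+ k) (s≤s (ℕₚ.m≤n⇒m≤1+n
               (ℕₚ.≤-reflexive (≡.trans (≡.sym k+0≡n) (ℕₚ.+-identityʳ k)))))))) ⟩
        _ ≈⟨ +-congˡ (trans (*-congˡ (zeroˡ _)) (zeroʳ _)) ⟩
        _ ≈⟨ +-identityʳ _ ⟩
        _ ≈⟨ solve 3 (λ Q r p → (:1 :+ r :* :1) :* ((:1 :- Q :* r) :* ((:1 :- :1) :* p)) :+ :1 :* ((:1 :- r) :* (:1 :- Q :* r) :* p)
              := p :* (:1 :- r :* :1) :* (:1 :- Q :* (r :* :1))) refl Q r p ⟩
        _ ∎
      finish (suc l) k+l≡n = begin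
        _ ≈⟨ +-congˡ (*-congˡ (*-congˡ (*-congˡ (P-top′)))) ⟩
        _ ≈⟨ +-congˡ (*-congˡ (ladder₁ n (c-closed n) (suc k) l (cong suc k+l≡n))) ⟩
        _ ≈⟨ solve 4 (λ Q r w p → (:1 :+ r :* (Q :* w)) :* ((:1 :- Q :* r) :* ((:1 :- Q :* w) :* p))
                :+ Q :* w :* ((:1 :- r) :* (:1 :- Q :* r) :* p)
                :+ Q :* r :* ((:1 :- Q :* w) :* (:1 :- w) :* p)
              := p :* (:1 :- r :* (Q :* w)) :* (:1 :- Q :* (r :* (Q :* w)))) refl Q r (Q ^ l) p ⟩
        _ ∎
        where
        P-top′ : P (suc n ℕ.+ suc k) ≈ P (n ℕ.+ (2 ℕ.+ k))
        P-top′ = reflexive (cong P (≡.sym (ℕₚ.+-suc n (suc k))))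

    W : ℕ → Carrier
    W = triPow Q

    s : ℕ → Carrier
    s k = a ^ k + b ^ k

    s-rec : ∀ k → (a + b) * s (suc k) ≈ s (2 ℕ.+ k) + Q * s k
    s-rec k = trans
      (solve 4 (λ a b x y → (a :+ b) :* (a :* x :+ b :* y) := a :* (a :* x) :+ b :* (b :* y) :+ a :* b :* (x :+ y))
        refl a b (a ^ k) (b ^ k))
      (+-congˡ (*-congʳ ab≈Q))

    term : ℕ → ℕ → Carrier
    term n k = c n (suc k) * (W k * s (suc k))

    factors : ℕ → Carrier
    factors n = poch a Q n * poch b Q n

    factors-suc : ∀ n → factors (suc n) ≈ factors n * (1# + Q ^ suc (n ℕ.+ n) + (a + b) * Q ^ n)
    factors-suc n = begin
      poch a Q n * (1# + a * t) * (poch b Q n * (1# + b * t))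
        ≈⟨ solve 5 (λ a b t p r → p :* (:1 :+ a :* t) :* (r :* (:1 :+ b :* t)) :=
             p :* r :* (:1 :+ a :* b :* (t :* t) :+ (a :+ b) :* t)) refl a b t (poch a Q n) (poch b Q n) ⟩
      factors n * (1# + a * b * (t * t) + (a + b) * t)
        ≈⟨ *-congˡ (+-congʳ (+-congˡ (*-cong ab≈Q (sym (^-homo-* Q n n))))) ⟩
      factors n * (1# + Q ^ suc (n ℕ.+ n) + (a + b) * t) ∎
      where t = Q ^ n

    -- The finite Jacobi triple product
    finite : ∀ n M → n ≤ M → factors n ≈ c n 0 + ∑ M (term n)
    finite zero    M _ = trans (*-identityˡ 1#)
      (sym (trans (+-congˡ (trans (∑-cong M (λ k _ → zeroˡ _)) (∑-0 M))) (+-identityʳ 1#)))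
      where
      ∑-0 : ∀ M → ∑ M (λ _ → 0#) ≈ 0#
      ∑-0 zero    = refl
      ∑-0 (suc M) = trans (+-identityʳ _) (∑-0 M)
    -- Only n ≤ M is demanded of the cut-off, so the induction hypothesis can be taken with the same
    -- `suc M` and all sums keep one length.
    finite (suc n) (suc M) (s≤s n≤M) = begin
      factors (suc n)
        ≈⟨ factors-suc n ⟩
      factors n * (1# + Q₂ + (a + b) * t)
        ≈⟨ *-congʳ (finite n (suc M) (ℕₚ.m≤n⇒m≤1+n n≤M)) ⟩
      (c n 0 + ∑ (suc M) (term n)) * (1# + Q₂ + (a + b) * t)
        ≈⟨ solve 5 (λ c S d e t → (c :+ S) :* (d :+ e :* t) := c :* d :+ c :* e :* t :+ (S :* d :+ S :* (e :* t)))
             refl (c n 0) (∑ (suc M) (term n)) (1# + Q₂) (a + b) t ⟩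
      c n 0 * (1# + Q₂) + c n 0 * (a + b) * t + (∑ (suc M) (term n) * (1# + Q₂) + ∑ (suc M) (term n) * ((a + b) * t))
        ≈⟨ +-congˡ (+-cong (∑-* (suc M) (term n) (1# + Q₂)) shifted) ⟩
      c n 0 * (1# + Q₂) + c n 0 * (a + b) * t + (∑ (suc M) stay + (∑ M up + (down 0 + ∑ M (λ k → down (suc k)))))
        ≈⟨ solve 6 (λ x y z u d v → x :+ y :+ (z :+ (u :+ (d :+ v))) := x :+ d :+ (z :+ (y :+ u) :+ v)) refl _ _ _ _ _ _ ⟩
      c n 0 * (1# + Q₂) + down 0 + (∑ (suc M) stay + (c n 0 * (a + b) * t + ∑ M up) + ∑ M (λ k → down (suc k)))
        ≈⟨ +-cong (+-congˡ down₀) (+-cong (+-congˡ ups) downs) ⟩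
      c (suc n) 0 + (∑ (suc M) stay + ∑ (suc M) fromBelow + ∑ (suc M) fromAbove)
        ≈⟨ +-congˡ (sym (trans (∑-cong (suc M) (λ k _ → expand k))
             (trans (∑-+ (suc M) _ fromAbove) (+-congʳ (∑-+ (suc M) stay fromBelow))))) ⟩
      c (suc n) 0 + ∑ (suc M) (term (suc n)) ∎
      where
      t = Q ^ n
      Q₂ = Q ^ suc (n ℕ.+ n)
      -- `up` and `down` are the halves of `s-rec`. Reindexed by one they become `fromBelow` and
      -- `fromAbove`, the outer parts of the recursion for `c`. The term `down 0`, where `s 0` is 2,
      -- goes into the constant term.
      stay up down fromBelow fromAbove : ℕ → Carrier
      stay k = term n k * (1# + Q₂)
      up k = c n (suc k) * (W k * t * s (2 ℕ.+ k))
      down k = c n (suc k) * (W k * t * (Q * s k))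
      fromBelow k = Q ^ (n ℕ.∸ k) * c n k * (W k * s (suc k))
      fromAbove k = Q ^ (n ℕ.+ (2 ℕ.+ k)) * c n (2 ℕ.+ k) * (W k * s (suc k))
      expand : ∀ k → term (suc n) k ≈ stay k + fromBelow k + fromAbove k
      expand k = solve 5 (λ x u y z w → (x :* u :+ y :+ z) :* w := x :* w :* u :+ y :* w :+ z :* w) refl _ _ _ _ _
      up-vanish : ∀ k → n ≤ k → up k ≈ 0#
      up-vanish k n≤k = trans (*-congʳ (c-vanish n (suc k) (s≤s n≤k))) (zeroˡ _)
      shifted : ∑ (suc M) (term n) * ((a + b) * t) ≈ ∑ M up + (down 0 + ∑ M (λ k → down (suc k)))
      shifted = begin
        ∑ (suc M) (term n) * ((a + b) * t)
          ≈⟨ ∑-* (suc M) (term n) _ ⟩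
        ∑ (suc M) (λ k → term n k * ((a + b) * t))
          ≈⟨ ∑-cong (suc M) (λ k _ → trans
               (solve 5 (λ c w s e t → c :* (w :* s) :* (e :* t) := c :* (w :* t :* (e :* s))) refl _ _ _ _ _)
               (trans (*-congˡ (*-congˡ (s-rec k)))
                 (trans (*-congˡ (distribˡ _ _ _)) (distribˡ _ _ _)))) ⟩
        ∑ (suc M) (λ k → up k + down k)
          ≈⟨ ∑-+ (suc M) up down ⟩
        ∑ M up + up M + ∑ (suc M) down
          ≈⟨ +-cong (trans (+-congˡ (up-vanish M n≤M)) (+-identityʳ _)) (∑-head M down) ⟩
        ∑ M up + (down 0 + ∑ M (λ k → down (suc k))) ∎
      down₀ : down 0 ≈ Q ^ suc n * (c n 1 + c n 1)
      down₀ = solve 3 (λ c t Q → c :* (:1 :* t :* (Q :* (:1 :+ :1))) := Q :* t :* (c :+ c)) refl (c n 1) t Q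
      ups : c n 0 * (a + b) * t + ∑ M up ≈ ∑ (suc M) fromBelow
      ups = sym (trans (∑-head M fromBelow) (+-cong
        (solve 4 (λ t c a b → t :* c :* (:1 :* (a :* :1 :+ b :* :1)) := c :* (a :+ b) :* t) refl t (c n 0) a b)
        (∑-cong M (λ k _ → below k))))
        where
        below : ∀ k → fromBelow (suc k) ≈ up k
        below k with suc k ℕₚ.≤? n
        ... | yes k<n = trans
          (solve 5 (λ x c w y s → x :* c :* (w :* y :* s) := c :* (w :* (y :* x) :* s)) refl
             (Q ^ (n ℕ.∸ suc k)) (c n (suc k)) (W k) (Q ^ suc k) (s (2 ℕ.+ k)))
          (*-congˡ (*-congʳ (*-congˡ (trans (sym (^-homo-* Q (suc k) (n ℕ.∸ suc k))) (^-≡ Q (ℕₚ.m+[n∸m]≡n k<n))))))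
        ... | no k≮n = trans (trans (*-congʳ (trans (*-congˡ (c-vanish n (suc k) (ℕₚ.≰⇒> k≮n))) (zeroʳ _))) (zeroˡ _))
                         (sym (up-vanish k (ℕₚ.≮⇒≥ k≮n)))
      downs : ∑ M (λ k → down (suc k)) ≈ ∑ (suc M) fromAbove
      downs = trans (∑-cong M (λ k _ → above k)) (sym (trans (+-congˡ top) (+-identityʳ _)))
        where
        above : ∀ k → down (suc k) ≈ fromAbove k
        above k = trans
          (solve 6 (λ c w y t Q s → c :* (w :* y :* t :* (Q :* s)) := Q :* (t :* y) :* c :* (w :* s)) refl
            (c n (2 ℕ.+ k)) (W k) (Q ^ suc k) t Q (s (suc k)))
          (*-congʳ (*-congʳ (trans (*-congˡ (sym (^-homo-* Q n (suc k)))) (^-≡ Q (≡.sym (ℕₚ.+-suc n (suc k)))))))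
        top : fromAbove M ≈ 0#
        top = trans (*-congʳ (trans (*-congˡ (c-vanish n (2 ℕ.+ M) (s≤s (ℕₚ.m≤n⇒m≤1+n n≤M)))) (zeroʳ _))) (zeroˡ _)

-- Eta quotients of level 18

infixl 7 _⊗_
infixr 8 _↑_

-- Quotients are kept as syntax so that two of them can be compared by computing their exponent
-- vectors; each use of `mono` is then closed by `≡.refl`.
data Mono (n : ℕ) : Set where
  η η⁻ : Fin n → Mono n
  _⊗_ : Mono n → Mono n → Mono n
  _↑_ : Mono n → ℕ → Mono n

module Generators where
  pattern e₁ = η 0F
  pattern e₂ = η 1F
  pattern e₃ = η 2F
  pattern e₆ = η 3F
  pattern e₉ = η 4F
  pattern e₁₈ = η 5F
  pattern i₁ = η⁻ 0F
  pattern i₂ = η⁻ 1F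
  pattern i₃ = η⁻ 2F
  pattern i₆ = η⁻ 3F
  pattern i₉ = η⁻ 4F
  pattern i₁₈ = η⁻ 5F

unitVec : ∀ {n} → ℤ → Fin n → Vec ℤ n
unitVec k zero    = k ∷ replicate _ (+ 0)
unitVec k (suc j) = + 0 ∷ unitVec k j

exponents : ∀ {n} → Mono n → Vec ℤ n
exponents (η j)         = unitVec (+ 1) j
exponents (η⁻ j)         = unitVec -[1+ 0 ] j
exponents (s ⊗ t)       = zipWith ℤ._+_ (exponents s) (exponents t)
exponents (s ↑ zero)    = replicate _ (+ 0)
exponents (s ↑ (suc k)) = zipWith ℤ._+_ (exponents s) (exponents (s ↑ k))

module Algebraic (R : CommutativeRing 0ℓ 0ℓ)
  (μ : ℤ.+-*-rawRing ACR.-Raw-AlmostCommutative⟶ ACR.fromCommutativeRing R) where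

  open RingKit R μ
  open ≈-Reasoning

  record Unit : Set where
    field
      el el⁻¹ : Carrier
      inverse : el * el⁻¹ ≈ 1#

  module _ (x : Unit) where
    open Unit x

    zpow : ℤ → Carrier
    zpow (+ n)    = el ^ n
    zpow -[1+ n ] = el⁻¹ ^ suc n

    zpow-⊖ : ∀ m n → zpow (m ℤ.⊖ n) ≈ el ^ m * el⁻¹ ^ n
    zpow-⊖ zero    zero    = sym (*-identityʳ 1#)
    zpow-⊖ zero    (suc n) = sym (*-identityˡ _)
    zpow-⊖ (suc m) zero    = sym (*-identityʳ _)
    zpow-⊖ (suc m) (suc n) = begin
      zpow (suc m ℤ.⊖ suc n)  ≈⟨ reflexive (cong zpow (ℤₚ.[1+m]⊖[1+n]≡m⊖n m n)) ⟩
      zpow (m ℤ.⊖ n)          ≈⟨ zpow-⊖ m n ⟩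
      el ^ m * el⁻¹ ^ n       ≈⟨ sym (*-identityˡ _) ⟩
      1# * (el ^ m * el⁻¹ ^ n) ≈⟨ *-congʳ (sym inverse) ⟩
      el * el⁻¹ * (el ^ m * el⁻¹ ^ n)
        ≈⟨ solve 4 (λ a b c d → a :* b :* (c :* d) := a :* c :* (b :* d)) refl el el⁻¹ _ _ ⟩
      el ^ suc m * el⁻¹ ^ suc n ∎

    zpow-+ : ∀ k l → zpow (k ℤ.+ l) ≈ zpow k * zpow l
    zpow-+ (+ m)    (+ n)    = ^-homo-* el m n
    zpow-+ (+ m)    -[1+ n ] = zpow-⊖ m (suc n)
    zpow-+ -[1+ m ] (+ n)    = trans (zpow-⊖ n (suc m)) (*-comm _ _)
    zpow-+ -[1+ m ] -[1+ n ] = trans (^-≡ el⁻¹ (cong suc (≡.sym (ℕₚ.+-suc m n)))) (^-homo-* el⁻¹ (suc m) (suc n))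

  zpows : ∀ {n} → Vec Unit n → Vec ℤ n → Carrier
  zpows []       []       = 1#
  zpows (x ∷ xs) (k ∷ ks) = zpow x k * zpows xs ks

  zpows-+ : ∀ {n} (xs : Vec Unit n) ks ls → zpows xs (zipWith ℤ._+_ ks ls) ≈ zpows xs ks * zpows xs ls
  zpows-+ []       []       []       = sym (*-identityʳ 1#)
  zpows-+ (x ∷ xs) (k ∷ ks) (l ∷ ls) = trans (*-cong (zpow-+ x k l) (zpows-+ xs ks ls))
    (solve 4 (λ a b c d → a :* b :* (c :* d) := a :* c :* (b :* d)) refl _ _ _ _)

  zpows-0 : ∀ {n} (xs : Vec Unit n) → zpows xs (replicate n (+ 0)) ≈ 1#
  zpows-0 []       = refl
  zpows-0 (x ∷ xs) = trans (*-identityˡ _) (zpows-0 xs)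

  zpows-unit : ∀ {n} (xs : Vec Unit n) k j → zpows xs (unitVec k j) ≈ zpow (lookup xs j) k
  zpows-unit (x ∷ xs) k zero    = trans (*-congˡ (zpows-0 xs)) (*-identityʳ _)
  zpows-unit (x ∷ xs) k (suc j) = trans (*-identityˡ _) (zpows-unit xs k j)

  module Monomial {n : ℕ} (xs : Vec Unit n) where
    open Unit

    eval : Mono n → Carrier
    eval (η j)   = el (lookup xs j)
    eval (η⁻ j)   = el⁻¹ (lookup xs j)
    eval (s ⊗ t) = eval s * eval t
    eval (s ↑ k) = eval s ^ k

    eval-exponents : ∀ s → eval s ≈ zpows xs (exponents s)
    eval-exponents (η j)         = sym (trans (zpows-unit xs (+ 1) j) (*-identityʳ _))
    eval-exponents (η⁻ j)         = sym (trans (zpows-unit xs -[1+ 0 ] j) (*-identityʳ _))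
    eval-exponents (s ⊗ t)       = trans (*-cong (eval-exponents s) (eval-exponents t)) (sym (zpows-+ xs (exponents s) (exponents t)))
    eval-exponents (s ↑ zero)    = sym (zpows-0 xs)
    eval-exponents (s ↑ (suc k)) = trans (*-cong (eval-exponents s) (eval-exponents (s ↑ k)))
      (sym (zpows-+ xs (exponents s) (exponents (s ↑ k))))

    mono : ∀ s t → exponents s ≡ exponents t → eval s ≈ eval t
    mono s t p = trans (eval-exponents s) (trans (reflexive (cong (zpows xs) p)) (sym (eval-exponents t)))

  horner : List ℤ → Carrier → Carrier
  horner []       y = ι (+ 0)
  horner (c ∷ cs) y = ι c + y * horner cs y

  -- The reciprocal polynomial κ^d p(1/κ). In terms of v, κ = 1 - 8v³ is a polynomial while Y = 1/κ
  -- is not, so identities between polynomials in Y are checked in this form.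
  reversed : List ℤ → Carrier → Carrier
  reversed []       κ = 0#
  reversed (c ∷ []) κ = ι c
  reversed (c ∷ cs@(_ ∷ _)) κ = ι c * κ ^ length cs + reversed cs κ

  :reversed : ∀ {n} → List ℤ → Polynomial n → Polynomial n
  :reversed []       κ = con (+ 0)
  :reversed (c ∷ []) κ = con c
  :reversed (c ∷ cs@(_ ∷ _)) κ = con c :* κ :^ length cs :+ :reversed cs κ

  inverse-^ : ∀ {x y} → x * y ≈ 1# → ∀ n → x ^ n * y ^ n ≈ 1#
  inverse-^ p zero    = *-identityʳ 1#
  inverse-^ {x} {y} p (suc n) = trans (solve 4 (λ a b c d → a :* b :* (c :* d) := a :* c :* (b :* d)) refl x _ y _)
    (trans (*-cong p (inverse-^ p n)) (*-identityʳ 1#))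

  -- If y = 1/κ then y^d κ^(d-k) = y^k.
  reversed-horner : ∀ {y κ} → y * κ ≈ 1# → ∀ c cs → y ^ length cs * reversed (c ∷ cs) κ ≈ horner (c ∷ cs) y
  reversed-horner {y} yκ c []          = trans (*-identityˡ _) (sym (trans (+-congˡ (trans (*-congˡ ι-0) (zeroʳ y))) (+-identityʳ _)))
  reversed-horner {y} {κ} yκ c (d ∷ ds) = begin
    y ^ n * (ι c * κ ^ n + r)
      ≈⟨ distribˡ _ _ _ ⟩
    y ^ n * (ι c * κ ^ n) + y ^ n * r
      ≈⟨ +-cong (solve 3 (λ a b c → a :* (b :* c) := b :* (a :* c)) refl (y ^ n) (ι c) (κ ^ n)) (*-assoc y (y ^ length ds) r) ⟩
    ι c * (y ^ n * κ ^ n) + y * (y ^ length ds * r)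
      ≈⟨ +-cong (trans (*-congˡ (inverse-^ yκ n)) (*-identityʳ _)) (*-congˡ (reversed-horner yκ d ds)) ⟩
    horner (c ∷ d ∷ ds) y ∎
    where
    n = suc (length ds)
    r = reversed (d ∷ ds) κ

  -- Relations between X, X(q³), ξ and v

  module Level18 (q : Carrier) (units : Vec Unit 6) where
    open Monomial units public
    open Generators

    -- Xm, Ym, Zm, hm, gm are X, X(q³), q²ξ, h/q, v/q; Φm is 1 + h and Φ′m is 1 + h(q³);
    -- Um and Wm are the eta quotients that equal u and w.
    Xm Ym Zm hm gm Φm Um Wm Um⁻¹ Wm⁻¹ Φ′m : Mono 6
    Xm = e₂ ↑ 4 ⊗ e₃ ↑ 8 ⊗ i₁ ↑ 8 ⊗ i₆ ↑ 4
    Ym = e₆ ↑ 4 ⊗ e₉ ↑ 8 ⊗ i₃ ↑ 8 ⊗ i₁₈ ↑ 4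
    Zm = e₂ ↑ 5 ⊗ e₉ ↑ 4 ⊗ i₁ ↑ 4 ⊗ i₁₈ ↑ 5
    hm = e₁ ↑ 3 ⊗ e₆ ↑ 9 ⊗ i₂ ↑ 3 ⊗ i₃ ↑ 9
    gm = e₃ ⊗ e₁₈ ↑ 3 ⊗ i₆ ⊗ i₉ ↑ 3
    Φm = e₂ ↑ 5 ⊗ e₆ ⊗ i₁ ⊗ i₃ ↑ 5
    Φ′m = e₆ ↑ 5 ⊗ e₁₈ ⊗ i₃ ⊗ i₉ ↑ 5
    Um = e₁ ↑ 2 ⊗ i₂ ⊗ e₁₈ ⊗ i₉ ↑ 2
    Um⁻¹ = i₁ ↑ 2 ⊗ e₂ ⊗ i₁₈ ⊗ e₉ ↑ 2
    Wm = e₂ ↑ 2 ⊗ i₁ ⊗ i₆ ⊗ i₉ ↑ 2 ⊗ e₃ ⊗ e₁₈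
    Wm⁻¹ = i₂ ↑ 2 ⊗ e₁ ⊗ e₆ ⊗ e₉ ↑ 2 ⊗ i₃ ⊗ i₁₈

    v X₁ X₃ h : Carrier
    v = q * eval gm
    X₁ = eval Xm
    X₃ = eval Ym
    h = q * eval hm

    u w m : Carrier
    u = 1# - (v + v)
    w = 1# + v
    m = 1# + (v + v) + ι (+ 4) * (v * v)

    :u :w :m :κ : ∀ {n} → Polynomial n → Polynomial n
    :u v = :1 :- (v :+ v)
    :w v = :1 :+ v
    :m v = :1 :+ (v :+ v) :+ con (+ 4) :* (v :* v)
    :κ v = :1 :- con (+ 8) :* v :^ 3

    κ : Carrier
    κ = 1# - ι (+ 8) * v ^ 3

    module _ (U≈ : eval Um ≈ u) (W≈ : eval Wm ≈ w) where

      -- The product telescopes: X = (φ(-q³)/φ(-q))⁴, X(q³) = (φ(-q⁹)/φ(-q³))⁴ and u = φ(-q)/φ(-q⁹).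
      Xu⁴Y : X₁ * (X₃ * u ^ 4) ≈ 1#
      Xu⁴Y = trans (*-congˡ (*-congˡ (^-congˡ 4 (sym U≈)))) (mono (Xm ⊗ (Ym ⊗ Um ↑ 4)) (e₁ ↑ 0) ≡.refl)

      module _ (Yκ : X₃ * κ ≈ 1#) where

        -- As an eta quotient, h/q contains `Φ′m` over `Wm`. The first is 1 + v³ and the second 1 +
        -- v, so their quotient is the polynomial 1 - v + v².
        contract-h : eval Φ′m ≈ 1# + v ^ 3 → h ≈ u * v * X₃ * (1# - v + v * v)
        contract-h Φ′ = begin
          q * eval hm
            ≈⟨ *-congˡ (mono hm (Um ⊗ gm ⊗ Ym ⊗ (Wm⁻¹ ⊗ Φ′m)) ≡.refl) ⟩
          q * (eval Um * eval gm * X₃ * (eval Wm⁻¹ * eval Φ′m))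
            ≈⟨ *-congˡ (*-cong (*-congʳ (*-congʳ U≈)) (*-congˡ Φ′w)) ⟩
          q * (u * eval gm * X₃ * (eval Wm⁻¹ * (eval Wm * (1# - v + v * v))))
            ≈⟨ solve 7 (λ q u g y a b c → q :* (u :* g :* y :* (a :* (b :* c))) := u :* (q :* g) :* y :* (a :* b :* c)) refl
                 q u (eval gm) X₃ (eval Wm⁻¹) (eval Wm) (1# - v + v * v) ⟩
          u * v * X₃ * (eval Wm⁻¹ * eval Wm * (1# - v + v * v))
            ≈⟨ *-congˡ (trans (*-congʳ (mono (Wm⁻¹ ⊗ Wm) (e₁ ↑ 0) ≡.refl)) (*-identityˡ _)) ⟩
          u * v * X₃ * (1# - v + v * v) ∎
          where
          Φ′w : eval Φ′m ≈ eval Wm * (1# - v + v * v)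
          Φ′w = trans Φ′ (trans (solve 1 (λ v → :1 :+ v :^ 3 := :w v :* (:1 :- v :+ v :* v)) refl v) (*-congʳ (sym W≈)))

        -- With h = uvY(1 - v + v²) and Yκ = 1, the two conclusions rest on κ - 8uv(1 - v + v²) = u⁴
        -- and uw³ = κ + uv(1 - v + v²).
        contract : eval Φ′m ≈ 1# + v ^ 3 → (X₁ * (1# - ι (+ 8) * h) ≈ 1#) × (eval Φm ≈ 1# + h)
        contract Φ′ = X-part , Φ-part
          where
          h≈ = contract-h Φ′
          X-part : X₁ * (1# - ι (+ 8) * h) ≈ 1#
          X-part = begin
            X₁ * (1# - ι (+ 8) * h)
              ≈⟨ *-congˡ (+-cong (sym Yκ) (-‿cong (*-congˡ h≈))) ⟩
            X₁ * (X₃ * κ - ι (+ 8) * (u * v * X₃ * (1# - v + v * v)))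
              ≈⟨ *-congˡ (solve 2 (λ v y → y :* :κ v :- con (+ 8) :* (:u v :* v :* y :* (:1 :- v :+ v :* v)) := y :* :u v :^ 4) refl v X₃) ⟩
            X₁ * (X₃ * u ^ 4)
              ≈⟨ Xu⁴Y ⟩
            1# ∎
          Φ-part : eval Φm ≈ 1# + h
          Φ-part = begin
            eval Φm
              ≈⟨ mono Φm (Um ⊗ Wm ↑ 3 ⊗ Ym) ≡.refl ⟩
            eval Um * eval Wm ^ 3 * X₃
              ≈⟨ *-congʳ (*-cong U≈ (^-congˡ 3 W≈)) ⟩
            u * w ^ 3 * X₃
              ≈⟨ solve 2 (λ v y → :u v :* :w v :^ 3 :* y := y :* :κ v :+ :u v :* v :* y :* (:1 :- v :+ v :* v)) refl v X₃ ⟩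
            X₃ * κ + u * v * X₃ * (1# - v + v * v)
              ≈⟨ +-cong Yκ (sym h≈) ⟩
            1# + h ∎

        Yum : X₃ * u * m ≈ 1#
        Yum = trans (solve 2 (λ v y → y :* :u v :* :m v := y :* :κ v) refl v X₃) Yκ

        X≈ : X₁ ≈ X₃ ^ 3 * m ^ 4
        X≈ = begin
          X₁                           ≈⟨ sym (*-identityʳ X₁) ⟩
          X₁ * 1#                      ≈⟨ *-congˡ (solve 0 (:1 := :1 :^ 4) refl) ⟩
          X₁ * 1# ^ 4                  ≈⟨ *-congˡ (^-congˡ 4 (sym Yum)) ⟩
          X₁ * (X₃ * u * m) ^ 4         ≈⟨ solve 4 (λ x y u m → x :* (y :* u :* m) :^ 4 := x :* (y :* u :^ 4) :* (y :^ 3 :* m :^ 4)) refl X₁ X₃ u m ⟩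
          X₁ * (X₃ * u ^ 4) * (X₃ ^ 3 * m ^ 4) ≈⟨ *-congʳ Xu⁴Y ⟩
          1# * (X₃ ^ 3 * m ^ 4)        ≈⟨ *-identityˡ _ ⟩
          X₃ ^ 3 * m ^ 4 ∎

        -- The equation is a polynomial identity only modulo r = 1, where r = Yum. Each term
        -- receives the power of r that makes it homogeneous of degree 9 in Y; the result holds
        -- identically in v and Y, and then r is replaced by 1.
        modular-equation : X₁ ^ 3 ≈ (ι (+ 30) * X₃ - ι (+ 108) * X₃ ^ 2 + ι (+ 81) * X₃ ^ 3) * X₁ ^ 2
          + (ι (+ 9) * X₃ ^ 2 - ι (+ 12) * X₃) * X₁ + X₃
        modular-equation = begin
          X₁ ^ 3
            ≈⟨ ^-congˡ 3 X≈ ⟩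
          (X₃ ^ 3 * m ^ 4) ^ 3
            ≈⟨ solve 2 (λ v y → let m = :m v ; u = :u v ; r = y :* u :* m in (y :^ 3 :* m :^ 4) :^ 3 :=
                 (con (+ 30) :* y :* r :^ 2 :- con (+ 108) :* y :^ 2 :* r :+ con (+ 81) :* y :^ 3) :* (y :^ 3 :* m :^ 4) :^ 2
                 :+ (con (+ 9) :* y :^ 2 :* r :^ 4 :- con (+ 12) :* y :* r :^ 5) :* (y :^ 3 :* m :^ 4) :+ y :* r :^ 8) refl v X₃ ⟩
          equation (X₃ * u * m) (X₃ ^ 3 * m ^ 4)
            ≈⟨ equation-cong Yum (sym X≈) ⟩
          equation 1# X₁
            ≈⟨ solve 2 (λ x y → (con (+ 30) :* y :* :1 :^ 2 :- con (+ 108) :* y :^ 2 :* :1 :+ con (+ 81) :* y :^ 3) :* x :^ 2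
                 :+ (con (+ 9) :* y :^ 2 :* :1 :^ 4 :- con (+ 12) :* y :* :1 :^ 5) :* x :+ y :* :1 :^ 8
                 := (con (+ 30) :* y :- con (+ 108) :* y :^ 2 :+ con (+ 81) :* y :^ 3) :* x :^ 2
                 :+ (con (+ 9) :* y :^ 2 :- con (+ 12) :* y) :* x :+ y) refl X₁ X₃ ⟩
          _ ∎
          where
          equation : Carrier → Carrier → Carrier
          equation r x = (ι (+ 30) * X₃ * r ^ 2 - ι (+ 108) * X₃ ^ 2 * r + ι (+ 81) * X₃ ^ 3) * x ^ 2
            + (ι (+ 9) * X₃ ^ 2 * r ^ 4 - ι (+ 12) * X₃ * r ^ 5) * x + X₃ * r ^ 8
          equation-cong : ∀ {r r′ x x′} → r ≈ r′ → x ≈ x′ → equation r x ≈ equation r′ x′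
          equation-cong p s = +-cong (+-cong
            (*-cong (+-congʳ (+-cong (*-congˡ (^-congˡ 2 p)) (-‿cong (*-congˡ p)))) (^-congˡ 2 s))
            (*-cong (+-cong (*-congˡ (^-congˡ 4 p)) (-‿cong (*-congˡ (^-congˡ 5 p)))) s)) (*-congˡ (^-congˡ 8 p))

        -- (v/q)² q²ξ, times 4 so that reducing it modulo 8v³ = 1 - 1/Y keeps the coefficients integral
        weight : Carrier
        weight = ι (+ 4) * (eval Zm * eval gm ^ 2)

        weight≈ : weight ≈ ι (+ 4) * (X₃ * (m * w ^ 2))
        weight≈ = *-congˡ (begin
          eval Zm * eval gm ^ 2
            ≈⟨ mono (Zm ⊗ gm ↑ 2) (Um⁻¹ ⊗ Wm ↑ 2) ≡.refl ⟩
          eval Um⁻¹ * eval Wm ^ 2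
            ≈⟨ *-cong Um⁻¹≈ (^-congˡ 2 W≈) ⟩
          X₃ * m * w ^ 2
            ≈⟨ *-assoc X₃ m _ ⟩
          X₃ * (m * w ^ 2) ∎)
          where
          Um⁻¹≈ : eval Um⁻¹ ≈ X₃ * m
          Um⁻¹≈ = begin
            eval Um⁻¹                     ≈⟨ sym (*-identityʳ _) ⟩
            eval Um⁻¹ * 1#                ≈⟨ *-congˡ (sym Yum) ⟩
            eval Um⁻¹ * (X₃ * u * m)       ≈⟨ *-congˡ (*-congʳ (*-congˡ (sym U≈))) ⟩
            eval Um⁻¹ * (X₃ * eval Um * m) ≈⟨ solve 4 (λ a y b m → a :* (y :* b :* m) := a :* b :* (y :* m)) refl _ X₃ (eval Um) m ⟩
            eval Um⁻¹ * eval Um * (X₃ * m) ≈⟨ *-congʳ (mono (Um⁻¹ ⊗ Um) (e₁ ↑ 0) ≡.refl) ⟩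
            1# * (X₃ * m)                  ≈⟨ *-identityˡ _ ⟩
            X₃ * m ∎

        -- Coordinates in the basis 1, v, v² over ℤ[Y]. Sorting G by exponents of v modulo 3 and
        -- putting 8v³ = 1 - κ makes each coordinate a polynomial in κ; the factor Y^d = κ^(-d)
        -- reverses its coefficients.
        split : ∀ {F G} c₀ l₀ c₁ l₁ c₂ l₂ → length l₁ ≡ length l₀ → length l₂ ≡ length l₀ →
          F ≈ X₃ ^ length l₀ * G →
          G ≈ reversed (c₀ ∷ l₀) κ + reversed (c₁ ∷ l₁) κ * v + reversed (c₂ ∷ l₂) κ * v ^ 2 →
          F ≈ horner (c₀ ∷ l₀) X₃ + horner (c₁ ∷ l₁) X₃ * v + horner (c₂ ∷ l₂) X₃ * v ^ 2
        split {F} {G} c₀ l₀ c₁ l₁ c₂ l₂ eq₁ eq₂ F≈ G≈ = begin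
          F ≈⟨ F≈ ⟩
          y * G ≈⟨ *-congˡ G≈ ⟩
          y * (reversed (c₀ ∷ l₀) κ + reversed (c₁ ∷ l₁) κ * v + reversed (c₂ ∷ l₂) κ * v ^ 2)
            ≈⟨ solve 5 (λ y a b c v → y :* (a :+ b :* v :+ c :* v :^ 2) := y :* a :+ y :* b :* v :+ y :* c :* v :^ 2) refl y _ _ _ v ⟩
          y * reversed (c₀ ∷ l₀) κ + y * reversed (c₁ ∷ l₁) κ * v + y * reversed (c₂ ∷ l₂) κ * v ^ 2
            ≈⟨ +-cong (+-cong (reversed-horner Yκ c₀ l₀)
                 (*-congʳ (trans (*-congʳ (^-≡ X₃ (≡.sym eq₁))) (reversed-horner Yκ c₁ l₁))))
                 (*-congʳ (trans (*-congʳ (^-≡ X₃ (≡.sym eq₂))) (reversed-horner Yκ c₂ l₂))) ⟩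
          _ ∎
          where y = X₃ ^ length l₀

        -- The coefficients come from expanding m⁴ and substituting v³ = (1 - κ)/8. The first list
        -- is row 1 of `a`, preceded by the constant coefficient 0.
        split-X : X₁ ≈ horner (+ 0 ∷ + 10 ∷ neg (+ 36) ∷ + 27 ∷ []) X₃
          + horner (+ 0 ∷ + 8 ∷ neg (+ 54) ∷ + 54 ∷ []) X₃ * v
          + horner (+ 0 ∷ + 4 ∷ neg (+ 72) ∷ + 108 ∷ []) X₃ * v ^ 2
        split-X = split {G = m ^ 4}
          (+ 0) (+ 10 ∷ neg (+ 36) ∷ + 27 ∷ [])
          (+ 0) (+ 8 ∷ neg (+ 54) ∷ + 54 ∷ [])
          (+ 0) (+ 4 ∷ neg (+ 72) ∷ + 108 ∷ [])
          ≡.refl ≡.refl X≈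
          (solve 1 (λ v → :m v :^ 4 :=
            :reversed (+ 0 ∷ + 10 ∷ neg (+ 36) ∷ + 27 ∷ []) (:κ v)
            :+ :reversed (+ 0 ∷ + 8 ∷ neg (+ 54) ∷ + 54 ∷ []) (:κ v) :* v
            :+ :reversed (+ 0 ∷ + 4 ∷ neg (+ 72) ∷ + 108 ∷ []) (:κ v) :* v :^ 2) refl v)

        split-X² : X₁ ^ 2 ≈ horner (+ 0 ∷ neg (+ 8) ∷ + 306 ∷ neg (+ 2160) ∷ + 5508 ∷ neg (+ 5832) ∷ + 2187 ∷ []) X₃
          + horner (+ 0 ∷ neg (+ 2) ∷ + 234 ∷ neg (+ 2484) ∷ + 8100 ∷ neg (+ 10206) ∷ + 4374 ∷ []) X₃ * v
          + horner (+ 0 ∷ + 0 ∷ + 144 ∷ neg (+ 2592) ∷ + 11340 ∷ neg (+ 17496) ∷ + 8748 ∷ []) X₃ * v ^ 2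
        split-X² = split {G = m ^ 8}
          (+ 0) (neg (+ 8) ∷ + 306 ∷ neg (+ 2160) ∷ + 5508 ∷ neg (+ 5832) ∷ + 2187 ∷ [])
          (+ 0) (neg (+ 2) ∷ + 234 ∷ neg (+ 2484) ∷ + 8100 ∷ neg (+ 10206) ∷ + 4374 ∷ [])
          (+ 0) (+ 0 ∷ + 144 ∷ neg (+ 2592) ∷ + 11340 ∷ neg (+ 17496) ∷ + 8748 ∷ [])
          ≡.refl ≡.refl (trans (^-congˡ 2 X≈) (solve 2 (λ y m → (y :^ 3 :* m :^ 4) :^ 2 := y :^ 6 :* m :^ 8) refl X₃ m))
          (solve 1 (λ v → :m v :^ 8 :=
            :reversed (+ 0 ∷ neg (+ 8) ∷ + 306 ∷ neg (+ 2160) ∷ + 5508 ∷ neg (+ 5832) ∷ + 2187 ∷ []) (:κ v)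
            :+ :reversed (+ 0 ∷ neg (+ 2) ∷ + 234 ∷ neg (+ 2484) ∷ + 8100 ∷ neg (+ 10206) ∷ + 4374 ∷ []) (:κ v) :* v
            :+ :reversed (+ 0 ∷ + 0 ∷ + 144 ∷ neg (+ 2592) ∷ + 11340 ∷ neg (+ 17496) ∷ + 8748 ∷ []) (:κ v) :* v :^ 2) refl v)

        -- Since ξ carries q^(-2), U reads off the coordinate of v². Here and in the two products
        -- with powers of X, that list is 4 times the coefficients of U(ξX^i), so the factor 4 can
        -- be removed again.
        split-weight : weight ≈ horner (neg (+ 5) ∷ + 9 ∷ []) X₃
          + horner (neg (+ 2) ∷ + 18 ∷ []) X₃ * v
          + horner (+ 0 ∷ + 36 ∷ []) X₃ * v ^ 2
        split-weight = split {G = ι (+ 4) * (m * w ^ 2)}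
          (neg (+ 5)) (+ 9 ∷ [])
          (neg (+ 2)) (+ 18 ∷ [])
          (+ 0) (+ 36 ∷ [])
          ≡.refl ≡.refl (trans weight≈ (solve 3 (λ y m w → con (+ 4) :* (y :* (m :* w :^ 2)) := y :^ 1 :* (con (+ 4) :* (m :* w :^ 2))) refl X₃ m w))
          (solve 1 (λ v → con (+ 4) :* (:m v :* :w v :^ 2) :=
            :reversed (neg (+ 5) ∷ + 9 ∷ []) (:κ v)
            :+ :reversed (neg (+ 2) ∷ + 18 ∷ []) (:κ v) :* v
            :+ :reversed (+ 0 ∷ + 36 ∷ []) (:κ v) :* v :^ 2) refl v)

        split-weight-X : weight * X₁ ≈ horner (+ 1 ∷ neg (+ 114) ∷ + 765 ∷ neg (+ 1377) ∷ + 729 ∷ []) X₃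
          + horner (+ 0 ∷ neg (+ 78) ∷ + 936 ∷ neg (+ 2268) ∷ + 1458 ∷ []) X₃ * v
          + horner (+ 0 ∷ neg (+ 36) ∷ + 1008 ∷ neg (+ 3564) ∷ + 2916 ∷ []) X₃ * v ^ 2
        split-weight-X = split {G = ι (+ 4) * (m ^ 5 * w ^ 2)}
          (+ 1) (neg (+ 114) ∷ + 765 ∷ neg (+ 1377) ∷ + 729 ∷ [])
          (+ 0) (neg (+ 78) ∷ + 936 ∷ neg (+ 2268) ∷ + 1458 ∷ [])
          (+ 0) (neg (+ 36) ∷ + 1008 ∷ neg (+ 3564) ∷ + 2916 ∷ [])
          ≡.refl ≡.refl (trans (*-cong weight≈ X≈) (solve 3 (λ y m w → con (+ 4) :* (y :* (m :* w :^ 2)) :* (y :^ 3 :* m :^ 4) := y :^ 4 :* (con (+ 4) :* (m :^ 5 :* w :^ 2))) refl X₃ m w))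
          (solve 1 (λ v → con (+ 4) :* (:m v :^ 5 :* :w v :^ 2) :=
            :reversed (+ 1 ∷ neg (+ 114) ∷ + 765 ∷ neg (+ 1377) ∷ + 729 ∷ []) (:κ v)
            :+ :reversed (+ 0 ∷ neg (+ 78) ∷ + 936 ∷ neg (+ 2268) ∷ + 1458 ∷ []) (:κ v) :* v
            :+ :reversed (+ 0 ∷ neg (+ 36) ∷ + 1008 ∷ neg (+ 3564) ∷ + 2916 ∷ []) (:κ v) :* v :^ 2) refl v)

        split-weight-X² : weight * X₁ ^ 2 ≈ horner (+ 0 ∷ + 85 ∷ neg (+ 3672) ∷ + 35424 ∷ neg (+ 133164) ∷ + 232551 ∷ neg (+ 190269) ∷ + 59049 ∷ []) X₃
          + horner (+ 0 ∷ + 26 ∷ neg (+ 2592) ∷ + 36666 ∷ neg (+ 175446) ∷ + 364500 ∷ neg (+ 341172) ∷ + 118098 ∷ []) X₃ * v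
          + horner (+ 0 ∷ + 4 ∷ neg (+ 1512) ∷ + 34452 ∷ neg (+ 218700) ∷ + 554040 ∷ neg (+ 603612) ∷ + 236196 ∷ []) X₃ * v ^ 2
        split-weight-X² = split {G = ι (+ 4) * (m ^ 9 * w ^ 2)}
          (+ 0) (+ 85 ∷ neg (+ 3672) ∷ + 35424 ∷ neg (+ 133164) ∷ + 232551 ∷ neg (+ 190269) ∷ + 59049 ∷ [])
          (+ 0) (+ 26 ∷ neg (+ 2592) ∷ + 36666 ∷ neg (+ 175446) ∷ + 364500 ∷ neg (+ 341172) ∷ + 118098 ∷ [])
          (+ 0) (+ 4 ∷ neg (+ 1512) ∷ + 34452 ∷ neg (+ 218700) ∷ + 554040 ∷ neg (+ 603612) ∷ + 236196 ∷ [])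
          ≡.refl ≡.refl (trans (*-cong weight≈ (^-congˡ 2 X≈)) (solve 3 (λ y m w → con (+ 4) :* (y :* (m :* w :^ 2)) :* (y :^ 3 :* m :^ 4) :^ 2 := y :^ 7 :* (con (+ 4) :* (m :^ 9 :* w :^ 2))) refl X₃ m w))
          (solve 1 (λ v → con (+ 4) :* (:m v :^ 9 :* :w v :^ 2) :=
            :reversed (+ 0 ∷ + 85 ∷ neg (+ 3672) ∷ + 35424 ∷ neg (+ 133164) ∷ + 232551 ∷ neg (+ 190269) ∷ + 59049 ∷ []) (:κ v)
            :+ :reversed (+ 0 ∷ + 26 ∷ neg (+ 2592) ∷ + 36666 ∷ neg (+ 175446) ∷ + 364500 ∷ neg (+ 341172) ∷ + 118098 ∷ []) (:κ v) :* v
            :+ :reversed (+ 0 ∷ + 4 ∷ neg (+ 1512) ∷ + 34452 ∷ neg (+ 218700) ∷ + 554040 ∷ neg (+ 603612) ∷ + 236196 ∷ []) (:κ v) :* v :^ 2) refl v)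

-- Precision, dilation and extraction of residue classes

module K = RingKit psRing constP-morphism
module Mod (N : ℕ) = RingKit (psRingMod N) (constP-morphismMod N)
open K

weaken : ∀ {N f g} → f ≈ g → f ≡[ N ] g
weaken p n _ = p n

≡[]-≤ : ∀ {M N f g} → M ≤ N → f ≡[ N ] g → f ≡[ M ] g
≡[]-≤ M≤N p n n<M = p n (ℕₚ.<-≤-trans n<M M≤N)

≡[]-all : ∀ {f g} → (∀ N → f ≡[ N ] g) → f ≈ g
≡[]-all p n = p (suc n) n ℕₚ.≤-refl

q^*-+ : ∀ m f n → (q ^ m * f) (m ℕ.+ n) ≡ f n
q^*-+ zero    f n = *-identityˡ f n
q^*-+ (suc m) f n = ≡.trans (*-assoc q (q ^ m) f (suc (m ℕ.+ n)))
  (≡.trans (q·-suc (q ^ m * f) (m ℕ.+ n)) (q^*-+ m f n))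

q^*-< : ∀ m f n → n < m → (q ^ m * f) n ≡ + 0
q^*-< (suc m) f zero    _         = ≡.trans (*-assoc q (q ^ m) f 0) (·-at0 q (q ^ m * f))
q^*-< (suc m) f (suc n) (s≤s n<m) = ≡.trans (*-assoc q (q ^ m) f (suc n))
  (≡.trans (q·-suc (q ^ m * f) n) (q^*-< m f n n<m))

decompose : ∀ f → f ≈ constP (f 0) + q * tailP f
decompose f zero    = ≡.sym (≡.trans (⊕-at (constP (f 0)) (q * tailP f) 0)
  (≡.trans (cong (λ z → f 0 ℤ.+ z) (·-at0 q (tailP f))) (ℤₚ.+-identityʳ (f 0))))
decompose f (suc n) = ≡.sym (≡.trans (⊕-at (constP (f 0)) (q * tailP f) (suc n))
  (≡.trans (ℤₚ.+-identityˡ _) (q·-suc (tailP f) n)))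

q*-cong[] : ∀ {N f g} → f ≡[ N ] g → (q * f) ≡[ suc N ] (q * g)
q*-cong[] {N} {f} {g} p zero    _         = ≡.trans (·-at0 q f) (≡.sym (·-at0 q g))
q*-cong[] {N} {f} {g} p (suc n) (s≤s n<N) = ≡.trans (q·-suc f n) (≡.trans (p n n<N) (≡.sym (q·-suc g n)))

ord-* : ∀ {M N f g} → f ≡[ M ] 0P → g ≡[ N ] 0P → (f * g) ≡[ M ℕ.+ N ] 0P
ord-* {M} {N} {f} {g} p r n n<M+N = ·-vanish f g n vanish
  where
  vanish : ∀ k → k ≤ n → f k ℤ.* g (n ℕ.∸ k) ≡ + 0
  vanish k k≤n with k ℕₚ.<? M
  ... | yes k<M = cong (ℤ._* g (n ℕ.∸ k)) (p k k<M)
  ... | no k≮M  = ≡.trans (cong (f k ℤ.*_) (r (n ℕ.∸ k) n∸k<N)) (ℤₚ.*-zeroʳ (f k))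
    where
    n∸k<N : n ℕ.∸ k < N
    n∸k<N = ℕₚ.+-cancelˡ-< k _ _ (subst (_< k ℕ.+ N) (≡.sym (ℕₚ.m+[n∸m]≡n k≤n))
              (ℕₚ.<-≤-trans n<M+N (ℕₚ.+-monoˡ-≤ N (ℕₚ.≮⇒≥ k≮M))))

-- Each unfolding multiplies the difference of F and G by a positive power of q, so they agree to
-- every order. With `I` the power series and `t` the tail, this proves the laws of dilation and
-- sections without index arithmetic.
fixpoint : {I : Set} (F G : I → PS) (t : I → I) (h : I → PS) (M : ℕ) →
  (∀ i → F i ≈ h i + q ^ suc M * F (t i)) → (∀ i → G i ≈ h i + q ^ suc M * G (t i)) →
  ∀ i → F i ≈ G i
fixpoint F G t h M F-eq G-eq i = ≡[]-all λ N → approx N i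
  where
  approx : ∀ N i → F i ≡[ N ] G i
  approx zero    i n ()
  approx (suc N) i = M′.trans (weaken (F-eq i)) (M′.trans (M′.+-congˡ advance) (M′.sym (weaken (G-eq i))))
    where
    module M′ = Mod (suc N)
    advance : (q ^ suc M * F (t i)) ≡[ suc N ] (q ^ suc M * G (t i))
    advance = M′.trans (weaken (*-assoc q (q ^ M) (F (t i)))) (M′.trans
      (q*-cong[] (Mod.*-congˡ N (approx N (t i)))) (weaken (sym (*-assoc q (q ^ M) (G (t i))))))

cancel-ι : ∀ c .{{_ : ℤ.NonZero c}} {f g} → ι c * f ≈ ι c * g → f ≈ g
cancel-ι c {f} {g} p n = ℤₚ.*-cancelˡ-≡ c (f n) (g n)
  (≡.trans (≡.sym (constP-· c f n)) (≡.trans (p n) (constP-· c g n)))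

-- Convergence at a prescribed rate; sums and products of limits then keep the rate, and passing to
-- later terms preserves it.
Lim : (ℕ → PS) → PS → Set
Lim s f = ∀ n → s n ≡[ n ] f

Lim-unique : ∀ {s f g} → Lim s f → Lim s g → f ≈ g
Lim-unique p r = ≡[]-all λ N n l → ≡.trans (≡.sym (p N n l)) (r N n l)

Lim-≈ : ∀ {s t f} → (∀ n → s n ≈ t n) → Lim s f → Lim t f
Lim-≈ e p n k l = ≡.trans (≡.sym (e n k)) (p n k l)

Lim-* : ∀ {s t f g} → Lim s f → Lim t g → Lim (λ n → s n * t n) (f * g)
Lim-* p r n = Mod.*-cong n (p n) (r n)

Lim-+ : ∀ {s t f g} → Lim s f → Lim t g → Lim (λ n → s n + t n) (f + g)
Lim-+ p r n = Mod.+-cong n (p n) (r n)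

Lim-const : ∀ f → Lim (λ _ → f) f
Lim-const f n k l = ≡.refl

Lim-sub : ∀ {s f} (r : ℕ → ℕ) → (∀ n → n ≤ r n) → Lim s f → Lim (λ n → s (r n)) f
Lim-sub r n≤r p n = ≡[]-≤ (n≤r n) (p (r n))

q^-coeff : ∀ m n → (q ^ m) n ≡ (if n ≡ᵇ m then + 1 else + 0)
q^-coeff zero    zero    = ≡.refl
q^-coeff zero    (suc n) = ≡.refl
q^-coeff (suc m) zero    = ·-at0 q (q ^ m)
q^-coeff (suc m) (suc n) = ≡.trans (q·-suc (q ^ m) n) (q^-coeff m n)

oneMinusQ-suc : ∀ m → oneMinusQ (suc m) ≈ 1# + - q * q ^ m
oneMinusQ-suc m n = ≡.trans (coeff n) (≡.trans (cong (λ z → oneP n ℤ.+ z)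
  (≡.trans (cong ℤ.-_ (≡.sym (q^-coeff (suc m) n))) (≡.trans (≡.sym (⊖-at (q ^ suc m) n)) (≡.sym (-q* n)))))
  (≡.sym (⊕-at 1# (- q * q ^ m) n)))
  where
  -q* : - q * q ^ m ≈ - (q ^ suc m)
  -q* = solve 2 (λ x t → :- x :* t := :- (x :* t)) refl q (q ^ m)
  coeff : ∀ n → oneMinusQ (suc m) n ≡ oneP n ℤ.+ ℤ.- (if n ≡ᵇ suc m then + 1 else + 0)
  coeff zero    = ≡.refl
  coeff (suc n) with n ≡ᵇ m
  ... | true  = ≡.refl
  ... | false = ≡.refl

finProd≈poch : ∀ n → finProd n ≈ poch (- q) q n
finProd≈poch zero    = refl
finProd≈poch (suc n) = trans (λ k → cong (λ h → h k) (≡.sym (·-*P (finProd n) (oneMinusQ (suc n))))) (*-cong (finProd≈poch n) (oneMinusQ-suc n))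

q^-ord : ∀ m → (q ^ m) ≡[ m ] 0P
q^-ord m n n<m = ≡.trans (≡.sym (*-identityʳ (q ^ m) n)) (q^*-< m 1# n n<m)

-- The additional factors 1 - q^m have m > n and are 1 modulo q^(n+1). This is what makes the
-- diagonal definition of `E` the infinite product.
poch-stable : ∀ n k → poch (- q) q (k ℕ.+ n) ≡[ suc n ] poch (- q) q n
poch-stable n zero    = M.refl where module M = Mod (suc n)
poch-stable n (suc k) = M.trans (M.trans (M.*-congˡ one) (M.*-identityʳ _)) (poch-stable n k)
  where
  module M = Mod (suc n)
  factor : 1# + - q * q ^ (k ℕ.+ n) ≈ 1# + - (q ^ suc (k ℕ.+ n) * 1#)
  factor = solve 2 (λ x t → :1 :+ :- x :* t := :1 :+ :- (x :* t :* :1)) refl q (q ^ (k ℕ.+ n))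
  one : (1# + - q * q ^ (k ℕ.+ n)) ≡[ suc n ] 1#
  one = M.trans (weaken factor) (M.trans (M.+-congˡ (M.-‿cong (M.trans (weaken (*-identityʳ _))
          (≡[]-≤ (s≤s (ℕₚ.m≤n+m n k)) (q^-ord (suc (k ℕ.+ n)))))))
          (M.trans (M.+-congˡ M.-0≈0) (M.+-identityʳ 1#)))

E-lim : Lim (poch (- q) q) E
E-lim n m m<n = ≡.trans
  (subst (λ t → poch (- q) q t m ≡ poch (- q) q m m) (ℕₚ.m∸n+n≡m (ℕₚ.<⇒≤ m<n)) (poch-stable m (n ℕ.∸ m) m ℕₚ.≤-refl))
  (≡.sym (finProd≈poch m m))

module Dilation (d : ℕ) where

  D : PS → PS
  D = dil (suc d)

  -- The precision is multiplied by the dilation factor; this gain drives the induction for the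
  -- level 6 identities.
  D-cong[] : ∀ {N f g} → f ≡[ N ] g → D f ≡[ N ℕ.* suc d ] D g
  D-cong[] p n l with (n DivMod.% suc d) ≡ᵇ 0
  ... | true  = p _ (DivMod.m<n*o⇒m/o<n l)
  ... | false = ≡.refl

  D-cong : ∀ {f g} → f ≈ g → D f ≈ D g
  D-cong p n with (n DivMod.% suc d) ≡ᵇ 0
  ... | true  = p _
  ... | false = ≡.refl

  D-low : ∀ f n → n < d → D f (suc n) ≡ + 0
  D-low f n n<d =
    cong (λ r → if r ≡ᵇ 0 then f (suc n DivMod./ suc d) else + 0) (DivMod.m<n⇒m%n≡m {n = suc d} (s≤s n<d))

  D-+ : ∀ f g → D (f + g) ≈ D f + D g
  D-+ f g n = ≡.trans pushed (≡.sym (⊕-at (D f) (D g) n))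
    where
    pushed : D (f + g) n ≡ D f n ℤ.+ D g n
    pushed with (n DivMod.% suc d) ≡ᵇ 0
    ... | true  = ⊕-at f g _
    ... | false = ≡.refl

  D-neg : ∀ f → D (- f) ≈ - D f
  D-neg f n = ≡.trans pushed (≡.sym (⊖-at (D f) n))
    where
    pushed : D (- f) n ≡ ℤ.- D f n
    pushed with (n DivMod.% suc d) ≡ᵇ 0
    ... | true  = ⊖-at f _
    ... | false = ≡.refl

  D-scale : ∀ c f → D (ι c * f) ≈ ι c * D f
  D-scale c f n = ≡.trans (D-cong (constP-· c f) n) (≡.trans scaled (≡.sym (constP-· c (D f) n)))
    where
    scaled : D (λ k → c ℤ.* f k) n ≡ c ℤ.* D f n
    scaled with (n DivMod.% suc d) ≡ᵇ 0
    ... | true  = ≡.refl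
    ... | false = ≡.sym (ℤₚ.*-zeroʳ c)

  D-shift : ∀ f n → D f (suc d ℕ.+ n) ≡ D (tailP f) n
  D-shift f n = ≡.trans (cong (D f) (ℕₚ.+-comm (suc d) n)) (cong₂ (λ r s → if r ≡ᵇ 0 then f s else + 0)
    (DivMod.[m+n]%n≡m%n n (suc d))
    (≡.trans (DivMod.m/n≡1+[m∸n]/n {n ℕ.+ suc d} {suc d} (ℕₚ.m≤n+m (suc d) n))
             (cong (λ t → suc (t DivMod./ suc d)) (ℕₚ.m+n∸n≡m n (suc d)))))

  D-decompose : ∀ f → D f ≈ constP (f 0) + q ^ suc d * D (tailP f)
  D-decompose f n = ≡.trans (split n) (≡.sym (⊕-at (constP (f 0)) (q ^ suc d * D (tailP f)) n))
    where
    split : ∀ n → D f n ≡ constP (f 0) n ℤ.+ (q ^ suc d * D (tailP f)) n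
    split zero = ≡.sym (≡.trans (cong (λ z → f 0 ℤ.+ z) (q^*-< (suc d) (D (tailP f)) 0 (s≤s z≤n))) (ℤₚ.+-identityʳ (f 0)))
    split (suc n) with n ℕₚ.<? d
    ... | yes n<d = ≡.trans (D-low f n n<d) (≡.sym (≡.trans (ℤₚ.+-identityˡ _) (q^*-< (suc d) (D (tailP f)) (suc n) (s≤s n<d))))
    ... | no n≮d = subst (λ t → D f t ≡ constP (f 0) t ℤ.+ (q ^ suc d * D (tailP f)) t) (cong suc (ℕₚ.m+[n∸m]≡n (ℕₚ.≮⇒≥ n≮d)))
      (≡.trans (D-shift f (n ℕ.∸ d)) (≡.sym (≡.trans (ℤₚ.+-identityˡ _) (q^*-+ (suc d) (D (tailP f)) (n ℕ.∸ d)))))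

  D-q* : ∀ f → D (q * f) ≈ q ^ suc d * D f
  D-q* f = trans (D-decompose (q * f)) (trans (+-cong (trans const₀ ι-0) (*-congˡ {x = q ^ suc d} (D-cong (q·-suc f)))) (+-identityˡ (q ^ suc d * D f)))
    where
    const₀ : constP ((q * f) 0) ≈ constP (+ 0)
    const₀ n = cong (λ c → constP c n) (·-at0 q f)

  -- As functions of `f`, both sides obey the same recursion along `tailP` with step q^(d+1), so
  -- `fixpoint` identifies them.
  D-* : ∀ f g → D (f * g) ≈ D f * D g
  D-* f g = fixpoint (λ f → D (f * g)) (λ f → D f * D g) tailP (λ f → constP (f 0) * D g) d
    (λ f → trans (D-cong (trans (*-congʳ {x = g} (decompose f)) (distribʳ g _ _)))
      (trans (D-+ (constP (f 0) * g) (q * tailP f * g)) (+-cong (D-scale (f 0) g)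
        (trans (D-cong (*-assoc q (tailP f) g)) (D-q* (tailP f * g))))))
    (λ f → trans (*-congʳ {x = D g} (D-decompose f)) (trans (distribʳ (D g) _ _)
      (+-congˡ {x = constP (f 0) * D g} (*-assoc (q ^ suc d) (D (tailP f)) (D g)))))
    f

  D-1 : D 1# ≈ 1#
  D-1 = trans (D-decompose 1#) (trans (+-cong ι-1 (trans (*-congˡ {x = q ^ suc d} (D-cong {tailP 1#} {0P} (λ _ → ≡.refl)))
    (trans (*-congˡ {x = q ^ suc d} D-0) (zeroʳ (q ^ suc d))))) (+-identityʳ 1#))
    where
    D-0 : D 0P ≈ 0P
    D-0 n with (n DivMod.% suc d) ≡ᵇ 0
    ... | true  = ≡.refl
    ... | false = ≡.refl

  D-ι : ∀ c → D (ι c) ≈ ι c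
  D-ι c = trans (D-cong (sym (*-identityʳ (ι c)))) (trans (D-scale c 1#) (trans (*-congˡ {x = ι c} D-1) (*-identityʳ (ι c))))

  D-q : D q ≈ q ^ suc d
  D-q = trans (D-cong (sym (*-identityʳ q))) (trans (D-q* 1#) (trans (*-congˡ {x = q ^ suc d} D-1) (*-identityʳ (q ^ suc d))))

  D-^ : ∀ f n → D (f ^ n) ≈ D f ^ n
  D-^ f zero    = D-1
  D-^ f (suc n) = trans (D-* f (f ^ n)) (*-congˡ {x = D f} (D-^ f n))

  D-poch : ∀ x y n → D (poch x y n) ≈ poch (D x) (D y) n
  D-poch x y zero    = D-1
  D-poch x y (suc n) = trans (D-* (poch x y n) _) (*-cong (D-poch x y n)
    (trans (D-+ 1# (x * y ^ n)) (+-cong D-1 (trans (D-* x (y ^ n)) (*-congˡ {x = D x} (D-^ y n))))))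

  D-E-lim : Lim (poch (- (q ^ suc d)) (q ^ suc d)) (D E)
  D-E-lim n m m<n = ≡.trans (≡.sym (trans (D-poch (- q) q n) (poch-cong n (trans (D-neg q) (-‿cong D-q)) D-q) m))
    (D-cong[] (E-lim n) m (ℕₚ.<-≤-trans m<n (ℕₚ.m≤m*n n (suc d))))

dil-dil : ∀ c d f → dil (suc c) (dil (suc d) f) ≈ dil (suc d ℕ.* suc c) f
-- The last argument is chosen so that its successor computes to `suc d * suc c`, the exponent of
-- the composite dilation.
dil-dil c d = fixpoint (λ f → dil (suc c) (dil (suc d) f)) (dil (suc d ℕ.* suc c)) tailP (λ f → constP (f 0)) (c ℕ.+ d ℕ.* suc c)
  (λ f → trans (C.D-cong (B.D-decompose f)) (trans (C.D-+ (constP (f 0)) _) (+-cong (C.D-ι (f 0))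
    (trans (C.D-* (q ^ suc d) (B.D (tailP f))) (*-congʳ {x = C.D (B.D (tailP f))} q^)))))
  (Dilation.D-decompose (c ℕ.+ d ℕ.* suc c))
  where
  module C = Dilation c
  module B = Dilation d
  q^ : C.D (q ^ suc d) ≈ q ^ (suc d ℕ.* suc c)
  q^ = trans (C.D-^ q (suc d)) (trans (^-congˡ (suc d) C.D-q) (trans (^-assocʳ q (suc c) (suc d)) (^-≡ q (ℕₚ.*-comm (suc c) (suc d)))))

-- The section of residue class c modulo 3. On power series U is `V 0`; after a factor q^(-2) it
-- becomes `V 2`.
V : ℕ → PS → PS
V c f n = f (n ℕ.* 3 ℕ.+ c)

D : PS → PS
D = dil 3

module D = Dilation 2

V-q³* : ∀ c f → c < 3 → V c (q ^ 3 * f) ≈ q * V c f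
V-q³* c f c<3 zero    = ≡.trans (q^*-< 3 f c c<3) (≡.sym (·-at0 q (V c f)))
V-q³* c f c<3 (suc n) = ≡.trans (q^*-+ 3 f (n ℕ.* 3 ℕ.+ c)) (≡.sym (q·-suc (V c f) n))

V-+ : ∀ c f g → V c (f + g) ≈ V c f + V c g
V-+ c f g n = ≡.trans (⊕-at f g (n ℕ.* 3 ℕ.+ c)) (≡.sym (⊕-at (V c f) (V c g) n))

V-cong : ∀ c {f g} → f ≈ g → V c f ≈ V c g
V-cong c p n = p (n ℕ.* 3 ℕ.+ c)

V-scale : ∀ c k f → V c (ι k * f) ≈ ι k * V c f
V-scale c k f n = ≡.trans (constP-· k f _) (≡.sym (constP-· k (V c f) n))

-- The factor q³ in the recursion of `D f` leaves `V c` as q, which is the recursion of `f` itself.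
-- The bound c < 3 ensures that a multiple of q³ has no coefficient at q^c.
V-D* : ∀ c f g → c < 3 → V c (D f * g) ≈ f * V c g
V-D* c f g c<3 = fixpoint (λ f → V c (D f * g)) (λ f → f * V c g) tailP (λ f → constP (f 0) * V c g) 0
  (λ f → trans (V-cong c (trans (*-congʳ {x = g} (D.D-decompose f)) (distribʳ g _ _)))
    (trans (V-+ c (constP (f 0) * g) (q ^ 3 * D (tailP f) * g)) (+-cong (V-scale c (f 0) g)
      (trans (V-cong c (*-assoc (q ^ 3) (D (tailP f)) g))
      (trans (V-q³* c (D (tailP f) * g) c<3) (*-congʳ {x = V c (D (tailP f) * g)} (sym (*-identityʳ q))))))))
  (λ f → trans (*-congʳ {x = V c g} (decompose f)) (trans (distribʳ (V c g) _ _) (+-congˡ {x = constP (f 0) * V c g}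
    (trans (*-assoc q (tailP f) (V c g)) (*-congʳ {x = tailP f * V c g} (sym (*-identityʳ q)))))))
  f

-- Theta functions as eta quotients

Lim-quotient : ∀ {s t f g i} → Lim (λ n → s n * t n) f → Lim t g → g * i ≈ 1# → Lim s (f * i)
Lim-quotient {s} {t} {f} {g} {i} st t→g gi n = begin
  s n               ≈⟨ weaken (sym (*-identityʳ (s n))) ⟩
  s n * 1#          ≈⟨ M.*-congˡ (weaken (sym gi)) ⟩
  s n * (g * i)     ≈⟨ M.*-congˡ (M.*-congʳ (M.sym (t→g n))) ⟩
  s n * (t n * i)   ≈⟨ weaken (sym (*-assoc (s n) (t n) i)) ⟩
  s n * t n * i     ≈⟨ M.*-congʳ (st n) ⟩
  f * i             ∎
  where
  module M = Mod n
  open M.≈-Reasoning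

∑-cong[] : ∀ {N} n {f g : ℕ → PS} → (∀ k → k < n → f k ≡[ N ] g k) → ∑ n f ≡[ N ] ∑ n g
∑-cong[] {N} zero    h = Mod.refl N
∑-cong[] {N} (suc n) h = Mod.+-cong N (∑-cong[] n (λ k l → h k (ℕₚ.m≤n⇒m≤1+n l))) (h n ℕₚ.≤-refl)

diff-ord : ∀ {N f g} → f ≡[ N ] g → (f - g) ≡[ N ] 0P
diff-ord {N} {f} {g} p = M.trans (M.+-congʳ p) (M.-‿inverseʳ g)
  where module M = Mod N

ord-diff : ∀ {N} f g → (f - g) ≡[ N ] 0P → f ≡[ N ] g
ord-diff {N} f g p = M.trans (weaken (solve 2 (λ f g → f := f :- g :+ g) refl f g))
  (M.trans (M.+-congʳ p) (M.+-identityˡ g))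
  where module M = Mod N

ord-^ : ∀ {Q} → Q ≡[ 1 ] 0P → ∀ k → (Q ^ k) ≡[ k ] 0P
ord-^ p zero    n ()
ord-^ p (suc k) = ord-* p (ord-^ p k)

triPow-ord : ∀ {Q} → Q ≡[ 1 ] 0P → ∀ k → triPow Q k ≡[ k ] 0P
triPow-ord p zero    n ()
triPow-ord p (suc k) = ≡[]-≤ (ℕₚ.m≤n+m (suc k) k) (ord-* (triPow-ord p k) (ord-^ p (suc k)))

module _ (a b Q eQ iQ : PS) (ab≈Q : a * b ≈ Q) (Q-ord : Q ≡[ 1 ] 0P)
  (Q-lim : Lim (poch (- Q) Q) eQ) (eQ*iQ : eQ * iQ ≈ 1#) where

  open TripleProduct a b Q ab≈Q

  -- By `c-closed` the binomial is a quotient of three finite products. Each agrees with (Q;Q)_∞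
  -- modulo q^l, since l is the smallest of their lengths.
  c-lim : ∀ k l → (c (k ℕ.+ l) k * eQ) ≡[ l ] 1#
  c-lim k l = begin
    x * eQ                   ≈⟨ weaken (sym (trans (*-congˡ eQ*iQ) (*-identityʳ _))) ⟩
    x * eQ * (eQ * iQ)       ≈⟨ weaken (solve 3 (λ x e i → x :* e :* (e :* i) := x :* (e :* e) :* i) refl x eQ iQ) ⟩
    x * (eQ * eQ) * iQ       ≈⟨ M.*-congʳ (M.*-congˡ (M.*-cong (M.sym (Q-lim l)) (M.sym (≡[]-≤ l≤n+k (Q-lim (n ℕ.+ k)))))) ⟩
    x * (P l * P (n ℕ.+ k)) * iQ ≈⟨ M.*-congʳ (weaken (c-closed n k l ≡.refl)) ⟩
    P (n ℕ.+ n) * iQ         ≈⟨ M.*-congʳ (≡[]-≤ l≤n+n (Q-lim (n ℕ.+ n))) ⟩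
    eQ * iQ                  ≈⟨ weaken eQ*iQ ⟩
    1#                       ∎
    where
    module M = Mod l
    open M.≈-Reasoning
    n = k ℕ.+ l
    x = c n k
    l≤n+k : l ≤ n ℕ.+ k
    l≤n+k = ℕₚ.≤-trans (ℕₚ.m≤n+m l k) (ℕₚ.m≤m+n n k)
    l≤n+n : l ≤ n ℕ.+ n
    l≤n+n = ℕₚ.≤-trans (ℕₚ.m≤n+m l k) (ℕₚ.m≤m+n n n)

  -- The k-th coefficient is known only to precision n - k, but its weight `W k` has order at least
  -- k, so every term is right modulo q^n.
  factors-theta : ∀ n → (factors (suc n) * eQ) ≡[ n ] theta a b Q (suc n)
  factors-theta n = begin
    factors N * eQ
      ≈⟨ weaken (*-congʳ (finite N N ℕₚ.≤-refl)) ⟩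
    (c N 0 + ∑ N (term N)) * eQ
      ≈⟨ weaken (trans (distribʳ eQ (c N 0) (∑ N (term N))) (+-congˡ (∑-* N (term N) eQ))) ⟩
    c N 0 * eQ + ∑ N (λ k → term N k * eQ)
      ≈⟨ M.+-cong (≡[]-≤ (ℕₚ.n≤1+n n) (c-lim 0 N)) (∑-cong[] N each) ⟩
    theta a b Q N ∎
    where
    N = suc n
    module M = Mod n
    open M.≈-Reasoning
    each : ∀ k → k < N → (term N k * eQ) ≡[ n ] (W k * s (suc k))
    each k (s≤s k≤n) = ord-diff (term N k * eQ) (W k * s (suc k)) (M.trans
      (weaken (solve 4 (λ c w s e → c :* (w :* s) :* e :- w :* s := w :* (c :* e :- :1) :* s) refl (c N (suc k)) (W k) (s (suc k)) eQ))
      (M.trans (M.*-congʳ (subst (λ m → (W k * (c N (suc k) * eQ - 1#)) ≡[ m ] 0P) k+l≡n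
          (ord-* (triPow-ord Q-ord k) (diff-ord lim)))) (M.zeroˡ _)))
      where
      l = n ℕ.∸ k
      k+l≡n : k ℕ.+ l ≡ n
      k+l≡n = ℕₚ.m+[n∸m]≡n k≤n
      lim : (c N (suc k) * eQ) ≡[ l ] 1#
      lim = subst (λ m → (c (suc m) (suc k) * eQ) ≡[ l ] 1#) k+l≡n (c-lim (suc k) l)

  theta-lim : ∀ {f} → Lim (λ n → factors (suc n)) f → Lim (λ n → theta a b Q (suc n)) (f * eQ)
  theta-lim p n = Mod.trans n (Mod.sym n (factors-theta n)) (Mod.*-congʳ n (p n))

-- e = ∏_{k≥1} (1 - z^k)
Eta : PS → PS → Set
Eta z e = Lim (poch (- z) z) e

Eta-cong : ∀ {y z e} → y ≈ z → Eta y e → Eta z e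
Eta-cong p = Lim-≈ (λ n → poch-cong n (-‿cong p) p)

double : ∀ n → n ≤ n ℕ.* 2
double n = ℕₚ.m≤m*n n 2

triple : ∀ n → n ≤ n ℕ.* 3
triple n = ℕₚ.m≤m*n n 3

-- Euler's splitting of E(z) into odd and even factors: (z;z²)_∞ = E(z)/E(z²).
odd-lim : ∀ {z e₁ e₂ i₂} → Eta z e₁ → Eta (z ^ 2) e₂ → e₂ * i₂ ≈ 1# → Lim (poch (- z) (z ^ 2)) (e₁ * i₂)
odd-lim {z} η₁ η₂ u = Lim-quotient
  (Lim-≈ (λ n → trans (poch-split2 (- z) z n) (*-cong (poch-cong n refl z²) (poch-cong n -z² z²)))
    (Lim-sub (ℕ._* 2) double η₁)) η₂ u
  where
  z² : z * z ≈ z ^ 2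
  z² = *-congˡ (sym (*-identityʳ z))
  -z² : - z * z ≈ - (z ^ 2)
  -z² = solve 1 (λ z → :- z :* z := :- (z :^ 2)) refl z

-- From (1 + z^k)(1 - z^k) = 1 - z^(2k), that is, (-z;z)_∞ = E(z²)/E(z).
plus-lim : ∀ {z e₁ e₂ i₁} → Eta z e₁ → Eta (z ^ 2) e₂ → e₁ * i₁ ≈ 1# → Lim (poch z z) (e₂ * i₁)
plus-lim {z} η₁ η₂ u = Lim-quotient
  (Lim-≈ (λ n → sym (trans (poch-conjugate z z n) (poch-cong n (-‿cong z²) z²))) η₂) η₁ u
  where
  z² : z * z ≈ z ^ 2
  z² = *-congˡ (sym (*-identityʳ z))

-- φ(-z) = E(z)² / E(z²)
phi-lim : ∀ {z e₁ e₂ i₂} → z ≡[ 1 ] 0P → Eta z e₁ → Eta (z ^ 2) e₂ → e₂ * i₂ ≈ 1# →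
  Lim (λ n → theta (- z) (- z) (z ^ 2) (suc n)) (e₁ * i₂ * (e₁ * i₂) * e₂)
phi-lim {z} {e₁} {e₂} {i₂} z-ord η₁ η₂ u =
  theta-lim (- z) (- z) (z ^ 2) e₂ i₂ (solve 1 (λ z → :- z :* :- z := z :^ 2) refl z)
    (≡[]-≤ (s≤s z≤n) (ord-^ z-ord 2)) η₂ u (Lim-sub suc ℕₚ.n≤1+n (Lim-* odd odd))
  where
  odd = odd-lim {e₁ = e₁} η₁ η₂ u

-- f(-z,-z⁵) = E(z) E(z⁶)² / (E(z²) E(z³))
omega-lim : ∀ {z e₁ e₂ e₃ e₆ i₂ i₃ i₆} → z ≡[ 1 ] 0P →
  Eta z e₁ → Eta (z ^ 2) e₂ → Eta (z ^ 3) e₃ → Eta (z ^ 6) e₆ →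
  e₂ * i₂ ≈ 1# → e₃ * i₃ ≈ 1# → e₆ * i₆ ≈ 1# →
  Lim (λ n → theta (- z) (- (z ^ 5)) (z ^ 6) (suc n)) (e₁ * i₂ * (i₃ * e₆) * e₆)
omega-lim {z} {e₁} {e₂} {e₃} {e₆} {i₂} {i₃} {i₆} z-ord η₁ η₂ η₃ η₆ u₂ u₃ u₆ =
  theta-lim (- z) (- (z ^ 5)) (z ^ 6) e₆ i₆ (solve 1 (λ z → :- z :* :- (z :^ 5) := z :^ 6) refl z)
    (≡[]-≤ (s≤s z≤n) (ord-^ z-ord 6)) η₆ u₆ (Lim-sub suc ℕₚ.n≤1+n
      -- (z;z²) splits into (z;z⁶)(z³;z⁶)(z⁵;z⁶); dividing by the middle factor E(z³)/E(z⁶) leaves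
      -- the two factors of the triple product.
      (Lim-quotient {t = poch (- (z ^ 3)) (z ^ 6)} {g = e₃ * i₆} product
        (Lim-≈ (λ n → poch-cong n refl (^-assocʳ z 3 2))
          (odd-lim {e₁ = e₃} η₃ (Eta-cong (sym (^-assocʳ z 3 2)) η₆) u₆)) unit))
  where
  unit : e₃ * i₆ * (i₃ * e₆) ≈ 1#
  unit = trans (solve 4 (λ a b c d → a :* b :* (c :* d) := a :* c :* (d :* b)) refl e₃ i₆ i₃ e₆)
    (trans (*-cong u₃ u₆) (*-identityʳ 1#))
  split : ∀ n → poch (- z) (z ^ 2) (n ℕ.* 3) ≈
    poch (- z) (z ^ 6) n * poch (- (z ^ 5)) (z ^ 6) n * poch (- (z ^ 3)) (z ^ 6) n
  split n = trans (poch-split3 (- z) (z ^ 2) n) (trans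
    (*-cong (*-cong (poch-cong n refl z⁶) (poch-cong n (solve 1 (λ z → :- z :* z :^ 2 := :- (z :^ 3)) refl z) z⁶))
            (poch-cong n (solve 1 (λ z → :- z :* (z :^ 2 :* z :^ 2) := :- (z :^ 5)) refl z) z⁶))
    (solve 3 (λ a b c → a :* b :* c := a :* c :* b) refl _ _ _))
    where
    z⁶ : z ^ 2 * (z ^ 2 * z ^ 2) ≈ z ^ 6
    z⁶ = solve 1 (λ z → z :^ 2 :* (z :^ 2 :* z :^ 2) := z :^ 6) refl z
  product : Lim (λ n → poch (- z) (z ^ 6) n * poch (- (z ^ 5)) (z ^ 6) n * poch (- (z ^ 3)) (z ^ 6) n) (e₁ * i₂)
  product = Lim-≈ split (Lim-sub (ℕ._* 3) triple (odd-lim {e₁ = e₁} η₁ η₂ u₂))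

-- f(z,z²) = E(z²) E(z³)² / (E(z) E(z⁶))
a-lim : ∀ {z e₁ e₂ e₃ e₆ i₁ i₃ i₆} → z ≡[ 1 ] 0P →
  Eta z e₁ → Eta (z ^ 2) e₂ → Eta (z ^ 3) e₃ → Eta (z ^ 6) e₆ →
  e₁ * i₁ ≈ 1# → e₃ * i₃ ≈ 1# → e₆ * i₆ ≈ 1# →
  Lim (λ n → theta z (z ^ 2) (z ^ 3) (suc n)) (e₂ * i₁ * (i₆ * e₃) * e₃)
a-lim {z} {e₁} {e₂} {e₃} {e₆} {i₁} {i₃} {i₆} z-ord η₁ η₂ η₃ η₆ u₁ u₃ u₆ =
  theta-lim z (z ^ 2) (z ^ 3) e₃ i₃ refl
    (≡[]-≤ (s≤s z≤n) (ord-^ z-ord 3)) η₃ u₃ (Lim-sub suc ℕₚ.n≤1+n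
      -- (-z;z) splits into (-z;z³)(-z²;z³)(-z³;z³), and the last factor, E(z⁶)/E(z³), is divided
      -- out.
      (Lim-quotient {t = poch (z ^ 3) (z ^ 3)} {g = e₆ * i₃} product
        (plus-lim {e₁ = e₃} η₃ (Eta-cong (sym (^-assocʳ z 3 2)) η₆) u₃) unit))
  where
  unit : e₆ * i₃ * (i₆ * e₃) ≈ 1#
  unit = trans (solve 4 (λ a b c d → a :* b :* (c :* d) := a :* c :* (d :* b)) refl e₆ i₃ i₆ e₃)
    (trans (*-cong u₆ u₃) (*-identityʳ 1#))
  split : ∀ n → poch z z (n ℕ.* 3) ≈ poch z (z ^ 3) n * poch (z ^ 2) (z ^ 3) n * poch (z ^ 3) (z ^ 3) n
  split n = trans (poch-split3 z z n) (*-cong (*-cong (poch-cong n refl z³) (poch-cong n z² z³)) (poch-cong n z³ z³))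
    where
    z² : z * z ≈ z ^ 2
    z² = *-congˡ (sym (*-identityʳ z))
    z³ : z * (z * z) ≈ z ^ 3
    z³ = *-congˡ z²
  product : Lim (λ n → poch z (z ^ 3) n * poch (z ^ 2) (z ^ 3) n * poch (z ^ 3) (z ^ 3) n) (e₂ * i₁)
  product = Lim-≈ split (Lim-sub (ℕ._* 3) triple (plus-lim {e₁ = e₁} η₁ η₂ u₁))

-- ψ(z) = E(z²)² / E(z)
psi-lim : ∀ {z e₁ e₂ i₁} → z ≡[ 1 ] 0P → Eta z e₁ → Eta (z ^ 2) e₂ → e₁ * i₁ ≈ 1# →
  Lim (λ n → ∑ (suc n) (triPow z)) (e₂ * i₁ * (e₂ * i₁) * e₁)
-- The triple product with a = 1, b = z evaluates f(1,z) = 2ψ(z). Its side of products carries the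
-- same 2 as the leading factor of (-1;z), and the 2 is cancelled in each coefficient.
psi-lim {z} {e₁} {e₂} {i₁} z-ord η₁ η₂ u n k k<n = ℤₚ.*-cancelˡ-≡ (+ 2) _ _
  (≡.trans (≡.sym (constP-· (+ 2) _ k)) (≡.trans (doubled n k k<n) (constP-· (+ 2) _ k)))
  where
  N = e₂ * i₁
  N-lim : Lim (poch z z) N
  N-lim = plus-lim {e₁ = e₁} η₁ η₂ u
  factors-lim : Lim (λ n → poch 1# z (suc n) * poch z z (suc n)) ((1# + 1#) * N * N)
  factors-lim = Lim-* {s = λ n → poch 1# z (suc n)}
    (Lim-≈ (λ n → sym (trans (poch-head 1# z n) (*-congˡ (poch-cong n (*-identityˡ z) refl))))
      (Lim-* (Lim-const (1# + 1#)) N-lim))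
    (Lim-sub suc ℕₚ.n≤1+n N-lim)
  θ-lim : Lim (λ n → theta 1# z z (suc n)) ((1# + 1#) * N * N * e₁)
  θ-lim = theta-lim 1# z z e₁ i₁ (*-identityˡ z) z-ord η₁ u factors-lim
  doubled : Lim (λ n → ι (+ 2) * ∑ (suc n) (triPow z)) (ι (+ 2) * (N * N * e₁))
  doubled n = begin
    ι (+ 2) * ∑ (suc n) (triPow z)
      ≈⟨ weaken (solve 1 (λ s → con (+ 2) :* s := s :+ s) refl (∑ (suc n) (triPow z))) ⟩
    ∑ (suc n) (triPow z) + ∑ (suc n) (triPow z)
      ≈⟨ M.+-congˡ (M.trans (M.sym (M.+-identityʳ _)) (M.+-congˡ (M.sym (≡[]-≤ (ℕₚ.n≤1+n n) (triPow-ord z-ord (suc n)))))) ⟩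
    ∑ (suc n) (triPow z) + ∑ (suc (suc n)) (triPow z)
      ≈⟨ weaken (sym (theta-1-z z (suc n))) ⟩
    theta 1# z z (suc n)
      ≈⟨ θ-lim n ⟩
    (1# + 1#) * N * N * e₁
      ≈⟨ weaken (solve 2 (λ N e → (:1 :+ :1) :* N :* N :* e := con (+ 2) :* (N :* N :* e)) refl N e₁) ⟩
    ι (+ 2) * (N * N * e₁) ∎
    where
    module M = Mod n
    open M.≈-Reasoning

module _ {e₁ e₂ e₃ e₆ e₉ e₁₈ i₁ i₂ i₃ i₆ i₉ i₁₈ : PS}
  (η₁ : Eta q e₁) (η₂ : Eta (q ^ 2) e₂) (η₃ : Eta (q ^ 3) e₃)
  (η₆ : Eta (q ^ 6) e₆) (η₉ : Eta (q ^ 9) e₉) (η₁₈ : Eta (q ^ 18) e₁₈)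
  (u₁ : e₁ * i₁ ≈ 1#) (u₂ : e₂ * i₂ ≈ 1#) (u₃ : e₃ * i₃ ≈ 1#)
  (u₆ : e₆ * i₆ ≈ 1#) (u₉ : e₉ * i₉ ≈ 1#) (u₁₈ : e₁₈ * i₁₈ ≈ 1#) where

  private
    q-ord : q ≡[ 1 ] 0P
    q-ord zero    _ = ≡.refl
    q-ord (suc n) (s≤s ())
    q³-ord : (q ^ 3) ≡[ 1 ] 0P
    q³-ord = ≡[]-≤ (s≤s z≤n) (ord-^ q-ord 3)
    q⁹-ord : (q ^ 9) ≡[ 1 ] 0P
    q⁹-ord = ≡[]-≤ (s≤s z≤n) (ord-^ q-ord 9)

  -- φ(-q) = φ(-q⁹) - 2q f(-q³,-q¹⁵) in product form: the limit of `theta-dissect` at w = -q.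
  phi-dissect : e₁ * i₂ * (e₁ * i₂) * e₂ ≈
    e₉ * i₁₈ * (e₉ * i₁₈) * e₁₈ + (- q + - q) * (e₃ * i₆ * (i₉ * e₁₈) * e₁₈)
  phi-dissect = Lim-unique
    (Lim-sub (λ n → suc n ℕ.* 3) (λ n → ℕₚ.≤-trans (ℕₚ.n≤1+n n) (triple (suc n))) (phi-lim {e₁ = e₁} q-ord η₁ η₂ u₂))
    (Lim-≈ (λ n → sym (trans (theta-cong (suc (suc n ℕ.* 3)) refl refl [-q]²) (trans (theta-dissect (- q) (suc n))
        (+-cong (theta-cong (suc n) -q⁹ -q⁹ -q¹⁸) (*-congˡ (theta-cong (suc n) -q³ -q¹⁵ -q¹⁸′))))))
      (Lim-+ (phi-lim {e₁ = e₉} q⁹-ord η₉ (Eta-cong (sym (^-assocʳ q 9 2)) η₁₈) u₁₈)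
        (Lim-* (Lim-const (- q + - q)) (omega-lim {e₁ = e₃} {e₂ = e₆} {e₃ = e₉} {e₆ = e₁₈} q³-ord η₃ (Eta-cong (sym (^-assocʳ q 3 2)) η₆)
          (Eta-cong (sym (^-assocʳ q 3 3)) η₉) (Eta-cong (sym (^-assocʳ q 3 6)) η₁₈) u₆ u₉ u₁₈))))
    where
    [-q]² : q ^ 2 ≈ (- q) ^ 2
    [-q]² = solve 1 (λ x → x :^ 2 := (:- x) :^ 2) refl q
    -q⁹ : (- q) ^ 9 ≈ - (q ^ 9)
    -q⁹ = solve 1 (λ x → (:- x) :^ 9 := :- (x :^ 9)) refl q
    -q³ : (- q) ^ 3 ≈ - (q ^ 3)
    -q³ = solve 1 (λ x → (:- x) :^ 3 := :- (x :^ 3)) refl q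
    -q¹⁵ : (- q) ^ 15 ≈ - ((q ^ 3) ^ 5)
    -q¹⁵ = solve 1 (λ x → (:- x) :^ 15 := :- ((x :^ 3) :^ 5)) refl q
    -q¹⁸ : (- q) ^ 18 ≈ (q ^ 9) ^ 2
    -q¹⁸ = solve 1 (λ x → (:- x) :^ 18 := (x :^ 9) :^ 2) refl q
    -q¹⁸′ : (- q) ^ 18 ≈ (q ^ 3) ^ 6
    -q¹⁸′ = solve 1 (λ x → (:- x) :^ 18 := (x :^ 3) :^ 6) refl q

  -- ψ(q) = f(q³,q⁶) + qψ(q⁹) in product form: the limit of `triangular-dissect` at z = q.
  psi-dissect : e₂ * i₁ * (e₂ * i₁) * e₁ ≈
    e₆ * i₃ * (i₁₈ * e₉) * e₉ + q * (e₁₈ * i₉ * (e₁₈ * i₉) * e₉)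
  psi-dissect = Lim-unique
    (Lim-sub (λ n → suc n ℕ.* 3) (λ n → ℕₚ.≤-trans (ℕₚ.n≤1+n n) (triple (suc n))) (psi-lim {e₁ = e₁} q-ord η₁ η₂ u₁))
    (Lim-≈ (λ n → sym (trans (triangular-dissect q (suc n)) (+-congʳ (theta-cong (suc n) refl (sym (^-assocʳ q 3 2)) (sym (^-assocʳ q 3 3))))))
      (Lim-+ (a-lim {e₁ = e₃} {e₂ = e₆} {e₃ = e₉} {e₆ = e₁₈} q³-ord η₃ (Eta-cong (sym (^-assocʳ q 3 2)) η₆)
          (Eta-cong (sym (^-assocʳ q 3 3)) η₉) (Eta-cong (sym (^-assocʳ q 3 6)) η₁₈) u₃ u₉ u₁₈)
        (Lim-* (Lim-const q) (psi-lim {e₁ = e₉} q⁹-ord η₉ (Eta-cong (sym (^-assocʳ q 9 2)) η₁₈) u₉))))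

open ≈-Reasoning

-- The level 6 identities

module A = Algebraic psRing constP-morphism
module AMod (N : ℕ) = Algebraic (psRingMod N) (constP-morphismMod N)
open A using (horner)

units : Vec A.Unit 6
units = unit E ≡.refl ∷ unit (dil 2 E) ≡.refl ∷ unit (dil 3 E) ≡.refl
  ∷ unit (dil 6 E) ≡.refl ∷ unit (dil 9 E) ≡.refl ∷ unit (dil 18 E) ≡.refl ∷ []
  where
  unit : ∀ f → f 0 ≡ + 1 → A.Unit
  unit f f0 = record { el = f ; el⁻¹ = inv f ; inverse = ·-inv f f0 }

unitsMod : ∀ N → Vec (AMod.Unit N) 6
unitsMod N = Vec.map (λ x → record { el = A.Unit.el x ; el⁻¹ = A.Unit.el⁻¹ x ; inverse = weaken (A.Unit.inverse x) }) units

module L = A.Level18 q units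
open L using (eval; mono; X₁; X₃; v; h)
module LMod (N : ℕ) = AMod.Level18 N q (unitsMod N)

open Generators

inverses : ∀ j → A.Unit.el (lookup units j) * A.Unit.el⁻¹ (lookup units j) ≈ 1#
inverses j = A.Unit.inverse (lookup units j)

E₁ : Eta q E
E₁ = E-lim

E′ : ∀ d → Eta (q ^ suc d) (dil (suc d) E)
E′ d = Dilation.D-E-lim d

U≈ : eval L.Um ≈ L.u
U≈ = begin
  eval L.Um
    ≈⟨ mono L.Um (e₁ ⊗ i₂ ⊗ (e₁ ⊗ i₂) ⊗ e₂ ⊗ (e₁₈ ⊗ i₉ ↑ 2)) ≡.refl ⟩
  eval (e₁ ⊗ i₂ ⊗ (e₁ ⊗ i₂) ⊗ e₂) * k
    ≈⟨ *-congʳ (phi-dissect {i₁ = inv E} {i₃ = inv (dil 3 E)} E₁ (E′ 1) (E′ 2) (E′ 5) (E′ 8) (E′ 17)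
         (inverses 0F) (inverses 1F) (inverses 2F) (inverses 3F) (inverses 4F) (inverses 5F)) ⟩
  (eval P + (- q + - q) * eval O) * k
    ≈⟨ solve 4 (λ q p o k → (p :+ (:- q :+ :- q) :* o) :* k := p :* k :- (q :* (o :* k) :+ q :* (o :* k))) refl q (eval P) (eval O) k ⟩
  eval P * k - (q * (eval O * k) + q * (eval O * k))
    ≈⟨ +-cong (mono (P ⊗ (e₁₈ ⊗ i₉ ↑ 2)) (e₁ ↑ 0) ≡.refl) (-‿cong (+-cong (*-congˡ ok) (*-congˡ ok))) ⟩
  L.u ∎
  where
  P = e₉ ⊗ i₁₈ ⊗ (e₉ ⊗ i₁₈) ⊗ e₁₈
  O = e₃ ⊗ i₆ ⊗ (i₉ ⊗ e₁₈) ⊗ e₁₈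
  k = eval (e₁₈ ⊗ i₉ ↑ 2)
  ok : eval O * k ≈ eval L.gm
  ok = mono (O ⊗ (e₁₈ ⊗ i₉ ↑ 2)) L.gm ≡.refl

W≈ : eval L.Wm ≈ L.w
W≈ = begin
  eval L.Wm
    ≈⟨ mono L.Wm (e₂ ⊗ i₁ ⊗ (e₂ ⊗ i₁) ⊗ e₁ ⊗ K) ≡.refl ⟩
  eval (e₂ ⊗ i₁ ⊗ (e₂ ⊗ i₁) ⊗ e₁) * eval K
    ≈⟨ *-congʳ (psi-dissect {i₂ = inv (dil 2 E)} {i₆ = inv (dil 6 E)} E₁ (E′ 1) (E′ 2) (E′ 5) (E′ 8) (E′ 17)
         (inverses 0F) (inverses 1F) (inverses 2F) (inverses 3F) (inverses 4F) (inverses 5F)) ⟩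
  (eval P + q * eval O) * eval K
    ≈⟨ solve 4 (λ q p o k → (p :+ q :* o) :* k := p :* k :+ q :* (o :* k)) refl q (eval P) (eval O) (eval K) ⟩
  eval P * eval K + q * (eval O * eval K)
    ≈⟨ +-cong (mono (P ⊗ K) (e₁ ↑ 0) ≡.refl) (*-congˡ (mono (O ⊗ K) L.gm ≡.refl)) ⟩
  L.w ∎
  where
  P = e₆ ⊗ i₃ ⊗ (i₁₈ ⊗ e₉) ⊗ e₉
  O = e₁₈ ⊗ i₉ ⊗ (e₁₈ ⊗ i₉) ⊗ e₉
  K = i₆ ⊗ i₉ ↑ 2 ⊗ e₃ ⊗ e₁₈

rename : ∀ {m n} → (Fin m → Fin n) → Mono m → Mono n
rename ρ (η j)   = η (ρ j)
rename ρ (η⁻ j)   = η⁻ (ρ j)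
rename ρ (s ⊗ t) = rename ρ s ⊗ rename ρ t
rename ρ (s ↑ k) = rename ρ s ↑ k

-- The generators E(q^d) with d dividing 6, matched with E(q^(3d)); dilation by 3 acts on eta
-- quotients of level 6 by this renaming.
level6 level18 : Fin 4 → Fin 6
level6 0F = 0F
level6 1F = 1F
level6 2F = 2F
level6 3F = 3F
level18 0F = 2F
level18 1F = 3F
level18 2F = 4F
level18 3F = 5F

D-inverse : ∀ {f g f⁻¹ g⁻¹} → f * f⁻¹ ≈ 1# → g * g⁻¹ ≈ 1# → D f ≈ g → D f⁻¹ ≈ g⁻¹
D-inverse {f} {g} {f⁻¹} {g⁻¹} ff gg Df = begin
  D f⁻¹               ≈⟨ sym (*-identityʳ _) ⟩
  D f⁻¹ * 1#          ≈⟨ *-congˡ (sym gg) ⟩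
  D f⁻¹ * (g * g⁻¹)   ≈⟨ *-congˡ (*-congʳ (sym Df)) ⟩
  D f⁻¹ * (D f * g⁻¹) ≈⟨ solve 3 (λ a b c → a :* (b :* c) := b :* a :* c) refl (D f⁻¹) (D f) g⁻¹ ⟩
  D f * D f⁻¹ * g⁻¹   ≈⟨ *-congʳ (trans (sym (D.D-* f f⁻¹)) (trans (D.D-cong ff) D.D-1)) ⟩
  1# * g⁻¹            ≈⟨ *-identityˡ _ ⟩
  g⁻¹ ∎

D-el : ∀ j → D (eval (η (level6 j))) ≈ eval (η (level18 j))
D-el 0F = refl
D-el 1F = dil-dil 2 1 E
D-el 2F = dil-dil 2 2 E
D-el 3F = dil-dil 2 5 E

D-eval : ∀ s → D (eval (rename level6 s)) ≈ eval (rename level18 s)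
D-eval (η j)   = D-el j
D-eval (η⁻ j)   = D-inverse (inverses (level6 j)) (inverses (level18 j)) (D-el j)
D-eval (s ⊗ t) = trans (D.D-* (eval (rename level6 s)) (eval (rename level6 t))) (*-cong (D-eval s) (D-eval t))
D-eval (s ↑ k) = trans (D.D-^ (eval (rename level6 s)) k) (^-congˡ k (D-eval s))

-- The series with v = q·G(q³), so that 1, v and v² lie in the three distinct residue classes of
-- exponents.
G : PS
G = eval (e₁ ⊗ e₆ ↑ 3 ⊗ i₂ ⊗ i₃ ↑ 3)

D-X : D X₁ ≈ X₃
D-X = D-eval (η 1F ↑ 4 ⊗ η 2F ↑ 8 ⊗ η⁻ 0F ↑ 8 ⊗ η⁻ 3F ↑ 4)

D-G : D G ≈ eval L.gm
D-G = D-eval (η 0F ⊗ η 3F ↑ 3 ⊗ η⁻ 1F ⊗ η⁻ 2F ↑ 3)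

D-Φ : D (eval L.Φm) ≈ eval L.Φ′m
D-Φ = D-eval (η 1F ↑ 5 ⊗ η 3F ⊗ η⁻ 0F ⊗ η⁻ 2F ↑ 5)

D-h : D h ≈ v ^ 3
D-h = begin
  D (q * eval L.hm)         ≈⟨ D.D-* q (eval L.hm) ⟩
  D q * D (eval L.hm)       ≈⟨ *-cong D.D-q (D-eval (η 0F ↑ 3 ⊗ η 3F ↑ 9 ⊗ η⁻ 1F ↑ 3 ⊗ η⁻ 2F ↑ 9)) ⟩
  q ^ 3 * eval (e₃ ↑ 3 ⊗ e₁₈ ↑ 9 ⊗ i₆ ↑ 3 ⊗ i₉ ↑ 9)
                            ≈⟨ *-congˡ (mono (e₃ ↑ 3 ⊗ e₁₈ ↑ 9 ⊗ i₆ ↑ 3 ⊗ i₉ ↑ 9) (L.gm ↑ 3) ≡.refl) ⟩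
  q ^ 3 * eval L.gm ^ 3     ≈⟨ sym (^-distrib-* q (eval L.gm) 3) ⟩
  v ^ 3 ∎

XC : PS
XC = X₁ * (1# - ι (+ 8) * h)

Level6 : ℕ → Set
Level6 N = (XC ≡[ N ] 1#) × (eval L.Φm ≡[ N ] (1# + h))

D-XC : D XC ≈ X₃ * L.κ
D-XC = trans (D.D-* X₁ _) (*-cong D-X (trans (D.D-+ 1# (- (ι (+ 8) * h))) (+-cong D.D-1
  (trans (D.D-neg (ι (+ 8) * h)) (-‿cong (trans (D.D-scale (+ 8) h) (*-congˡ D-h)))))))

level6-base : Level6 1
level6-base = M.trans (M.*-cong (one L.Xm) (M.+-congˡ (M.-‿cong (M.trans (M.*-congˡ h≡0) (M.zeroʳ (ι (+ 8)))))))
    (M.trans (M.*-congˡ (M.trans (M.+-congˡ M.-0≈0) (M.+-identityʳ 1#))) (M.*-identityʳ 1#))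
  , M.trans (one L.Φm) (M.sym (M.trans (M.+-congˡ h≡0) (M.+-identityʳ 1#)))
  where
  module M = Mod 1
  at0 : ∀ {f} → f 0 ≡ + 1 → f ≡[ 1 ] 1#
  at0 p zero    _ = p
  at0 p (suc n) (s≤s ())
  one : ∀ s → eval s ≡[ 1 ] 1#
  one (η 0F) = at0 ≡.refl
  one (η 1F) = at0 ≡.refl
  one (η 2F) = at0 ≡.refl
  one (η 3F) = at0 ≡.refl
  one (η 4F) = at0 ≡.refl
  one (η 5F) = at0 ≡.refl
  one (η⁻ 0F) = at0 ≡.refl
  one (η⁻ 1F) = at0 ≡.refl
  one (η⁻ 2F) = at0 ≡.refl
  one (η⁻ 3F) = at0 ≡.refl
  one (η⁻ 4F) = at0 ≡.refl
  one (η⁻ 5F) = at0 ≡.refl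
  one (s ⊗ t) = M.trans (M.*-cong (one s) (one t)) (M.*-identityʳ 1#)
  one (s ↑ zero) = M.refl
  one (s ↑ suc k) = M.trans (M.*-cong (one s) (one (s ↑ k))) (M.*-identityʳ 1#)
  h≡0 : h ≡[ 1 ] 0P
  h≡0 zero    _ = ·-at0 q (eval L.hm)
  h≡0 (suc n) (s≤s ())

-- Dilation turns precision N+1 into 3N+3, at least N+2, and `contract` in the ring modulo q^(N+2)
-- returns from q³ to q. The gain requires a positive starting precision, hence the base case of
-- constant terms.
level6-step : ∀ N → Level6 (suc N) → Level6 (suc (suc N))
level6-step N (XC≡1 , Φ≡) = LM.contract (weaken U≈) (weaken W≈) Yκ Φ′
  where
  module LM = LMod (2 ℕ.+ N)
  module M = Mod (2 ℕ.+ N)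
  2+N≤ : 2 ℕ.+ N ≤ suc N ℕ.* 3
  2+N≤ = s≤s (s≤s (ℕₚ.≤-trans (ℕₚ.m≤m*n N 3) (ℕₚ.n≤1+n (N ℕ.* 3))))
  Yκ : (X₃ * L.κ) ≡[ 2 ℕ.+ N ] 1#
  Yκ = M.trans (weaken (sym D-XC)) (M.trans (≡[]-≤ 2+N≤ (D.D-cong[] XC≡1)) (weaken D.D-1))
  Φ′ : eval L.Φ′m ≡[ 2 ℕ.+ N ] (1# + v ^ 3)
  Φ′ = M.trans (weaken (sym D-Φ)) (M.trans (≡[]-≤ 2+N≤ (D.D-cong[] Φ≡))
    (weaken (trans (D.D-+ 1# h) (+-cong D.D-1 D-h))))

level6-all : ∀ N → Level6 (suc N)
level6-all zero    = level6-base
level6-all (suc N) = level6-step N (level6-all N)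

Yκ : X₃ * L.κ ≈ 1#
Yκ = trans (sym D-XC) (trans (D.D-cong (λ n → proj₁ (level6-all n) n ℕₚ.≤-refl)) D.D-1)

-- Action of U on the powers of X

D-horner : ∀ l f → D (horner l f) ≈ horner l (D f)
D-horner []       f = D.D-ι (+ 0)
D-horner (c ∷ cs) f = trans (D.D-+ (ι c) (f * horner cs f)) (+-cong (D.D-ι c)
  (trans (D.D-* f (horner cs f)) (*-congˡ (D-horner cs f))))

horner-cong : ∀ l {f g} → f ≈ g → horner l f ≈ horner l g
horner-cong []       p = refl
horner-cong (c ∷ cs) p = +-congˡ (*-cong p (horner-cong cs p))

V-q^ : ∀ c j r → V c (q ^ j) 0 ≡ r → (∀ n → (3 ℕ.+ n ≡ᵇ j) ≡ false) → V c (q ^ j) ≈ ι r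
V-q^ c j r p _ zero = p
V-q^ c j r _ p (suc n) = ≡.trans (q^-coeff j (3 ℕ.+ (n ℕ.* 3 ℕ.+ c))) (cong (λ b → if b then + 1 else + 0) (p (n ℕ.* 3 ℕ.+ c)))

-- With Y = `D X₁` and v = q·`D G`, the expansion of F has the shape D f₀ + q D f₁ + q² D f₂. The
-- numbers k₀, k₁, k₂ record the sections of 1, q, q².
V-split : ∀ c {F p₀ p₁ p₂} k₀ k₁ k₂ → c < 3 → V c (q ^ 0) ≈ ι k₀ → V c (q ^ 1) ≈ ι k₁ → V c (q ^ 2) ≈ ι k₂ →
  F ≈ horner p₀ X₃ + horner p₁ X₃ * v + horner p₂ X₃ * v ^ 2 →
  V c F ≈ horner p₀ X₁ * ι k₀ + horner p₁ X₁ * G * ι k₁ + horner p₂ X₁ * G ^ 2 * ι k₂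
V-split c {F} {p₀} {p₁} {p₂} k₀ k₁ k₂ c<3 V₀ V₁ V₂ F≈ = begin
  V c F
    ≈⟨ V-cong c F≈D ⟩
  V c (D f₀ * q ^ 0 + D f₁ * q ^ 1 + D f₂ * q ^ 2)
    ≈⟨ trans (V-+ c (D f₀ * q ^ 0 + D f₁ * q ^ 1) _) (+-congʳ (V-+ c (D f₀ * q ^ 0) _)) ⟩
  V c (D f₀ * q ^ 0) + V c (D f₁ * q ^ 1) + V c (D f₂ * q ^ 2)
    ≈⟨ +-cong (+-cong (V-D* c f₀ _ c<3) (V-D* c f₁ _ c<3)) (V-D* c f₂ _ c<3) ⟩
  f₀ * V c (q ^ 0) + f₁ * V c (q ^ 1) + f₂ * V c (q ^ 2)
    ≈⟨ +-cong (+-cong (*-congˡ V₀) (*-congˡ V₁)) (*-congˡ V₂) ⟩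
  f₀ * ι k₀ + f₁ * ι k₁ + f₂ * ι k₂ ∎
  where
  f₀ = horner p₀ X₁
  f₁ = horner p₁ X₁ * G
  f₂ = horner p₂ X₁ * G ^ 2
  D-poly : ∀ l → horner l X₃ ≈ D (horner l X₁)
  D-poly l = trans (horner-cong l (sym D-X)) (sym (D-horner l X₁))
  v≈ : v ≈ q * D G
  v≈ = *-congˡ (sym D-G)
  F≈D : F ≈ D f₀ * q ^ 0 + D f₁ * q ^ 1 + D f₂ * q ^ 2
  F≈D = begin
    F ≈⟨ F≈ ⟩
    horner p₀ X₃ + horner p₁ X₃ * v + horner p₂ X₃ * v ^ 2
      ≈⟨ +-cong (+-cong (D-poly p₀) (*-cong (D-poly p₁) v≈)) (*-cong (D-poly p₂) (^-congˡ 2 v≈)) ⟩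
    D f₀ + D (horner p₁ X₁) * (q * D G) + D (horner p₂ X₁) * (q * D G) ^ 2
      ≈⟨ solve 5 (λ a b c q g → a :+ b :* (q :* g) :+ c :* (q :* g) :^ 2 :=
           a :* q :^ 0 :+ b :* g :* q :^ 1 :+ c :* g :^ 2 :* q :^ 2) refl (D f₀) (D (horner p₁ X₁)) (D (horner p₂ X₁)) q (D G) ⟩
    D f₀ * q ^ 0 + D (horner p₁ X₁) * D G * q ^ 1 + D (horner p₂ X₁) * D G ^ 2 * q ^ 2
      ≈⟨ +-cong (+-congˡ (*-congʳ (sym (D.D-* (horner p₁ X₁) G))))
           (*-congʳ (trans (*-congˡ (sym (D.D-^ G 2))) (sym (D.D-* (horner p₂ X₁) (G ^ 2))))) ⟩
    D f₀ * q ^ 0 + D f₁ * q ^ 1 + D f₂ * q ^ 2 ∎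

V₀-split : ∀ {F p₀ p₁ p₂} → F ≈ horner p₀ X₃ + horner p₁ X₃ * v + horner p₂ X₃ * v ^ 2 → V 0 F ≈ horner p₀ X₁
V₀-split {F} {p₀} {p₁} {p₂} F≈ = trans
  (V-split 0 {F} {p₀} {p₁} {p₂} (+ 1) (+ 0) (+ 0) (s≤s z≤n) (V-q^ 0 0 (+ 1) ≡.refl (λ _ → ≡.refl))
    (V-q^ 0 1 (+ 0) (q^-coeff 1 0) (λ _ → ≡.refl)) (V-q^ 0 2 (+ 0) (q^-coeff 2 0) (λ _ → ≡.refl)) F≈)
  (solve 3 (λ a b c → a :* con (+ 1) :+ b :* con (+ 0) :+ c :* con (+ 0) := a) refl _ _ _)

V₂-split : ∀ {F p₀ p₁ p₂} → F ≈ horner p₀ X₃ + horner p₁ X₃ * v + horner p₂ X₃ * v ^ 2 → V 2 F ≈ horner p₂ X₁ * G ^ 2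
V₂-split {F} {p₀} {p₁} {p₂} F≈ = trans
  (V-split 2 {F} {p₀} {p₁} {p₂} (+ 0) (+ 0) (+ 1) (s≤s (s≤s (s≤s z≤n))) (V-q^ 2 0 (+ 0) ≡.refl (λ _ → ≡.refl))
    (V-q^ 2 1 (+ 0) (q^-coeff 1 2) (λ _ → ≡.refl)) (V-q^ 2 2 (+ 1) (q^-coeff 2 2) (λ _ → ≡.refl)) F≈)
  (solve 3 (λ a b c → a :* con (+ 0) :+ b :* con (+ 0) :+ c :* con (+ 1) := c) refl _ _ _)

C₁ C₂ : PS
C₁ = ι (+ 30) * X₁ - ι (+ 108) * X₁ ^ 2 + ι (+ 81) * X₁ ^ 3
C₂ = ι (+ 9) * X₁ ^ 2 - ι (+ 12) * X₁

modular : X₁ ^ 3 ≈ D C₁ * X₁ ^ 2 + D C₂ * X₁ + D X₁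
modular = trans (L.modular-equation U≈ W≈ Yκ) (sym (+-cong (+-cong
  (*-congʳ (trans (D.D-+ (ι (+ 30) * X₁ - ι (+ 108) * X₁ ^ 2) _) (+-cong (trans (D.D-+ (ι (+ 30) * X₁) _)
     (+-cong (trans (D.D-scale (+ 30) X₁) (*-congˡ D-X)) (trans (D.D-neg (ι (+ 108) * X₁ ^ 2)) (-‿cong (D-monomial (+ 108) 2)))))
     (D-monomial (+ 81) 3))))
  (*-congʳ (trans (D.D-+ (ι (+ 9) * X₁ ^ 2) _) (+-cong (D-monomial (+ 9) 2)
     (trans (D.D-neg (ι (+ 12) * X₁)) (-‿cong (trans (D.D-scale (+ 12) X₁) (*-congˡ D-X))))))))
  D-X))
  where
  D-monomial : ∀ c k → D (ι c * X₁ ^ k) ≈ ι c * X₃ ^ k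
  D-monomial c k = trans (D.D-scale c (X₁ ^ k)) (*-congˡ (trans (D.D-^ X₁ k) (^-congˡ k D-X)))

-- The coefficients of the cubic equation are series in q³, so they pass through `V c` with Y
-- becoming X. The free factor F serves both families: 1 with c = 0, and q²ξ with c = 2.
V-recurrence : ∀ c F i → c < 3 → V c (F * X₁ ^ (3 ℕ.+ i)) ≈
  C₁ * V c (F * X₁ ^ (2 ℕ.+ i)) + C₂ * V c (F * X₁ ^ (1 ℕ.+ i)) + X₁ * V c (F * X₁ ^ i)
V-recurrence c F i c<3 = begin
  V c (F * X₁ ^ (3 ℕ.+ i))
    ≈⟨ V-cong c (begin
      F * X₁ ^ (3 ℕ.+ i)
        ≈⟨ solve 3 (λ f x t → f :* (x :* (x :* (x :* t))) := x :^ 3 :* (f :* t)) refl F X₁ (X₁ ^ i) ⟩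
      X₁ ^ 3 * (F * X₁ ^ i)
        ≈⟨ *-congʳ modular ⟩
      (D C₁ * X₁ ^ 2 + D C₂ * X₁ + D X₁) * (F * X₁ ^ i)
        ≈⟨ solve 6 (λ a b c f x t → (a :* x :^ 2 :+ b :* x :+ c) :* (f :* t) :=
             a :* (f :* (x :* (x :* t))) :+ b :* (f :* (x :* t)) :+ c :* (f :* t)) refl (D C₁) (D C₂) (D X₁) F X₁ (X₁ ^ i) ⟩
      D C₁ * (F * X₁ ^ (2 ℕ.+ i)) + D C₂ * (F * X₁ ^ (1 ℕ.+ i)) + D X₁ * (F * X₁ ^ i) ∎) ⟩
  V c (D C₁ * (F * X₁ ^ (2 ℕ.+ i)) + D C₂ * (F * X₁ ^ (1 ℕ.+ i)) + D X₁ * (F * X₁ ^ i))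
    ≈⟨ trans (V-+ c (D C₁ * (F * X₁ ^ (2 ℕ.+ i)) + D C₂ * (F * X₁ ^ (1 ℕ.+ i))) _) (+-congʳ (V-+ c (D C₁ * (F * X₁ ^ (2 ℕ.+ i))) _)) ⟩
  V c (D C₁ * (F * X₁ ^ (2 ℕ.+ i))) + V c (D C₂ * (F * X₁ ^ (1 ℕ.+ i))) + V c (D X₁ * (F * X₁ ^ i))
    ≈⟨ +-cong (+-cong (V-D* c C₁ _ c<3) (V-D* c C₂ _ c<3)) (V-D* c X₁ _ c<3) ⟩
  C₁ * V c (F * X₁ ^ (2 ℕ.+ i)) + C₂ * V c (F * X₁ ^ (1 ℕ.+ i)) + X₁ * V c (F * X₁ ^ i) ∎

-- Matrix rows as polynomials in X

combine : (ℕ → ℤ) → ℕ → PS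
combine r M = ∑ M (λ k → ι (r (suc k)) * X₁ ^ suc k)

combine-cong : ∀ r s M → (∀ j → r (suc j) ≡ s (suc j)) → combine r M ≈ combine s M
combine-cong r s M p = ∑-cong M (λ k _ → *-congʳ (reflexive (cong ι (p k))))

combine-head : ∀ r M → combine r (suc M) ≈ X₁ * (ι (r 1) + combine (λ j → r (suc j)) M)
combine-head r M = trans (∑-head M _) (trans (+-cong
    (solve 2 (λ c x → c :* (x :* :1) := c :* x) refl (ι (r 1)) X₁)
    (trans (∑-cong M (λ k _ → solve 3 (λ c x t → c :* (x :* (x :* t)) := c :* (x :* t) :* x) refl (ι (r (2 ℕ.+ k))) X₁ (X₁ ^ k)))
           (sym (∑-* M _ X₁))))
  (solve 3 (λ c x s → c :* x :+ s :* x := x :* (c :+ s)) refl (ι (r 1)) X₁ _))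

combine-rowOf-[] : ∀ M → combine (rowOf []) M ≈ 0#
combine-rowOf-[] zero    = refl
combine-rowOf-[] (suc M) = trans (+-cong (combine-rowOf-[] M) (trans (*-congʳ ι-0) (zeroˡ _))) (+-identityʳ 0#)

combine-rowOf : ∀ l k → combine (rowOf l) (length l ℕ.+ k) ≈ X₁ * horner l X₁
combine-rowOf []       k = trans (combine-rowOf-[] k) (sym (trans (*-congˡ ι-0) (zeroʳ X₁)))
combine-rowOf (c ∷ cs) k = trans (combine-head (rowOf (c ∷ cs)) (length cs ℕ.+ k))
  (*-congˡ (+-congˡ (trans (combine-cong (λ j → rowOf (c ∷ cs) (suc j)) (rowOf cs) (length cs ℕ.+ k) (λ j → ≡.refl)) (combine-rowOf cs k))))

-- Shifting a row is multiplication by X^k, provided `r 0` is 0: the shift would move that entry to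
-- position k, whereas `combine` starts at index 1.
combine-sh : ∀ r k M → r 0 ≡ + 0 → combine (sh r k) (k ℕ.+ M) ≈ X₁ ^ k * combine r M
combine-sh r zero    M r0 = sym (*-identityˡ _)
combine-sh r (suc k) M r0 = begin
  combine (sh r (suc k)) (suc k ℕ.+ M)
    ≈⟨ combine-head (sh r (suc k)) (k ℕ.+ M) ⟩
  X₁ * (ι (sh r (suc k) 1) + combine (λ j → sh r (suc k) (suc j)) (k ℕ.+ M))
    ≈⟨ *-congˡ (trans (+-cong (trans (reflexive (cong ι (first k))) ι-0) (combine-cong (λ j → sh r (suc k) (suc j)) (sh r k) (k ℕ.+ M) (rest k)))
         (trans (+-identityˡ _) (combine-sh r k M r0))) ⟩
  X₁ * (X₁ ^ k * combine r M)
    ≈⟨ sym (*-assoc X₁ (X₁ ^ k) _) ⟩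
  X₁ ^ suc k * combine r M ∎
  where
  first : ∀ k → sh r (suc k) 1 ≡ + 0
  first zero    = r0
  first (suc k) = ≡.refl
  rest : ∀ k j → sh r (suc k) (suc (suc j)) ≡ sh r k (suc j)
  rest zero    j = ≡.refl
  rest (suc k) j = ≡.refl

combine-step : ∀ r₁ r₂ r₃ M → combine (step r₁ r₂ r₃) M ≈
  ι (+ 30) * combine (sh r₁ 1) M - ι (+ 108) * combine (sh r₁ 2) M + ι (+ 81) * combine (sh r₁ 3) M
  - ι (+ 12) * combine (sh r₂ 1) M + ι (+ 9) * combine (sh r₂ 2) M + combine (sh r₃ 1) M
combine-step r₁ r₂ r₃ zero    = trans (sym ι-0) (trans
  (solve 0 (con (+ 0) := con (+ 30) :* con (+ 0) :- con (+ 108) :* con (+ 0) :+ con (+ 81) :* con (+ 0)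
     :- con (+ 12) :* con (+ 0) :+ con (+ 9) :* con (+ 0) :+ con (+ 0)) refl)
  (+-cong (+-cong (+-cong (+-cong (+-cong (*-congˡ ι-0) (-‿cong (*-congˡ ι-0))) (*-congˡ ι-0)) (-‿cong (*-congˡ ι-0))) (*-congˡ ι-0)) ι-0))
combine-step r₁ r₂ r₃ (suc M) = trans (+-cong (combine-step r₁ r₂ r₃ M) (*-congʳ expand))
  (solve 13 (λ a b c d e f a′ b′ c′ d′ e′ f′ x →
     let lin = λ a b c d e f → con (+ 30) :* a :- con (+ 108) :* b :+ con (+ 81) :* c :- con (+ 12) :* d :+ con (+ 9) :* e :+ f
     in lin a b c d e f :+ lin a′ b′ c′ d′ e′ f′ :* x :=
        lin (a :+ a′ :* x) (b :+ b′ :* x) (c :+ c′ :* x) (d :+ d′ :* x) (e :+ e′ :* x) (f :+ f′ :* x)) refl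
     (combine (sh r₁ 1) M) (combine (sh r₁ 2) M) (combine (sh r₁ 3) M) (combine (sh r₂ 1) M) (combine (sh r₂ 2) M) (combine (sh r₃ 1) M)
     (ι (sh r₁ 1 j)) (ι (sh r₁ 2 j)) (ι (sh r₁ 3 j)) (ι (sh r₂ 1 j)) (ι (sh r₂ 2 j)) (ι (sh r₃ 1 j)) (X₁ ^ j))
  where
  j = suc M
  ι-− : ∀ x y → ι (x ℤ.- y) ≈ ι x - ι y
  ι-− x y = trans (ι-+ x (neg y)) (+-congˡ (constP-neg y))
  ι-× : ∀ x y → ι (x ℤ.* y) ≈ ι x * ι y
  ι-× = constP-*
  expand : ι (step r₁ r₂ r₃ j) ≈ ι (+ 30) * ι (sh r₁ 1 j) - ι (+ 108) * ι (sh r₁ 2 j) + ι (+ 81) * ι (sh r₁ 3 j)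
    - ι (+ 12) * ι (sh r₂ 1 j) + ι (+ 9) * ι (sh r₂ 2 j) + ι (sh r₃ 1 j)
  expand = trans (ι-+ _ (sh r₃ 1 j)) (+-congʳ (trans (ι-+ _ (+ 9 ℤ.* sh r₂ 2 j)) (+-cong (trans (ι-− _ (+ 12 ℤ.* sh r₂ 1 j))
    (+-cong (trans (ι-+ _ (+ 81 ℤ.* sh r₁ 3 j)) (+-cong (trans (ι-− (+ 30 ℤ.* sh r₁ 1 j) (+ 108 ℤ.* sh r₁ 2 j))
      (+-cong (ι-× (+ 30) _) (-‿cong (ι-× (+ 108) _)))) (ι-× (+ 81) _))) (-‿cong (ι-× (+ 12) _)))) (ι-× (+ 9) _))))

module Rows (l₁ l₂ l₃ : List ℤ) (len₁ : length l₁ ≤ 4) (len₂ : length l₂ ≤ 7) (len₃ : length l₃ ≤ 10)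
  (f : ℕ → PS)
  (f₁ : f 1 ≈ X₁ * horner l₁ X₁) (f₂ : f 2 ≈ X₁ * horner l₂ X₁) (f₃ : f 3 ≈ X₁ * horner l₃ X₁)
  (f-rec : ∀ i → f (3 ℕ.+ i) ≈ C₁ * f (2 ℕ.+ i) + C₂ * f (1 ℕ.+ i) + X₁ * f i) where

  m : ℕ → ℕ → ℤ
  m = mat l₁ l₂ l₃

  m-0 : ∀ i → m i 0 ≡ + 0
  m-0 0 = ≡.refl
  m-0 1 = ≡.refl
  m-0 2 = ≡.refl
  m-0 3 = ≡.refl
  m-0 (suc (suc (suc (suc i)))) = ≡.refl

  base : ∀ l M {f} → length l ≤ M → f ≈ X₁ * horner l X₁ → combine (rowOf l) M ≈ f
  base l M len f≈ = trans (reflexive (cong (combine (rowOf l)) (≡.sym (ℕₚ.m+[n∸m]≡n len))))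
    (trans (combine-rowOf l (M ℕ.∸ length l)) (sym f≈))

  bound : ℕ → ℕ
  bound i = i ℕ.* 3 ℕ.+ 1

  -- The length M is free above the bound because the recurrence uses earlier rows shifted by 1, 2
  -- and 3 places, hence at different lengths. The bound rises by 3 per row, which accommodates all
  -- of them.
  rows : ∀ i M → bound (suc i) ≤ M → combine (m (suc i)) M ≈ f (suc i)
  rows 0 M b = base l₁ M (ℕₚ.≤-trans len₁ b) f₁
  rows 1 M b = base l₂ M (ℕₚ.≤-trans len₂ b) f₂
  rows 2 M b = base l₃ M (ℕₚ.≤-trans len₃ b) f₃
  rows (suc (suc (suc i))) (suc (suc (suc M))) (s≤s (s≤s (s≤s b))) = begin
    combine (step r₁ r₂ r₃) (3 ℕ.+ M)
      ≈⟨ combine-step r₁ r₂ r₃ (3 ℕ.+ M) ⟩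
    _ ≈⟨ +-cong (+-cong (+-cong (+-cong (+-cong
           (*-congˡ (shifted (2 ℕ.+ i) 1 (2 ℕ.+ M) (rows (suc (suc i)) (2 ℕ.+ M) (ℕₚ.m≤n⇒m≤1+n (ℕₚ.m≤n⇒m≤1+n b)))))
           (-‿cong (*-congˡ (shifted (2 ℕ.+ i) 2 (1 ℕ.+ M) (rows (suc (suc i)) (1 ℕ.+ M) (ℕₚ.m≤n⇒m≤1+n b))))))
           (*-congˡ (shifted (2 ℕ.+ i) 3 M (rows (suc (suc i)) M b))))
           (-‿cong (*-congˡ (shifted (1 ℕ.+ i) 1 (2 ℕ.+ M) (rows (suc i) (2 ℕ.+ M) (ℕₚ.m≤n⇒m≤1+n (ℕₚ.m≤n⇒m≤1+n b₂)))))))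
           (*-congˡ (shifted (1 ℕ.+ i) 2 (1 ℕ.+ M) (rows (suc i) (1 ℕ.+ M) (ℕₚ.m≤n⇒m≤1+n b₂)))))
           (shifted i 1 (2 ℕ.+ M) (rows i (2 ℕ.+ M) (ℕₚ.m≤n⇒m≤1+n (ℕₚ.m≤n⇒m≤1+n b₁)))) ⟩
    _ ≈⟨ solve 4 (λ x a b c →
           con (+ 30) :* (x :^ 1 :* a) :- con (+ 108) :* (x :^ 2 :* a) :+ con (+ 81) :* (x :^ 3 :* a)
             :- con (+ 12) :* (x :^ 1 :* b) :+ con (+ 9) :* (x :^ 2 :* b) :+ x :^ 1 :* c
           := (con (+ 30) :* x :- con (+ 108) :* x :^ 2 :+ con (+ 81) :* x :^ 3) :* a
             :+ (con (+ 9) :* x :^ 2 :- con (+ 12) :* x) :* b :+ x :* c) refl X₁ (f (3 ℕ.+ i)) (f (2 ℕ.+ i)) (f (1 ℕ.+ i)) ⟩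
    C₁ * f (3 ℕ.+ i) + C₂ * f (2 ℕ.+ i) + X₁ * f (1 ℕ.+ i)
      ≈⟨ sym (f-rec (suc i)) ⟩
    f (4 ℕ.+ i) ∎
    where
    r₁ = m (3 ℕ.+ i)
    r₂ = m (2 ℕ.+ i)
    r₃ = m (1 ℕ.+ i)
    b₂ : bound (2 ℕ.+ i) ≤ M
    b₂ = ℕₚ.≤-trans (ℕₚ.m≤n+m _ 3) b
    b₁ : bound (1 ℕ.+ i) ≤ M
    b₁ = ℕₚ.≤-trans (ℕₚ.m≤n+m _ 3) b₂
    shifted : ∀ i k M → combine (m (suc i)) M ≈ f (suc i) → combine (sh (m (suc i)) k) (k ℕ.+ M) ≈ X₁ ^ k * f (suc i)
    shifted i k M p = trans (combine-sh (m (suc i)) k M (m-0 (suc i))) (*-congˡ p)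

-- The series of the theorem and the initial rows

^P≈^ : ∀ f k → f ^P k ≈ f ^ k
^P≈^ f zero    = refl
^P≈^ f (suc k) = trans (λ n → cong (λ g → g n) (≡.sym (·-*P f (f ^P k)))) (*-congˡ (^P≈^ f k))

*P≈* : ∀ {f f′ g g′} → f ≈ f′ → g ≈ g′ → (f *P g) ≈ f′ * g′
*P≈* {f} {f′} {g} {g′} p r n = ≡.trans (cong (λ k → k n) (≡.sym (·-*P f g))) (*-cong p r n)

X≈ : X ≈ X₁
X≈ = *P≈* (*P≈* (*P≈* (^P≈^ (dil 2 E) 4) (^P≈^ (dil 3 E) 8)) (^P≈^ (inv E) 8)) (^P≈^ (inv (dil 6 E)) 4)

Z : PS
Z = eval L.Zm

q2ξ≈ : q2ξ ≈ Z
q2ξ≈ = *P≈* (*P≈* (*P≈* (^P≈^ (dil 2 E) 5) (^P≈^ (dil 9 E) 4)) (^P≈^ (inv E) 4)) (^P≈^ (inv (dil 18 E)) 5)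

X^≈ : ∀ i → X ^P i ≈ X₁ ^ i
X^≈ i = trans (^P≈^ X i) (^-congˡ i X≈)

combine-coeff : ∀ r M n → sum1To M (λ j → r j ℤ.* (X ^P j) n) ≡ combine r M n
combine-coeff r zero    n = ≡.refl
combine-coeff r (suc M) n = ≡.trans (cong₂ ℤ._+_ (combine-coeff r M n)
    (≡.trans (cong (λ z → r (suc M) ℤ.* z) (X^≈ (suc M) n)) (≡.sym (constP-· (r (suc M)) (X₁ ^ suc M) n))))
  (≡.sym (⊕-at (combine r M) (ι (r (suc M)) * X₁ ^ suc M) n))

-- U(X^i) and U(ξX^i); the factor `1#` gives the first the form required by `V-recurrence`.
fa fb : ℕ → PS
fa i = V 0 (1# * X₁ ^ i)
fb i = V 2 (Z * X₁ ^ i)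

fa₀ : fa 0 ≈ 1#
fa₀ = trans (V-cong 0 (*-identityˡ 1#)) (trans (V-q^ 0 0 (+ 1) ≡.refl (λ _ → ≡.refl)) ι-1)

:horner : ∀ {n} → List ℤ → Polynomial n → Polynomial n
:horner []       x = con (+ 0)
:horner (c ∷ cs) x = con c :+ x :* :horner cs x

:C₁ :C₂ : ∀ {n} → Polynomial n → Polynomial n
:C₁ x = con (+ 30) :* x :- con (+ 108) :* x :^ 2 :+ con (+ 81) :* x :^ 3
:C₂ x = con (+ 9) :* x :^ 2 :- con (+ 12) :* x

drop₀ : ∀ l → horner (+ 0 ∷ l) X₁ ≈ X₁ * horner l X₁
drop₀ l = trans (+-congʳ ι-0) (+-identityˡ _)

la₁ : List ℤ
la₁ = + 10 ∷ neg (+ 36) ∷ + 27 ∷ []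

la₂ : List ℤ
la₂ = neg (+ 8) ∷ + 306 ∷ neg (+ 2160) ∷ + 5508 ∷ neg (+ 5832) ∷ + 2187 ∷ []

la₃ : List ℤ
la₃ = + 1 ∷ neg (+ 360) ∷ + 10566 ∷ neg (+ 99144) ∷ + 423549 ∷ neg (+ 944784) ∷ + 1141614 ∷ neg (+ 708588) ∷ + 177147 ∷ []

lb₁ : List ℤ
lb₁ = neg (+ 9) ∷ + 252 ∷ neg (+ 891) ∷ + 729 ∷ []

lb₂ : List ℤ
lb₂ = + 1 ∷ neg (+ 378) ∷ + 8613 ∷ neg (+ 54675) ∷ + 138510 ∷ neg (+ 150903) ∷ + 59049 ∷ []

lb₃ : List ℤ
lb₃ = + 0 ∷ + 147 ∷ neg (+ 14553) ∷ + 312255 ∷ neg (+ 2617839) ∷ + 10764414 ∷ neg (+ 23914845) ∷ + 29288304 ∷ neg (+ 18600435) ∷ + 4782969 ∷ []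

fa₁ : fa 1 ≈ X₁ * horner la₁ X₁
fa₁ = trans (V-cong 0 (trans (*-identityˡ _) (*-identityʳ X₁))) (trans (V₀-split {p₀ = + 0 ∷ la₁} {+ 0 ∷ + 8 ∷ neg (+ 54) ∷ + 54 ∷ []} {+ 0 ∷ + 4 ∷ neg (+ 72) ∷ + 108 ∷ []} (L.split-X U≈ W≈ Yκ)) (drop₀ la₁))

fa₂ : fa 2 ≈ X₁ * horner la₂ X₁
fa₂ = trans (V-cong 0 (*-identityˡ _)) (trans (V₀-split {p₀ = + 0 ∷ la₂} {+ 0 ∷ neg (+ 2) ∷ + 234 ∷ neg (+ 2484) ∷ + 8100 ∷ neg (+ 10206) ∷ + 4374 ∷ []} {+ 0 ∷ + 0 ∷ + 144 ∷ neg (+ 2592) ∷ + 11340 ∷ neg (+ 17496) ∷ + 8748 ∷ []} (L.split-X² U≈ W≈ Yκ)) (drop₀ la₂))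

-- The cubic equation already gives row 3 when started at U(1) = 1. This value has a nonzero
-- constant term, which the matrix cannot store as its row 0.
fa₃ : fa 3 ≈ X₁ * horner la₃ X₁
fa₃ = begin
  fa 3 ≈⟨ V-recurrence 0 1# 0 (s≤s z≤n) ⟩
  C₁ * fa 2 + C₂ * fa 1 + X₁ * fa 0
    ≈⟨ +-cong (+-cong (*-congˡ fa₂) (*-congˡ fa₁)) (*-congˡ fa₀) ⟩
  C₁ * (X₁ * horner la₂ X₁) + C₂ * (X₁ * horner la₁ X₁) + X₁ * 1#
    ≈⟨ solve 1 (λ x → :C₁ x :* (x :* :horner la₂ x) :+ :C₂ x :* (x :* :horner la₁ x) :+ x :* :1
         := x :* :horner la₃ x) refl X₁ ⟩
  X₁ * horner la₃ X₁ ∎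

-- The multiplier G(q³)² that makes q²ξ polynomial in Y and v passes through `V 2` as G². The
-- section of v² produces another G², so the two cancel, and finally the factor 4 is removed.
fb-scaled : ∀ k p₀ p₁ p₂ l → L.weight U≈ W≈ Yκ * X₁ ^ k ≈ horner p₀ X₃ + horner p₁ X₃ * v + horner p₂ X₃ * v ^ 2 →
  horner p₂ X₁ ≈ ι (+ 4) * (X₁ * horner l X₁) → fb k ≈ X₁ * horner l X₁
fb-scaled k p₀ p₁ p₂ l F≈ p₂≈ = cancel-ι (+ 4) (begin
  ι (+ 4) * fb k
    ≈⟨ sym (V-scale 2 (+ 4) _) ⟩
  V 2 (ι (+ 4) * (Z * X₁ ^ k))
    ≈⟨ sym (*-identityˡ _) ⟩
  1# * V 2 (ι (+ 4) * (Z * X₁ ^ k))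
    ≈⟨ *-congʳ (sym GG) ⟩
  G⁻² * G ^ 2 * V 2 (ι (+ 4) * (Z * X₁ ^ k))
    ≈⟨ *-assoc G⁻² (G ^ 2) _ ⟩
  G⁻² * (G ^ 2 * V 2 (ι (+ 4) * (Z * X₁ ^ k)))
    ≈⟨ *-congˡ (sym (V-D* 2 (G ^ 2) _ (s≤s (s≤s (s≤s z≤n))))) ⟩
  G⁻² * V 2 (D (G ^ 2) * (ι (+ 4) * (Z * X₁ ^ k)))
    ≈⟨ *-congˡ (V-cong 2 (trans (*-congʳ (trans (D.D-^ G 2) (^-congˡ 2 D-G)))
         (solve 4 (λ g c z x → g :* (c :* (z :* x)) := c :* (z :* g) :* x) refl (eval L.gm ^ 2) (ι (+ 4)) Z (X₁ ^ k)))) ⟩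
  G⁻² * V 2 (L.weight U≈ W≈ Yκ * X₁ ^ k)
    ≈⟨ *-congˡ (V₂-split {p₀ = p₀} {p₁} {p₂} F≈) ⟩
  G⁻² * (horner p₂ X₁ * G ^ 2)
    ≈⟨ trans (solve 3 (λ a b c → a :* (b :* c) := a :* c :* b) refl G⁻² (horner p₂ X₁) (G ^ 2)) (trans (*-congʳ GG) (*-identityˡ _)) ⟩
  horner p₂ X₁
    ≈⟨ p₂≈ ⟩
  ι (+ 4) * (X₁ * horner l X₁) ∎)
  where
  G⁻² : PS
  G⁻² = eval ((η⁻ 0F ⊗ η⁻ 3F ↑ 3 ⊗ η 1F ⊗ η 2F ↑ 3) ↑ 2)
  GG : G⁻² * G ^ 2 ≈ 1#
  GG = mono ((η⁻ 0F ⊗ η⁻ 3F ↑ 3 ⊗ η 1F ⊗ η 2F ↑ 3) ↑ 2 ⊗ (η 0F ⊗ η 3F ↑ 3 ⊗ η⁻ 1F ⊗ η⁻ 2F ↑ 3) ↑ 2) (η 0F ↑ 0) ≡.refl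

fb₀ : fb 0 ≈ X₁ * horner (+ 9 ∷ []) X₁
fb₀ = fb-scaled 0
  (neg (+ 5) ∷ + 9 ∷ [])
  (neg (+ 2) ∷ + 18 ∷ [])
  (+ 0 ∷ + 36 ∷ [])
  (+ 9 ∷ []) (trans (*-identityʳ _) (L.split-weight U≈ W≈ Yκ))
  (trans (drop₀ (+ 36 ∷ [])) (solve 1 (λ x → x :* :horner (+ 36 ∷ []) x := con (+ 4) :* (x :* :horner (+ 9 ∷ []) x)) refl X₁))

fb₁ : fb 1 ≈ X₁ * horner lb₁ X₁
fb₁ = fb-scaled 1
  (+ 1 ∷ neg (+ 114) ∷ + 765 ∷ neg (+ 1377) ∷ + 729 ∷ [])
  (+ 0 ∷ neg (+ 78) ∷ + 936 ∷ neg (+ 2268) ∷ + 1458 ∷ [])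
  (+ 0 ∷ neg (+ 36) ∷ + 1008 ∷ neg (+ 3564) ∷ + 2916 ∷ [])
  lb₁ (trans (*-congˡ (*-identityʳ X₁)) (L.split-weight-X U≈ W≈ Yκ))
  (trans (drop₀ (neg (+ 36) ∷ + 1008 ∷ neg (+ 3564) ∷ + 2916 ∷ [])) (solve 1 (λ x → x :* :horner (neg (+ 36) ∷ + 1008 ∷ neg (+ 3564) ∷ + 2916 ∷ []) x := con (+ 4) :* (x :* :horner lb₁ x)) refl X₁))

fb₂ : fb 2 ≈ X₁ * horner lb₂ X₁
fb₂ = fb-scaled 2
  (+ 0 ∷ + 85 ∷ neg (+ 3672) ∷ + 35424 ∷ neg (+ 133164) ∷ + 232551 ∷ neg (+ 190269) ∷ + 59049 ∷ [])
  (+ 0 ∷ + 26 ∷ neg (+ 2592) ∷ + 36666 ∷ neg (+ 175446) ∷ + 364500 ∷ neg (+ 341172) ∷ + 118098 ∷ [])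
  (+ 0 ∷ + 4 ∷ neg (+ 1512) ∷ + 34452 ∷ neg (+ 218700) ∷ + 554040 ∷ neg (+ 603612) ∷ + 236196 ∷ [])
  lb₂ (trans refl (L.split-weight-X² U≈ W≈ Yκ))
  (trans (drop₀ (+ 4 ∷ neg (+ 1512) ∷ + 34452 ∷ neg (+ 218700) ∷ + 554040 ∷ neg (+ 603612) ∷ + 236196 ∷ [])) (solve 1 (λ x → x :* :horner (+ 4 ∷ neg (+ 1512) ∷ + 34452 ∷ neg (+ 218700) ∷ + 554040 ∷ neg (+ 603612) ∷ + 236196 ∷ []) x := con (+ 4) :* (x :* :horner lb₂ x)) refl X₁))

-- Row 3 comes from the cubic equation started at U(ξ) = 9X.
fb₃ : fb 3 ≈ X₁ * horner lb₃ X₁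
fb₃ = begin
  fb 3 ≈⟨ V-recurrence 2 Z 0 (s≤s (s≤s (s≤s z≤n))) ⟩
  C₁ * fb 2 + C₂ * fb 1 + X₁ * fb 0
    ≈⟨ +-cong (+-cong (*-congˡ fb₂) (*-congˡ fb₁)) (*-congˡ fb₀) ⟩
  C₁ * (X₁ * horner lb₂ X₁) + C₂ * (X₁ * horner lb₁ X₁) + X₁ * (X₁ * horner (+ 9 ∷ []) X₁)
    ≈⟨ solve 1 (λ x → :C₁ x :* (x :* :horner lb₂ x) :+ :C₂ x :* (x :* :horner lb₁ x) :+ x :* (x :* :horner (+ 9 ∷ []) x)
         := x :* :horner lb₃ x) refl X₁ ⟩
  X₁ * horner lb₃ X₁ ∎

module RowsA = Rows la₁ la₂ la₃ (ℕₚ.m≤m+n 3 1) (ℕₚ.m≤m+n 6 1) (ℕₚ.m≤m+n 9 1) fa fa₁ fa₂ fa₃ (λ i → V-recurrence 0 1# i (s≤s z≤n))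
module RowsB = Rows lb₁ lb₂ lb₃ ℕₚ.≤-refl ℕₚ.≤-refl ℕₚ.≤-refl fb fb₁ fb₂ fb₃ (λ i → V-recurrence 2 Z i (s≤s (s≤s (s≤s z≤n))))

-- Comparison of coefficients

sumX-+ : ∀ m i n → sumX m i (+ n) ≡ combine (m i) (3 ℕ.* i ℕ.+ 1) n
sumX-+ m i n = combine-coeff (m i) (3 ℕ.* i ℕ.+ 1) n

sumX-neg : ∀ m i n → sumX m i -[1+ n ] ≡ + 0
sumX-neg m i n = vanish (3 ℕ.* i ℕ.+ 1)
  where
  vanish : ∀ M → sum1To M (λ j → m i j ℤ.* + 0) ≡ + 0
  vanish zero    = ≡.refl
  vanish (suc M) = cong₂ ℤ._+_ (vanish M) (ℤₚ.*-zeroʳ (m i (suc M)))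

3n≡ : ∀ n → + 3 ℤ.* + n ≡ + (n ℕ.* 3 ℕ.+ 0)
3n≡ n = ≡.trans (≡.sym (ℤₚ.pos-* 3 n)) (cong +_ (≡.trans (ℕₚ.*-comm 3 n) (≡.sym (ℕₚ.+-identityʳ _))))

3n+2≡ : ∀ n → + 3 ℤ.* + n ℤ.- ℤ.- (+ 2) ≡ + (n ℕ.* 3 ℕ.+ 2)
3n+2≡ n = cong (ℤ._+ + 2) (≡.trans (3n≡ n) (cong +_ (ℕₚ.+-identityʳ (n ℕ.* 3))))

-- For a negative index the exponent stays negative even after the shift by 2, so the pole q^(-2) of
-- ξ leaves no trace after U.
3[-1-n]+2≡ : ∀ n → + 3 ℤ.* -[1+ n ] ℤ.- ℤ.- (+ 2) ≡ -[1+ n ℕ.* 3 ]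
3[-1-n]+2≡ n = ≡.trans (cong (ℤ._+ + 2) 3[-1-n]) ≡.refl
  where
  3[-1-n] : + 3 ℤ.* -[1+ n ] ≡ -[1+ suc (suc (n ℕ.* 3)) ]
  3[-1-n] = cong ℤ.-_ (cong +_ (ℕₚ.*-comm 3 (suc n)))

theorem2p5 : (i : ℕ) → 1 ≤ i → (n : ℤ) →
    (U (X^ i) n ≡ sumX a i n) × (U (ξX^ i) n ≡ sumX b i n)
theorem2p5 (suc i) _ (+ n) =
    ≡.trans (cong (X^ (suc i)) (3n≡ n)) (≡.trans (trans (X^≈ (suc i)) (sym (*-identityˡ _)) (n ℕ.* 3 ℕ.+ 0))
      (≡.trans (≡.sym (RowsA.rows i (3 ℕ.* suc i ℕ.+ 1) enough n)) (≡.sym (sumX-+ a (suc i) n))))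
  , ≡.trans (cong (toLS (q2ξ *P (X ^P suc i))) (3n+2≡ n)) (≡.trans (*P≈* q2ξ≈ (X^≈ (suc i)) (n ℕ.* 3 ℕ.+ 2))
      (≡.trans (≡.sym (RowsB.rows i (3 ℕ.* suc i ℕ.+ 1) enough n)) (≡.sym (sumX-+ b (suc i) n))))
  where
  enough : suc i ℕ.* 3 ℕ.+ 1 ≤ 3 ℕ.* suc i ℕ.+ 1
  enough = ℕₚ.≤-reflexive (cong (ℕ._+ 1) (ℕₚ.*-comm (suc i) 3))
theorem2p5 i _ -[1+ n ] =
    ≡.sym (sumX-neg a i n)
  , ≡.trans (cong (toLS (q2ξ *P (X ^P i))) (3[-1-n]+2≡ n)) (≡.sym (sumX-neg b i n))
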